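{- Let $T$ be a set of transpositions in the symmetric group $S_n$. Then: (a) If $G_T$ is a connected graph with a cut vertex $v$, then $\mathrm{Cay}(S_n,T)$ is integral if and only if $v$ is a complete vertex of $G_T$ and $\mathrm{Cay}(S_n,T')$ is integral, where $T'$ is the set of transpositions in $S_n$ such that $G_{T'}=(G_T-v)+v$, i.e. $G_{T'}$ is obtained from $G_T$ by deleting the vertex $v$ (with all its incident edges) and then adding $v$ back as an isolated vertex. (b) If $G_T$ is a tree, then $\mathrm{Cay}(S_n,T)$ is integral if and only if $G_T$ is (isomorphic to) the star graph $K_{1,n-1}$.
   Context: $S_n$ is the symmetric group on $[n]=\{1,\dots,n\}$. For a group $G$ and an inverse-closed subset $S\subseteq G$ not containing the identity, $\mathrm{Cay}(G,S)$ is the graph with vertex set $G$ in which $g_1,g_2$ are adjacent if and only if $g_1g_2^{ -1}\in S$. For a set $T$ of transpositions in $S_n$, $G_T$ is the graph with vertex set $[n]$ in which $i,j$ are adjacent if and only if $(i,j)\in T$. A finite simple graph is integral if all eigenvalues of its adjacency matrix are integers. A vertex $v$ of a graph $\Gamma$ is a complete vertex if it is adjacent to every vertex $u\neq v$ of $\Gamma$. A cut vertex of $\Gamma$ is a vertex $v$ such that $\Gamma-v$ has more connected components than $\Gamma$. -}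

module Defs where

open import Algebra.Apartness.Bundles using (HeytingField; HeytingCommutativeRing)
open import Algebra.Bundles using (Group; CommutativeRing)
import Algebra.Properties.CommutativeMonoid.Sum as Sum
import Algebra.Properties.Group as GroupProperties
import Algebra.Properties.Monoid.Mult as Mult
open import Data.Empty using (⊥)
open import Data.Fin.Base
  using (Fin; zero; suc; inject₁; fromℕ; punchIn; combine; remQuot)
import Data.Fin.Properties as Fin
open import Data.Fin.Permutation as Perm
  using (Permutation′; _⟨$⟩ʳ_; _⟨$⟩ˡ_; _∘ₚ_; flip; transpose; insert; remove)
open import Data.Integer.Base using (ℤ; +_; -[1+_])
open import Data.Nat.Base using (ℕ; zero; suc; pred; _<_; _!)
open import Data.Product.Base using (Σ; ∃₂; ∃-syntax; _×_; _,_)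
open import Data.Sum.Base using (_⊎_; inj₁; inj₂)
open import Data.Unit.Base using (⊤; tt)
open import Function.Bundles using (Inverse; _⇔_)
open import Function.Definitions using (Injective; Surjective)
open import Level using (0ℓ)
open import Relation.Binary.Bundles using (Setoid)
open import Relation.Binary.Core using (Rel)
open import Relation.Binary.Definitions
  using (Decidable; Symmetric; Irreflexive; _Respects_; _Respects₂_)
open import Relation.Binary.Construct.Closure.ReflexiveTransitive using (Star)
open import Relation.Binary.PropositionalEquality as ≡ using (_≡_; _≢_)
open import Relation.Nullary using (¬_; yes; no; contradiction)
open import Relation.Nullary.Decidable using (does; ¬?; _×-dec_)
open import Data.Bool.Base using (if_then_else_)
open import Relation.Unary using (Pred) renaming (Decidable to Decidable₁)

------------------------------------------------------------------------
-- Finite simple graphs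

-- Adjacency in a finite graph is decidable; classically this is no restriction.
record SimpleGraph (V : Setoid 0ℓ 0ℓ) : Set₁ where
  open Setoid V using (Carrier; _≈_)
  infix 4 _~_ _~?_
  field
    _~_      : Rel Carrier 0ℓ
    _~?_     : Decidable _~_
    ~-resp   : _~_ Respects₂ _≈_
    ~-sym    : Symmetric _~_
    ~-irrefl : Irreflexive _≈_ _~_

record Finite (V : Setoid 0ℓ 0ℓ) : Set where
  field
    size        : ℕ
    enumeration : Inverse (≡.setoid (Fin size)) V

infix 4 _≅_ _≐_

record _≅_ {V W : Setoid 0ℓ 0ℓ} (Γ : SimpleGraph V) (Δ : SimpleGraph W) : Set where
  private
    module Γ = SimpleGraph Γ
    module Δ = SimpleGraph Δ
  field
    bijection : Inverse V W
  open Inverse bijection using (to)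
  field
    adjacency : ∀ u v → u Γ.~ v ⇔ to u Δ.~ to v

-- The complete bipartite graph K_{a,b}.
K : (a b : ℕ) → SimpleGraph (≡.setoid (Fin a ⊎ Fin b))
K a b = record
  { _~_      = adj
  ; _~?_     = λ { (inj₁ _) (inj₁ _) → no λ ()
                 ; (inj₁ _) (inj₂ _) → yes tt
                 ; (inj₂ _) (inj₁ _) → yes tt
                 ; (inj₂ _) (inj₂ _) → no λ () }
  ; ~-resp   = (λ { ≡.refl p → p }) , (λ { ≡.refl p → p })
  ; ~-sym    = λ { {inj₁ _} {inj₂ _} p → p ; {inj₂ _} {inj₁ _} p → p }
  ; ~-irrefl = λ { {inj₁ _} ≡.refl () ; {inj₂ _} ≡.refl () }
  }
  where
  adj : Rel (Fin a ⊎ Fin b) 0ℓ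
  adj (inj₁ _) (inj₁ _) = ⊥
  adj (inj₁ _) (inj₂ _) = ⊤
  adj (inj₂ _) (inj₁ _) = ⊤
  adj (inj₂ _) (inj₂ _) = ⊥

------------------------------------------------------------------------
-- Graphs on the vertex set Fin n

Graph : ℕ → Set₁
Graph n = SimpleGraph (≡.setoid (Fin n))

_≐_ : ∀ {n} → Graph n → Graph n → Set
Γ ≐ Δ = ∀ i j → SimpleGraph._~_ Γ i j ⇔ SimpleGraph._~_ Δ i j

module _ {n : ℕ} (Γ : Graph n) where
  open SimpleGraph Γ

  Reachable : Rel (Fin n) 0ℓ
  Reachable = Star _~_

  -- A connected graph has at least one vertex.
  Connected : Set
  Connected = Fin n × (∀ i j → Reachable i j)

  HasComponents : ℕ → Set
  HasComponents k = ∃[ c ] Surjective {A = Fin n} {B = Fin k} _≡_ _≡_ c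
                         × (∀ i j → c i ≡ c j ⇔ Reachable i j)

  IsComplete : Fin n → Set
  IsComplete v = ∀ u → u ≢ v → v ~ u

  -- A cycle c 0 ~ c 1 ~ … ~ c (m + 2) ~ c 0 through m + 3 distinct vertices.
  record Cycle : Set where
    field
      m         : ℕ
      c         : Fin (suc (suc (suc m))) → Fin n
      injective : Injective _≡_ _≡_ c
      steps     : ∀ i → c (inject₁ i) ~ c (suc i)
      closing   : c (fromℕ (suc (suc m))) ~ c zero

  IsTree : Set
  IsTree = Connected × ¬ Cycle

-- Γ − v, with the vertices other than v numbered by punchIn v.
delete : ∀ {n} → Graph n → Fin n → Graph (pred n)
delete {suc n} Γ v = record
  { _~_      = λ i j → punchIn v i ~ punchIn v j
  ; _~?_     = λ i j → punchIn v i ~? punchIn v j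
  ; ~-resp   = (λ { ≡.refl p → p }) , (λ { ≡.refl p → p })
  ; ~-sym    = ~-sym
  ; ~-irrefl = λ { ≡.refl → ~-irrefl ≡.refl }
  }
  where open SimpleGraph Γ

IsCutVertex : ∀ {n} → Graph n → Fin n → Set
IsCutVertex Γ v = ∃₂ λ k k′ → HasComponents Γ k × HasComponents (delete Γ v) k′ × k < k′

-- (Γ − v) + v: the edges of Γ avoiding v, on the vertex set of Γ.
isolate : ∀ {n} → Graph n → Fin n → Graph n
isolate Γ v = record
  { _~_      = λ i j → i ≢ v × j ≢ v × i ~ j
  ; _~?_     = λ i j → ¬? (i Fin.≟ v) ×-dec (¬? (j Fin.≟ v) ×-dec (i ~? j))
  ; ~-resp   = (λ { ≡.refl p → p }) , (λ { ≡.refl p → p })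
  ; ~-sym    = λ (i≢v , j≢v , i~j) → j≢v , i≢v , ~-sym i~j
  ; ~-irrefl = λ { ≡.refl (_ , _ , i~i) → ~-irrefl ≡.refl i~i }
  }
  where open SimpleGraph Γ

------------------------------------------------------------------------
-- Eigenvalues and integral graphs

module Spectrum (F : HeytingField 0ℓ 0ℓ 0ℓ) where
  open HeytingField F renaming (_*_ to _·_)
  open HeytingCommutativeRing (HeytingField.heytingCommutativeRing F) using (commutativeRing)
  open CommutativeRing commutativeRing using (+-commutativeMonoid; +-monoid)
  open Sum +-commutativeMonoid using (sum-syntax)
  open Mult +-monoid using () renaming (_×_ to _⨯_)

  CharacteristicZero : Set
  CharacteristicZero = ∀ n → (suc n ⨯ 1#) # 0#

  fromℤ : ℤ → Carrier
  fromℤ (+ n)    = n ⨯ 1#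
  fromℤ -[1+ n ] = - (suc n ⨯ 1#)

  IsInteger : Carrier → Set
  IsInteger x = ∃[ k ] x ≈ fromℤ k

  Matrix : ℕ → Set
  Matrix n = Fin n → Fin n → Carrier

  IsEigenvalue : ∀ {n} → Matrix n → Carrier → Set
  IsEigenvalue {n} M μ = Σ (Fin n → Carrier) λ x →
    (∃[ i ] x i # 0#) × (∀ i → ∑[ j < n ] (M i j · x j) ≈ μ · x i)

  adjacencyMatrix : ∀ {V} (fin : Finite V) → SimpleGraph V → Matrix (Finite.size fin)
  adjacencyMatrix fin Γ i j = if does (to i ~? to j) then 1# else 0#
    where
    open SimpleGraph Γ
    open Inverse (Finite.enumeration fin) using (to)

-- There is no ℂ in which to take the eigenvalues of the (integer) adjacency
-- matrix, so they are taken in all fields of characteristic zero.  Classically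
-- this is the usual notion: if all complex eigenvalues are integers, then the
-- characteristic polynomial is a product of factors X − k with k ∈ ℤ, so its
-- roots in any field of characteristic zero are integers as well.
Integral : ∀ {V} → Finite V → SimpleGraph V → Set₁
Integral fin Γ = (F : HeytingField 0ℓ 0ℓ 0ℓ) → let open Spectrum F in
  CharacteristicZero → ∀ μ → IsEigenvalue (adjacencyMatrix fin Γ) μ → IsInteger μ

------------------------------------------------------------------------
-- Cayley graphs

record ConnectionSet (G : Group 0ℓ 0ℓ) : Set₁ where
  open Group G
  field
    _∈S       : Pred Carrier 0ℓ
    _∈S?      : Decidable₁ _∈S
    ∈S-resp   : _∈S Respects _≈_
    ε∉S       : ¬ ε ∈S
    ⁻¹-closed : ∀ {g} → g ∈S → (g ⁻¹) ∈S

Cay : (G : Group 0ℓ 0ℓ) → ConnectionSet G → SimpleGraph (Group.setoid G)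
Cay G S = record
  { _~_      = λ g h → (g ∙ h ⁻¹) ∈S
  ; _~?_     = λ g h → (g ∙ h ⁻¹) ∈S?
  ; ~-resp   = (λ h≈h′ → ∈S-resp (∙-congˡ (⁻¹-cong h≈h′)))
             , (λ g≈g′ → ∈S-resp (∙-congʳ g≈g′))
  ; ~-sym    = λ {g} {h} p → ∈S-resp
      (trans (⁻¹-anti-homo-∙ g (h ⁻¹)) (∙-congʳ (⁻¹-involutive h))) (⁻¹-closed p)
  ; ~-irrefl = λ {g} {h} g≈h p → ε∉S
      (∈S-resp (trans (∙-congʳ g≈h) (inverseʳ h)) p)
  }
  where
  open Group G
  open GroupProperties G
  open ConnectionSet S

------------------------------------------------------------------------
-- The symmetric group

-- The product g ∙ h is "first h, then g"; ∘ₚ composes in the opposite order.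
Sym : ℕ → Group 0ℓ 0ℓ
Sym n = record
  { Carrier = Permutation′ n
  ; _≈_     = Perm._≈_
  ; _∙_     = λ g h → h ∘ₚ g
  ; ε       = Perm.id
  ; _⁻¹     = flip
  ; isGroup = record
    { isMonoid = record
      { isSemigroup = record
        { isMagma = record
          { isEquivalence = record
            { refl  = λ _ → ≡.refl
            ; sym   = λ p i → ≡.sym (p i)
            ; trans = λ p q i → ≡.trans (p i) (q i)
            }
          ; ∙-cong = λ {g} {g′} {h} {h′} p q i →
              ≡.trans (≡.cong (g ⟨$⟩ʳ_) (q i)) (p (h′ ⟨$⟩ʳ i))
          }
        ; assoc = λ _ _ _ _ → ≡.refl
        }
      ; identity = (λ _ _ → ≡.refl) , (λ _ _ → ≡.refl)
      }
    ; inverse = (λ g _ → Perm.inverseˡ g) , (λ g _ → Perm.inverseʳ g)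
    ; ⁻¹-cong = λ {g} {h} p i →
        ≡.trans (≡.cong (g ⟨$⟩ˡ_) (≡.sym (≡.trans (p (h ⟨$⟩ˡ i)) (Perm.inverseʳ h))))
                (Perm.inverseˡ g)
    }
  }

remove-cong : ∀ {n} (π ρ : Permutation′ (suc n)) → π Perm.≈ ρ →
              remove zero π Perm.≈ remove zero ρ
remove-cong π ρ π≈ρ j = Fin.punchIn-injective (π ⟨$⟩ʳ zero) _ _ (begin
  punchIn (π ⟨$⟩ʳ zero) (remove zero π ⟨$⟩ʳ j) ≡⟨ Perm.punchIn-permute π zero j ⟨
  π ⟨$⟩ʳ suc j                                 ≡⟨ π≈ρ (suc j) ⟩
  ρ ⟨$⟩ʳ suc j                                 ≡⟨ Perm.punchIn-permute ρ zero j ⟩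
  punchIn (ρ ⟨$⟩ʳ zero) (remove zero ρ ⟨$⟩ʳ j)
    ≡⟨ ≡.cong (λ k → punchIn k (remove zero ρ ⟨$⟩ʳ j)) (π≈ρ zero) ⟨
  punchIn (π ⟨$⟩ʳ zero) (remove zero ρ ⟨$⟩ʳ j) ∎)
  where open ≡.≡-Reasoning

insert-cong : ∀ {n} i (π ρ : Permutation′ n) → π Perm.≈ ρ →
              insert zero i π Perm.≈ insert zero i ρ
insert-cong i π ρ π≈ρ zero    = ≡.refl
insert-cong i π ρ π≈ρ (suc k) = ≡.cong (punchIn i) (π≈ρ k)

decode : ∀ n → Fin (n !) → Permutation′ n
decode zero    _ = Perm.id
decode (suc n) x = let i , y = remQuot (n !) x in insert zero i (decode n y)

encode : ∀ n → Permutation′ n → Fin (n !)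
encode zero    _ = zero
encode (suc n) π = combine (π ⟨$⟩ʳ zero) (encode n (remove zero π))

encode-cong : ∀ n π ρ → π Perm.≈ ρ → encode n π ≡ encode n ρ
encode-cong zero    _ _ _   = ≡.refl
encode-cong (suc n) π ρ π≈ρ = ≡.cong₂ combine (π≈ρ zero)
  (encode-cong n (remove zero π) (remove zero ρ) (remove-cong π ρ π≈ρ))

decode-encode : ∀ n π → decode n (encode n π) Perm.≈ π
decode-encode (suc n) π k = begin
  decode (suc n) (encode (suc n) π) ⟨$⟩ʳ k
    ≡⟨ ≡.cong (λ (i , y) → insert zero i (decode n y) ⟨$⟩ʳ k)
              (Fin.remQuot-combine π₀ (encode n π₁)) ⟩
  insert zero π₀ (decode n (encode n π₁)) ⟨$⟩ʳ k
    ≡⟨ insert-cong π₀ (decode n (encode n π₁)) π₁ (decode-encode n π₁) k ⟩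
  insert zero π₀ π₁ ⟨$⟩ʳ k
    ≡⟨ Perm.insert-remove zero π k ⟩
  π ⟨$⟩ʳ k ∎
  where
  open ≡.≡-Reasoning
  π₀ = π ⟨$⟩ʳ zero
  π₁ = remove zero π

encode-decode : ∀ n x → encode n (decode n x) ≡ x
encode-decode zero    zero = ≡.refl
encode-decode (suc n) x    = let i , y = remQuot {suc n} (n !) x in ≡.trans
  (≡.cong (combine i) (≡.trans
    (encode-cong n (remove zero (insert zero i (decode n y))) (decode n y)
      (Perm.remove-insert zero i (decode n y)))
    (encode-decode n y)))
  (Fin.combine-remQuot {suc n} (n !) x)

Sym-finite : ∀ n → Finite (Group.setoid (Sym n))
Sym-finite n = record
  { size        = n !
  ; enumeration = record
    { to        = decode n
    ; from      = encode n
    ; to-cong   = λ { ≡.refl _ → ≡.refl }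
    ; from-cong = λ {π} {ρ} → encode-cong n π ρ
    ; inverse   = (λ { {π} ≡.refl → decode-encode n π })
                , (λ {x} {π} π≈ → ≡.trans (encode-cong n π (decode n x) π≈) (encode-decode n x))
    }
  }

------------------------------------------------------------------------
-- Sets of transpositions

IsTransposition : ∀ {n} → Permutation′ n → Set
IsTransposition π = ∃₂ λ i j → i ≢ j × π Perm.≈ transpose i j

record TranspositionSet (n : ℕ) : Set₁ where
  field
    _∈T            : Pred (Permutation′ n) 0ℓ
    _∈T?           : Decidable₁ _∈T
    ∈T-resp        : _∈T Respects Perm._≈_
    transpositions : ∀ {π} → π ∈T → IsTransposition π

transpose-sym : ∀ {n} (i j : Fin n) → transpose i j Perm.≈ transpose j i
transpose-sym i j k with k Fin.≟ i
transpose-sym i j k | yes k≡i with k Fin.≟ j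
... | yes k≡j = ≡.trans (≡.sym k≡j) k≡i
... | no  _ with k Fin.≟ i
...   | yes _   = ≡.refl
...   | no  k≢i = contradiction k≡i k≢i
transpose-sym i j k | no k≢i with k Fin.≟ j
... | yes _ = ≡.refl
... | no  _ with k Fin.≟ i
...   | yes k≡i = contradiction k≡i k≢i
...   | no  _   = ≡.refl

transpose-matchˡ : ∀ {n} (i j : Fin n) → transpose i j ⟨$⟩ʳ i ≡ j
transpose-matchˡ i j with i Fin.≟ i
... | yes _   = ≡.refl
... | no  i≢i = contradiction ≡.refl i≢i

transpose-refl : ∀ {n} (i : Fin n) → transpose i i Perm.≈ Perm.id
transpose-refl i k with k Fin.≟ i
... | yes k≡i = ≡.sym k≡i
... | no  k≢i with k Fin.≟ i
...   | yes k≡i = ≡.sym k≡i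
...   | no  _   = ≡.refl

id-not-transposition : ∀ {n} → ¬ IsTransposition (Perm.id {n})
id-not-transposition (i , j , i≢j , id≈) = i≢j (≡.trans (id≈ i) (transpose-matchˡ i j))

connectionSet : ∀ {n} → TranspositionSet n → ConnectionSet (Sym n)
connectionSet {n} T = record
  { _∈S       = _∈T
  ; _∈S?      = _∈T?
  ; ∈S-resp   = ∈T-resp
  ; ε∉S       = λ p → id-not-transposition (transpositions p)
  ; ⁻¹-closed = λ {g} p → let i , j , _ , g≈ = transpositions p in
      ∈T-resp (≈.trans {g} {transpose i j} {flip g} g≈
              (≈.trans {transpose i j} {transpose j i} {flip g} (transpose-sym i j)
                 (≈.sym {flip g} {transpose j i} (⁻¹-cong {g} {transpose i j} g≈)))) p
  }
  where
  open TranspositionSet T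
  module ≈ = Setoid (Group.setoid (Sym n))
  open Group (Sym n) using (⁻¹-cong)

CaySym : ∀ {n} → TranspositionSet n → SimpleGraph (Group.setoid (Sym n))
CaySym {n} T = Cay (Sym n) (connectionSet T)

-- The graph G_T.  As transpose i i is the identity, there are no loops.
G[_] : ∀ {n} → TranspositionSet n → Graph n
G[ T ] = record
  { _~_      = λ i j → transpose i j ∈T
  ; _~?_     = λ i j → transpose i j ∈T?
  ; ~-resp   = (λ { ≡.refl p → p }) , (λ { ≡.refl p → p })
  ; ~-sym    = λ {i} {j} → ∈T-resp {transpose i j} {transpose j i} (transpose-sym i j)
  ; ~-irrefl = λ { {i} ≡.refl p →
      id-not-transposition (transpositions {Perm.id} (∈T-resp {transpose i i} {Perm.id} (transpose-refl i) p)) }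
  }
  where open TranspositionSet T

IntegralCay : ∀ {n} → TranspositionSet n → Set₁
IntegralCay {n} T = Integral (Sym-finite n) (CaySym T)

{-# OPTIONS --safe #-}

-- Let A_T be the adjacency operator on functions on S_n, the sum of the
-- transpositions in T.
--
-- If v is a complete vertex then A_T = A_T′ + J with J the Jucys–Murphy element of
-- v, which commutes with A_T′.  By the degenerate Hecke relations, and since J is
-- symmetric over ℤ, J is annihilated by a product of factors J − k for distinct
-- integers k; so eigenvectors of A_T or A_T′ over any field of characteristic zero
-- may be assumed to be eigenvectors of J, and T is integral iff T′ is.
--
-- Functions of the image of a point show that the Laplacian of an integral G_T has
-- only integer eigenvalues over every field of characteristic zero.  Applying this
-- to fields ℚ[X]/Ann(w), any nonzero subspace of ℚⁿ stable under the Laplacian L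
-- contains an eigenvector of L with an integer eigenvalue.  If G_T is connected,
-- projecting off such eigenvectors one at a time gives x·Lx ≥ x·x for all x ⊥ 1.
-- If v separates the other vertices into A and B, the vector with values |B| on A,
-- −|A| on B and 0 at v violates this unless v is complete.
--
-- In a tree with at least three vertices a vertex with two neighbours separates.

module Submission where

open import Defs
open import Algebra.Apartness.Bundles using (HeytingField; HeytingCommutativeRing)
import Algebra.Apartness.Properties.HeytingCommutativeRing
open import Algebra.Bundles using (CommutativeRing)
import Algebra.Properties.Ring
import Algebra.Properties.Semiring.Mult
import Algebra.Properties.Semiring.Sum
import Algebra.Solver.Ring
open import Algebra.Solver.Ring.AlmostCommutativeRing
  using (fromCommutativeRing; AlmostCommutativeRing; _-Raw-AlmostCommutative⟶_)
open import Data.Bool.Base using (Bool; true; false; not; if_then_else_)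
open import Data.Empty using (⊥)
open import Data.Fin.Base as Fin using (Fin; zero; suc; punchIn; punchOut; inject₁; fromℕ; toℕ)
open import Data.Fin.Permutation as Perm
  using (Permutation′; _⟨$⟩ʳ_; _⟨$⟩ˡ_; _∘ₚ_; flip; transpose)
import Data.Fin.Properties as Fin
open import Data.Integer.Base as ℤ using (ℤ; 0ℤ; -[1+_])
import Data.Integer.Properties as ℤ
open import Data.List.Base using (List; []; _∷_; _++_; map; deduplicate)
open import Data.List.Membership.Propositional using (_∈_)
open import Data.List.Membership.Propositional.Properties
  using (∈-++⁺ˡ; ∈-++⁺ʳ; ∈-map⁺; ∈-deduplicate⁺)
open import Data.List.Relation.Unary.All using ([]; _∷_)
open import Data.List.Relation.Unary.AllPairs using ([]; _∷_)
open import Data.List.Relation.Unary.Any using (here; there)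
open import Data.List.Relation.Unary.Unique.DecPropositional.Properties ℤ._≟_ using (deduplicate-!)
open import Data.List.Relation.Unary.Unique.Propositional using (Unique)
open import Data.Maybe.Base using (Maybe; just; nothing)
open import Data.Nat.Base as ℕ using (ℕ; zero; suc; _!; _∸_)
import Data.Nat.Properties as ℕ
open import Data.Product.Base using (Σ; ∃; ∃₂; ∃-syntax; _×_; _,_; proj₁; proj₂)
import Data.Rational.Base as ℚ
import Data.Rational.Properties as ℚ
open import Data.Sum.Base using (_⊎_; inj₁; inj₂; [_,_]′)
open import Data.Vec.Base as Vec using (Vec; []; _∷_; toList)
open import Data.Vec.Functional using (insertAt)
open import Data.Vec.Functional.Properties using (insertAt-lookup; insertAt-punchIn)
open import Data.Vec.Relation.Unary.All using (All; []; _∷_)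
open import Data.Vec.Relation.Unary.All.Properties using (tabulate⁻)
open import Function.Base using (_∘_)
open import Function.Bundles using (_⇔_; mk⇔; Equivalence; Inverse; mk↔ₛ′)
open import Function.Definitions using (Injective)
open import Level using (0ℓ)
open import Relation.Binary.Construct.Closure.ReflexiveTransitive using (ε; _◅_; _◅◅_)
open import Relation.Binary.Definitions using (tri<; tri≈; tri>)
open import Relation.Binary.PropositionalEquality as ≡ using (_≡_; _≢_)
import Relation.Binary.Reasoning.Setoid
open import Relation.Nullary using (Dec; yes; no; does; ¬_; contradiction)
open import Relation.Nullary.Decidable using (decidable-stable; ¬?; _×-dec_)

-- Eigenvectors have to be produced constructively, without a spectral theorem. Integrality speaks
-- only about eigenvectors already present over some field, so the field is built together with its
-- eigenvector. Inside an invariant subspace, `w` is chosen with a monic annihilator of least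
-- degree; this makes ℚ[X]/Ann(w) a field without factoring any polynomial. There the class of X is
-- an eigenvalue of the Laplacian, hence an integer k, which says L w = k w. Least degrees and
-- connected components are found only up to double negation, which is harmless because the final
-- goal, adjacency to `v`, is decidable.
--
-- Semisimplicity of the Jucys-Murphy element comes from sums of squares over ℤ; the resulting
-- polynomial identity passes to every commutative ring, and characteristic zero keeps its roots
-- distinct.
--
-- The constant 1 in x·Lx ≥ x·x appears because an eigenvalue that is a positive integer is at least
-- 1. The bound is tight for the vector that separates A from B: x·Lx collects its squares at the
-- neighbours of `v` only, and x·x collects all of them.

-- Commutative rings: integers, indicator sums, linear operators and products of factors J - c.

module RingLemmas (R : CommutativeRing 0ℓ 0ℓ) where
  open CommutativeRing R public hiding (zero) renaming (_*_ to infixl 7 _·_)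
  open Algebra.Properties.Ring ring public
  open Algebra.Properties.Semiring.Sum semiring public
  open Algebra.Properties.Semiring.Mult semiring public
    using (×-homo-+; ×1-homo-*) renaming (_×_ to _⨯_)
  open Relation.Binary.Reasoning.Setoid setoid public

  -- Has the clauses of `fromℤ` but makes sense in any commutative ring; it is the coefficient map
  -- of `Solver`, so that integer constants may occur in solved identities.
  ι : ℤ → Carrier
  ι (ℤ.+ n)    = n ⨯ 1#
  ι -[1+ n ] = - (suc n ⨯ 1#)

  ι-neg : ∀ i → ι (ℤ.- i) ≈ - ι i
  ι-neg (ℤ.+ zero)  = sym -0#≈0#
  ι-neg (ℤ.+ suc n) = refl
  ι-neg -[1+ n ]  = sym (-‿involutive _)

  private
    cancelˡ : ∀ x y z → (x + y) - (x + z) ≈ y - z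
    cancelˡ x y z = begin
      (x + y) - (x + z)     ≈⟨ +-congˡ (-‿+-comm x z) ⟨
      (x + y) + (- x + - z) ≈⟨ +-congʳ (+-comm x y) ⟩
      (y + x) + (- x + - z) ≈⟨ +-assoc y x _ ⟩
      y + (x + (- x + - z)) ≈⟨ +-congˡ (+-assoc x (- x) (- z)) ⟨
      y + ((x - x) + - z)   ≈⟨ +-congˡ (+-congʳ (-‿inverseʳ x)) ⟩
      y + (0# + - z)        ≈⟨ +-congˡ (+-identityˡ _) ⟩
      y - z                 ∎

  ι-⊖ : ∀ m n → ι (m ℤ.⊖ n) ≈ m ⨯ 1# - n ⨯ 1#
  ι-⊖ m       zero    = sym (trans (+-congˡ -0#≈0#) (+-identityʳ _))
  ι-⊖ zero    (suc n) = sym (+-identityˡ _)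
  ι-⊖ (suc m) (suc n) = begin
    ι (suc m ℤ.⊖ suc n)     ≡⟨ ≡.cong ι (ℤ.[1+m]⊖[1+n]≡m⊖n m n) ⟩
    ι (m ℤ.⊖ n)             ≈⟨ ι-⊖ m n ⟩
    m ⨯ 1# - n ⨯ 1#         ≈⟨ cancelˡ 1# _ _ ⟨
    suc m ⨯ 1# - suc n ⨯ 1# ∎

  ι-+ : ∀ i j → ι (i ℤ.+ j) ≈ ι i + ι j
  ι-+ (ℤ.+ m)    (ℤ.+ n)    = ×-homo-+ 1# m n
  ι-+ (ℤ.+ m)    -[1+ n ] = ι-⊖ m (suc n)
  ι-+ -[1+ m ] (ℤ.+ n)    = trans (ι-⊖ n (suc m)) (+-comm _ _)
  ι-+ -[1+ m ] -[1+ n ] = begin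
    - (suc (suc (m ℕ.+ n)) ⨯ 1#)   ≡⟨ ≡.cong (λ k → - (suc k ⨯ 1#)) (ℕ.+-suc m n) ⟨
    - ((suc m ℕ.+ suc n) ⨯ 1#)     ≈⟨ -‿cong (×-homo-+ 1# (suc m) (suc n)) ⟩
    - (suc m ⨯ 1# + suc n ⨯ 1#)    ≈⟨ -‿+-comm _ _ ⟨
    - (suc m ⨯ 1#) - (suc n ⨯ 1#)  ∎

  private
    ι-*⁺ : ∀ m j → ι (ℤ.+ m ℤ.* j) ≈ ι (ℤ.+ m) · ι j
    ι-*⁺ m (ℤ.+ n) = begin
      ι (ℤ.+ m ℤ.* ℤ.+ n)   ≡⟨ ≡.cong ι (ℤ.pos-* m n) ⟨
      ι (ℤ.+ (m ℕ.* n))   ≈⟨ ×1-homo-* m n ⟩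
      ι (ℤ.+ m) · ι (ℤ.+ n) ∎
    ι-*⁺ m -[1+ n ] = begin
      ι (ℤ.+ m ℤ.* ℤ.- (ℤ.+ suc n))   ≡⟨ ≡.cong ι (ℤ.neg-distribʳ-* (ℤ.+ m) (ℤ.+ suc n)) ⟨
      ι (ℤ.- (ℤ.+ m ℤ.* ℤ.+ suc n))   ≈⟨ ι-neg (ℤ.+ m ℤ.* ℤ.+ suc n) ⟩
      - ι (ℤ.+ m ℤ.* ℤ.+ suc n)       ≈⟨ -‿cong (ι-*⁺ m (ℤ.+ suc n)) ⟩
      - (ι (ℤ.+ m) · ι (ℤ.+ suc n))   ≈⟨ -‿distribʳ-* _ _ ⟩
      ι (ℤ.+ m) · - ι (ℤ.+ suc n)     ∎

  ι-* : ∀ i j → ι (i ℤ.* j) ≈ ι i · ι j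
  ι-* (ℤ.+ m)    j = ι-*⁺ m j
  ι-* -[1+ m ] j = begin
    ι (ℤ.- (ℤ.+ suc m) ℤ.* j)    ≡⟨ ≡.cong ι (ℤ.neg-distribˡ-* (ℤ.+ suc m) j) ⟨
    ι (ℤ.- (ℤ.+ suc m ℤ.* j))    ≈⟨ ι-neg (ℤ.+ suc m ℤ.* j) ⟩
    - ι (ℤ.+ suc m ℤ.* j)        ≈⟨ -‿cong (ι-*⁺ (suc m) j) ⟩
    - (ι (ℤ.+ suc m) · ι j)      ≈⟨ -‿distribˡ-* _ _ ⟩
    - ι (ℤ.+ suc m) · ι j        ∎

  private
    morphism : AlmostCommutativeRing.rawRing (fromCommutativeRing ℤ.+-*-commutativeRing)
               -Raw-AlmostCommutative⟶ fromCommutativeRing R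
    morphism = record
      { ⟦_⟧ = ι ; +-homo = ι-+ ; *-homo = ι-* ; -‿homo = ι-neg
      ; 0-homo = refl ; 1-homo = +-identityʳ 1# }

    coeff≟ : ∀ i j → Maybe (ι i ≈ ι j)
    coeff≟ i j with i ℤ.≟ j
    ... | yes ≡.refl = just refl
    ... | no  _      = nothing

  module Solver = Algebra.Solver.Ring
    (AlmostCommutativeRing.rawRing (fromCommutativeRing ℤ.+-*-commutativeRing))
    (fromCommutativeRing R) morphism coeff≟

  infixr 8 [_]_
  [_]_ : Bool → Carrier → Carrier
  [ b ] x = if b then x else 0#

  []-cong : ∀ b {x y} → x ≈ y → [ b ] x ≈ [ b ] y
  []-cong true  p = p
  []-cong false p = refl

  []-0 : ∀ b → [ b ] 0# ≈ 0#
  []-0 true  = refl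
  []-0 false = refl

  []-+ : ∀ b x y → [ b ] (x + y) ≈ [ b ] x + [ b ] y
  []-+ true  x y = refl
  []-+ false x y = sym (+-identityˡ 0#)

  []-· : ∀ b c x → [ b ] (c · x) ≈ c · [ b ] x
  []-· true  c x = refl
  []-· false c x = sym (zeroʳ c)

  []-yes : ∀ {P : Set} (d : Dec P) {x} → P → [ does d ] x ≈ x
  []-yes (yes _) _ = refl
  []-yes (no ¬p) p = contradiction p ¬p

  []-no : ∀ {P : Set} (d : Dec P) {x} → ¬ P → [ does d ] x ≈ 0#
  []-no (yes p) ¬p = contradiction p ¬p
  []-no (no _)  _  = refl

  []-cong-dec : ∀ {P : Set} (d : Dec P) {x y} → (P → x ≈ y) → [ does d ] x ≈ [ does d ] y
  []-cong-dec (yes p) eq = eq p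
  []-cong-dec (no _)  eq = refl

  ∑-cong : ∀ {n} {f g : Fin n → Carrier} → (∀ i → f i ≈ g i) → sum f ≈ sum g
  ∑-cong = sum-cong-≋

  ∑-0 : ∀ {n} {f : Fin n → Carrier} → (∀ i → f i ≈ 0#) → sum f ≈ 0#
  ∑-0 {n} p = trans (sum-cong-≋ p) (sum-replicate-zero n)

  ∑-[]  : ∀ {n} b (f : Fin n → Carrier) → [ b ] sum f ≈ sum (λ i → [ b ] f i)
  ∑-[] true  f = refl
  ∑-[] {n} false f = sym (sum-replicate-zero n)

  ∑-single : ∀ {n} (f : Fin n → Carrier) i → (∀ j → j ≢ i → f j ≈ 0#) → sum f ≈ f i
  ∑-single {suc n} f i p = begin
    sum f                        ≈⟨ sum-remove {i = i} f ⟩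
    f i + sum (f ∘ punchIn i)    ≈⟨ +-congˡ (∑-0 (λ j → p _ (Fin.punchInᵢ≢i i j))) ⟩
    f i + 0#                     ≈⟨ +-identityʳ _ ⟩
    f i                          ∎

  ∑-δ : ∀ {n} (f : Fin n → Carrier) i → sum (λ j → [ does (j Fin.≟ i) ] f j) ≈ f i
  ∑-δ f i = trans (∑-single _ i λ j → []-no (j Fin.≟ i)) ([]-yes (i Fin.≟ i) ≡.refl)

  ∑-·ˡ : ∀ {n} c (f : Fin n → Carrier) → sum (λ i → c · f i) ≈ c · sum f
  ∑-·ˡ c f = sym (*-distribˡ-sum c f)

  ∑-·ʳ : ∀ {n} c (f : Fin n → Carrier) → sum (λ i → f i · c) ≈ sum f · c
  ∑-·ʳ c f = sym (*-distribʳ-sum c f)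

  Vect : ℕ → Set
  Vect N = Fin N → Carrier

  infix 4 _≋_
  _≋_ : ∀ {N} → Vect N → Vect N → Set
  x ≋ y = ∀ i → x i ≈ y i

  record Linear {N M} (J : Vect N → Vect M) : Set where
    field
      cong   : ∀ {x y} → x ≋ y → J x ≋ J y
      add    : ∀ x y → J (λ i → x i + y i) ≋ λ i → J x i + J y i
      scale  : ∀ c x → J (λ i → c · x i) ≋ λ i → c · J x i

    at-0 : ∀ {x} → (∀ i → x i ≈ 0#) → ∀ i → J x i ≈ 0#
    at-0 {x} p i = begin
      J x i                 ≈⟨ cong (λ j → trans (p j) (sym (zeroˡ (x j)))) i ⟩
      J (λ j → 0# · x j) i  ≈⟨ scale 0# x i ⟩
      0# · J x i            ≈⟨ zeroˡ _ ⟩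
      0#                    ∎

    sub : ∀ x c y → J (λ i → x i - c · y i) ≋ λ i → J x i - c · J y i
    sub x c y i = begin
      J (λ i → x i - c · y i) i      ≈⟨ cong (λ j → +-congˡ (-‿distribˡ-* c (y j))) i ⟩
      J (λ i → x i + - c · y i) i    ≈⟨ add x _ i ⟩
      J x i + J (λ i → - c · y i) i  ≈⟨ +-congˡ (scale (- c) y i) ⟩
      J x i + - c · J y i            ≈⟨ +-congˡ (-‿distribˡ-* c _) ⟨
      J x i - c · J y i              ∎

  prod : ∀ {N} → (Vect N → Vect N) → List Carrier → Vect N → Vect N
  prod J []       x = x
  prod J (c ∷ cs) x = prod J cs (λ i → J x i - c · x i)

  module _ {N} {J : Vect N → Vect N} (lin : Linear J) where
    open Linear lin

    shift-linear : ∀ c → Linear (λ x i → J x i - c · x i)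
    shift-linear c = record
      { cong  = λ p i → +-cong (cong p i) (-‿cong (*-congˡ (p i)))
      ; add   = λ x y i → trans (+-congʳ (add x y i))
          (solve 5 (λ a b c x y → (a :+ b) :- c :* (x :+ y) := (a :- c :* x) :+ (b :- c :* y)) refl
             (J x i) (J y i) c (x i) (y i))
      ; scale = λ d x i → trans (+-congʳ (scale d x i))
          (solve 4 (λ a c d x → d :* a :- c :* (d :* x) := d :* (a :- c :* x)) refl (J x i) c d (x i))
      } where open Solver

    prod-linear : ∀ cs → Linear (prod J cs)
    prod-linear []       = record { cong = λ p → p ; add = λ _ _ _ → refl ; scale = λ _ _ _ → refl }
    prod-linear (c ∷ cs) = record
      { cong  = λ p → P.cong (S.cong p)
      ; add   = λ x y i → trans (P.cong (S.add x y) i) (P.add _ _ i)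
      ; scale = λ d x i → trans (P.cong (S.scale d x) i) (P.scale _ _ i)
      }
      where
      module S = Linear (shift-linear c)
      module P = Linear (prod-linear cs)

    -- B is moved past one factor at a time. With K = J this handles commuting operators; with K
    -- different from J it handles the Hecke intertwiner `φ`.
    prod-intertwine : ∀ {K B : Vect N → Vect N} → Linear B → (∀ x → B (K x) ≋ J (B x)) →
                      ∀ cs x → B (prod K cs x) ≋ prod J cs (B x)
    prod-intertwine B-lin comm []       x i = refl
    prod-intertwine {K} {B} B-lin comm (c ∷ cs) x i = trans (prod-intertwine B-lin comm cs _ i)
      (Linear.cong (prod-linear cs)
        (λ j → trans (Linear.sub B-lin (K x) c x j) (+-congʳ (comm x j))) i)

    prod-shift : ∀ d cs x → prod J cs (λ i → J x i - d · x i) ≋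
                 λ i → J (prod J cs x) i - d · prod J cs x i
    prod-shift d cs x i = sym (prod-intertwine (shift-linear d)
      (λ x j → sym (sub (J x) d x j)) cs x i)

    prod-++ : ∀ cs ds x → prod J (cs ++ ds) x ≡ prod J ds (prod J cs x)
    prod-++ []       ds x = ≡.refl
    prod-++ (c ∷ cs) ds x = prod-++ cs ds _

    prod-prod : ∀ cs ds x → prod J cs (prod J ds x) ≋ prod J ds (prod J cs x)
    prod-prod cs ds = prod-intertwine (prod-linear cs)
      (λ x i → sym (prod-intertwine lin (λ _ _ → refl) cs x i)) ds

    prod-swap : ∀ c d cs x → prod J (c ∷ d ∷ cs) x ≋ prod J (d ∷ c ∷ cs) x
    prod-swap c d cs x = Linear.cong (prod-linear cs) λ j → begin
      J (λ i → J x i - c · x i) j - d · (J x j - c · x j)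
        ≈⟨ +-congʳ (sub (J x) c x j) ⟩
      (J (J x) j - c · J x j) - d · (J x j - c · x j)
        ≈⟨ solve 5 (λ a b x c d → (a :- c :* b) :- d :* (b :- c :* x)
             := (a :- d :* b) :- c :* (b :- d :* x)) refl (J (J x) j) (J x j) (x j) c d ⟩
      (J (J x) j - d · J x j) - c · (J x j - d · x j)
        ≈⟨ +-congʳ (sub (J x) d x j) ⟨
      J (λ i → J x i - d · x i) j - c · (J x j - d · x j) ∎
      where open Solver

-- Transpositions and the left multiplication action of the symmetric group.

transpose-matchʳ : ∀ {n} (i j : Fin n) → transpose i j ⟨$⟩ʳ j ≡ i
transpose-matchʳ i j = ≡.trans (transpose-sym i j j) (transpose-matchˡ j i)

transpose-other : ∀ {n} (i j : Fin n) {k} → k ≢ i → k ≢ j → transpose i j ⟨$⟩ʳ k ≡ k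
transpose-other i j {k} k≢i k≢j with k Fin.≟ i
... | yes k≡i = contradiction k≡i k≢i
... | no  _ with k Fin.≟ j
...   | yes k≡j = contradiction k≡j k≢j
...   | no  _   = ≡.refl

-- The conjugation formula f (a b) = (f a f b) f for an arbitrary injection; it is applied to
-- permutations and also to the embedding `e` of a set of points.
transpose-map : ∀ {n m} (f : Fin n → Fin m) → Injective _≡_ _≡_ f → ∀ a b k →
                f (transpose a b ⟨$⟩ʳ k) ≡ transpose (f a) (f b) ⟨$⟩ʳ f k
transpose-map f f-inj a b k = go (k Fin.≟ a) (k Fin.≟ b)
  where
  go : Dec (k ≡ a) → Dec (k ≡ b) → f (transpose a b ⟨$⟩ʳ k) ≡ transpose (f a) (f b) ⟨$⟩ʳ f k
  go (yes ≡.refl) _ = ≡.trans (≡.cong f (transpose-matchˡ k b)) (≡.sym (transpose-matchˡ (f k) (f b)))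
  go (no _) (yes ≡.refl) = ≡.trans (≡.cong f (transpose-matchʳ a k)) (≡.sym (transpose-matchʳ (f a) (f k)))
  go (no k≢a) (no k≢b) = ≡.trans (≡.cong f (transpose-other a b k≢a k≢b))
    (≡.sym (transpose-other (f a) (f b) (k≢a ∘ f-inj) (k≢b ∘ f-inj)))

module _ {n : ℕ} where

  perm-injective : ∀ (τ : Permutation′ n) {i j} → τ ⟨$⟩ʳ i ≡ τ ⟨$⟩ʳ j → i ≡ j
  perm-injective τ p = ≡.trans (≡.sym (Perm.inverseˡ τ)) (≡.trans (≡.cong (τ ⟨$⟩ˡ_) p) (Perm.inverseˡ τ))

  transpose-involutive : ∀ (a b k : Fin n) → transpose a b ⟨$⟩ʳ (transpose a b ⟨$⟩ʳ k) ≡ k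
  transpose-involutive a b k =
    ≡.trans (transpose-sym a b (transpose a b ⟨$⟩ʳ k)) (Perm.inverseˡ (transpose a b) {k})

  -- Left multiplication by σ, on indices.
  act : Permutation′ n → Fin (n !) → Fin (n !)
  act σ i = encode n (decode n i ∘ₚ σ)

  decode-act : ∀ σ i → decode n (act σ i) Perm.≈ (decode n i ∘ₚ σ)
  decode-act σ i = decode-encode n (decode n i ∘ₚ σ)

  act-cong : ∀ σ τ → σ Perm.≈ τ → ∀ i → act σ i ≡ act τ i
  act-cong σ τ σ≈τ i = encode-cong n (decode n i ∘ₚ σ) (decode n i ∘ₚ τ) (λ k → σ≈τ (decode n i ⟨$⟩ʳ k))

  act-∘ : ∀ σ τ i → act σ (act τ i) ≡ act (τ ∘ₚ σ) i
  act-∘ σ τ i = encode-cong n (decode n (act τ i) ∘ₚ σ) (decode n i ∘ₚ (τ ∘ₚ σ))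
    (λ k → ≡.cong (σ ⟨$⟩ʳ_) (decode-act τ i k))

  act-id : ∀ i → act Perm.id i ≡ i
  act-id i = ≡.trans (encode-cong n (decode n i ∘ₚ Perm.id) (decode n i) (λ _ → ≡.refl)) (encode-decode n i)

  t : Fin n → Fin n → Fin (n !) → Fin (n !)
  t a b = act (transpose a b)

  t-sym : ∀ a b i → t a b i ≡ t b a i
  t-sym a b = act-cong (transpose a b) (transpose b a) (transpose-sym a b)

  t-involutive : ∀ a b i → t a b (t a b i) ≡ i
  t-involutive a b i = ≡.trans (act-∘ (transpose a b) (transpose a b) i)
    (≡.trans (act-cong (transpose a b ∘ₚ transpose a b) Perm.id (transpose-involutive a b) i) (act-id i))

  act-t : ∀ τ a b i → act τ (t a b i) ≡ t (τ ⟨$⟩ʳ a) (τ ⟨$⟩ʳ b) (act τ i)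
  act-t τ a b i = ≡.trans (act-∘ τ (transpose a b) i) (≡.trans
    (act-cong (transpose a b ∘ₚ τ) (τ ∘ₚ transpose (τ ⟨$⟩ʳ a) (τ ⟨$⟩ʳ b))
      (transpose-map (τ ⟨$⟩ʳ_) (perm-injective τ) a b) i)
    (≡.sym (act-∘ (transpose (τ ⟨$⟩ʳ a) (τ ⟨$⟩ʳ b)) τ i)))

  t-perm : ∀ a b → Perm.Permutation′ (n !)
  t-perm a b = Perm.permutation (t a b) (t a b) (t-involutive a b) (t-involutive a b)

  -- Jucys-Murphy elements and the degenerate Hecke relations.

  module JM (R : CommutativeRing 0ℓ 0ℓ) where
    open RingLemmas R

    -- The Jucys–Murphy element ∑ₖ (v e(k)).
    J : ∀ {m} → (Fin m → Fin n) → Fin n → Vect (n !) → Vect (n !)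
    J {m} e v x i = ∑[ k < m ] x (t v (e k) i)

    J-linear : ∀ {m} (e : Fin m → Fin n) v → Linear (J e v)
    J-linear e v = record
      { cong  = λ p i → ∑-cong (λ k → p (t v (e k) i))
      ; add   = λ x y i → ∑-distrib-+ (λ k → x (t v (e k) i)) _
      ; scale = λ c x i → ∑-·ˡ c (λ k → x (t v (e k) i))
      }

    J-symmetric : ∀ {m} (e : Fin m → Fin n) v x y →
                  sum (λ i → J e v x i · y i) ≈ sum (λ i → x i · J e v y i)
    J-symmetric {m} e v x y = begin
      sum (λ i → sum (λ k → x (t v (e k) i)) · y i)
        ≈⟨ ∑-cong (λ i → sym (∑-·ʳ (y i) (λ k → x (t v (e k) i)))) ⟩
      sum (λ i → sum (λ k → x (t v (e k) i) · y i))
        ≈⟨ ∑-comm (λ i k → x (t v (e k) i) · y i) ⟩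
      sum (λ k → sum (λ i → x (t v (e k) i) · y i))
        ≈⟨ ∑-cong (λ k → sum-permute (λ i → x (t v (e k) i) · y i) (t-perm v (e k))) ⟩
      sum (λ k → sum (λ i → x (t v (e k) (t v (e k) i)) · y (t v (e k) i)))
        ≈⟨ ∑-cong (λ k → ∑-cong (λ i → *-congʳ (reflexive (≡.cong x (t-involutive v (e k) i))))) ⟩
      sum (λ k → sum (λ i → x i · y (t v (e k) i)))
        ≈⟨ ∑-comm (λ k i → x i · y (t v (e k) i)) ⟩
      sum (λ i → sum (λ k → x i · y (t v (e k) i)))
        ≈⟨ ∑-cong (λ i → ∑-·ˡ (x i) (λ k → y (t v (e k) i))) ⟩
      sum (λ i → x i · sum (λ k → y (t v (e k) i))) ∎

    -- Conjugation by τ fixes v and permutes the points `e k`, so it merely permutes the summands (v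
    -- `e k`).
    J-act : ∀ {m} (e : Fin m → Fin n) v (τ : Permutation′ n) (π : Permutation′ m) →
            τ ⟨$⟩ʳ v ≡ v → (∀ k → τ ⟨$⟩ʳ e k ≡ e (π ⟨$⟩ʳ k)) →
            ∀ x i → J e v (x ∘ act τ) i ≈ J e v x (act τ i)
    J-act {m} e v τ π τv τe x i = begin
      sum (λ k → x (act τ (t v (e k) i)))
        ≈⟨ ∑-cong (λ k → reflexive (≡.cong x (≡.trans (act-t τ v (e k) i)
              (≡.cong₂ (λ a b → t a b (act τ i)) τv (τe k))))) ⟩
      sum (λ k → x (t v (e (π ⟨$⟩ʳ k)) (act τ i)))
        ≈⟨ sum-permute (λ k → x (t v (e k) (act τ i))) π ⟨
      sum (λ k → x (t v (e k) (act τ i))) ∎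

    module Hecke {m} (e : Fin (suc m) → Fin n) (e-inj : Injective _≡_ _≡_ e)
                 (v : Fin n) (v≢e : ∀ k → v ≢ e k) where
      u = e zero
      J₀ = J (e ∘ suc) u
      J₁ = J e v

      s : Vect (n !) → Vect (n !)
      s x i = x (t v u i)

      s-s : ∀ x → s (s x) ≋ x
      s-s x i = reflexive (≡.cong x (t-involutive v u i))

      -- The first summand of `J₁` is (v u), which cancels against `s`. Moving any other (v `e k`)
      -- past (v u) replaces v by u and gives a summand of `J₀`.
      J₁-s : ∀ x i → J₁ (s x) i ≈ x i + s (J₀ x) i
      J₁-s x i = +-cong (s-s x i) (∑-cong λ k → reflexive (≡.cong x
        (≡.trans (act-t (transpose v u) v (e (suc k)) i)
          (≡.cong₂ (λ a b → t a b (t v u i)) (transpose-matchˡ v u)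
            (transpose-other v u (v≢e (suc k) ∘ ≡.sym) (λ p → Fin.0≢1+n (≡.sym (e-inj p))))))))

      -- This is `J₁-s` for `s x`, read at the translate of i by (v u), as `s` is an involution.
      J₀-s : ∀ x i → J₀ (s x) i ≈ s (J₁ x) i - x i
      J₀-s x i = begin
        J₀ (s x) i                                  ≈⟨ s-s (J₀ (s x)) i ⟨
        J₀ (s x) (t v u (t v u i))                  ≈⟨ solve 2 (λ a b → b := (a :+ b) :- a) refl (s x (t v u i)) _ ⟩
        (s x (t v u i) + s (J₀ (s x)) (t v u i)) - s x (t v u i)
          ≈⟨ +-cong (sym (J₁-s (s x) (t v u i))) (-‿cong (s-s x i)) ⟩
        J₁ (s (s x)) (t v u i) - x i                ≈⟨ +-congʳ (Linear.cong (J-linear e v) (s-s x) (t v u i)) ⟩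
        s (J₁ x) i - x i                            ∎
        where open Solver

      -- Each transposition (u `e k`) in `J₀` fixes v and permutes the image of `e`, so `J₁`
      -- commutes with it by `J-act`.
      J₀-J₁ : ∀ x → J₁ (J₀ x) ≋ J₀ (J₁ x)
      J₀-J₁ x i = begin
        sum (λ j → sum (λ k → x (t u (e (suc k)) (t v (e j) i))))
          ≈⟨ ∑-comm (λ j k → x (t u (e (suc k)) (t v (e j) i))) ⟩
        sum (λ k → J₁ (x ∘ t u (e (suc k))) i)
          ≈⟨ ∑-cong (λ k → J-act e v (transpose u (e (suc k))) (transpose zero (suc k))
               (transpose-other u (e (suc k)) (v≢e zero) (v≢e (suc k)))
               (λ j → ≡.sym (transpose-map e e-inj zero (suc k) j)) x i) ⟩
        sum (λ k → J₁ x (t u (e (suc k)) i)) ∎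

-- Sums of squares over ℤ and the splitting of Jucys-Murphy elements into distinct integer roots.

-- What is needed of an order for a vanishing sum of squares to vanish term by term; it covers both
-- ℤ, where division fails, and ordered fields.
record Positivity (R : CommutativeRing 0ℓ 0ℓ) : Set₁ where
  open CommutativeRing R using (Carrier; _≈_; _+_; _*_; 0#)
  field
    NonNeg        : Carrier → Set
    nonNeg-resp   : ∀ {x y} → x ≈ y → NonNeg x → NonNeg y
    nonNeg-0      : NonNeg 0#
    nonNeg-+      : ∀ {x y} → NonNeg x → NonNeg y → NonNeg (x + y)
    nonNeg-square : ∀ x → NonNeg (x * x)
    +-zero        : ∀ {x y} → NonNeg x → NonNeg y → x + y ≈ 0# → x ≈ 0#
    square-zero   : ∀ {x} → x * x ≈ 0# → x ≈ 0#

module SumOfSquares (R : CommutativeRing 0ℓ 0ℓ) (P : Positivity R) where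
  open RingLemmas R
  open Positivity P

  nonNeg-∑ : ∀ {n} {f : Vect n} → (∀ i → NonNeg (f i)) → NonNeg (sum f)
  nonNeg-∑ {zero}  p = nonNeg-0
  nonNeg-∑ {suc n} p = nonNeg-+ (p zero) (nonNeg-∑ (λ i → p (suc i)))

  ∑-zero : ∀ {n} {f : Vect n} → (∀ i → NonNeg (f i)) → sum f ≈ 0# → ∀ i → f i ≈ 0#
  ∑-zero p q zero    = +-zero (p zero) (nonNeg-∑ (λ i → p (suc i))) q
  ∑-zero p q (suc i) = ∑-zero (λ i → p (suc i))
    (+-zero (nonNeg-∑ (λ i → p (suc i))) (p zero) (trans (+-comm _ _) q)) i

  ∑-squares-zero : ∀ {n} (x : Vect n) → sum (λ i → x i · x i) ≈ 0# → ∀ i → x i ≈ 0#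
  ∑-squares-zero x q i = square-zero (∑-zero (λ i → nonNeg-square (x i)) q i)

ℤ-ring = ℤ.+-*-commutativeRing

ℤ-+-zero : ∀ {x y} → 0ℤ ℤ.≤ x → 0ℤ ℤ.≤ y → x ℤ.+ y ≡ 0ℤ → x ≡ 0ℤ
ℤ-+-zero {x} {y} 0≤x 0≤y q = ℤ.≤-antisym
  (≡.subst₂ ℤ._≤_ (ℤ.+-identityʳ x) q (ℤ.+-monoʳ-≤ x 0≤y)) 0≤x

ℤ-square-zero : ∀ {x} → x ℤ.* x ≡ 0ℤ → x ≡ 0ℤ
ℤ-square-zero {x} p with ℤ.i*j≡0⇒i≡0∨j≡0 x p
... | inj₁ q = q
... | inj₂ q = q

ℤ-nonNeg-square : ∀ x → 0ℤ ℤ.≤ x ℤ.* x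
ℤ-nonNeg-square (ℤ.+ zero)  = ℤ.≤-refl
ℤ-nonNeg-square (ℤ.+ suc n) = ℤ.+≤+ ℕ.z≤n
ℤ-nonNeg-square -[1+ n ]  = ℤ.+≤+ ℕ.z≤n

ℤ-positivity : Positivity ℤ-ring
ℤ-positivity = record
  { NonNeg        = 0ℤ ℤ.≤_
  ; nonNeg-resp   = λ { ≡.refl p → p }
  ; nonNeg-0      = ℤ.≤-refl
  ; nonNeg-+      = ℤ.+-mono-≤
  ; nonNeg-square = ℤ-nonNeg-square
  ; +-zero        = ℤ-+-zero
  ; square-zero   = ℤ-square-zero
  }

module Split where
  open RingLemmas ℤ-ring
  open Solver

  torsion-free : ∀ {c d x} → c ≢ d → (c - d) · x ≡ 0ℤ → x ≡ 0ℤ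
  torsion-free {c} {d} c≢d p with ℤ.i*j≡0⇒i≡0∨j≡0 (c - d) p
  ... | inj₁ q = contradiction (ℤ.i-j≡0⇒i≡j c d q) c≢d
  ... | inj₂ q = q

  -- Semisimplicity in a form that makes sense over ℤ: no Jordan block of size two at an integer c.
  Reduced : ∀ {N} → (Vect N → Vect N) → Set
  Reduced J = ∀ c y → (∀ i → prod J (c ∷ c ∷ []) y i ≡ 0ℤ) → ∀ i → prod J (c ∷ []) y i ≡ 0ℤ

  HasSplit : ∀ {N} → (Vect N → Vect N) → Set
  HasSplit J = ∃[ rs ] Unique rs × (∀ x i → prod J rs x i ≡ 0ℤ)

  module _ {N} {J : Vect N → Vect N} (lin : Linear J) where

    shift-symmetric : (∀ x y → sum (λ i → J x i · y i) ≡ sum (λ i → x i · J y i)) → ∀ c x y →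
                      sum (λ i → prod J (c ∷ []) x i · y i) ≡ sum (λ i → x i · prod J (c ∷ []) y i)
    shift-symmetric J-sym c x y = begin
      sum (λ i → (J x i - c · x i) · y i)
        ≡⟨ ∑-cong (λ i → solve 4 (λ a c x y → (a :- c :* x) :* y := a :* y :+ (:- c) :* (x :* y)) refl (J x i) c (x i) (y i)) ⟩
      sum (λ i → J x i · y i + - c · (x i · y i))
        ≡⟨ ∑-distrib-+ (λ i → J x i · y i) _ ⟩
      sum (λ i → J x i · y i) + sum (λ i → - c · (x i · y i))
        ≡⟨ +-congʳ (J-sym x y) ⟩
      sum (λ i → x i · J y i) + sum (λ i → - c · (x i · y i))
        ≡⟨ ∑-distrib-+ (λ i → x i · J y i) _ ⟨
      sum (λ i → x i · J y i + - c · (x i · y i))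
        ≡⟨ ∑-cong (λ i → solve 4 (λ a c x y → x :* a :+ (:- c) :* (x :* y) := x :* (a :- c :* y)) refl (J y i) c (x i) (y i)) ⟩
      sum (λ i → x i · (J y i - c · y i)) ∎

    -- With D = J - c, symmetry gives Dy·Dy = y·D²y = 0, and a vanishing sum of integer squares has
    -- zero terms.
    symmetric⇒reduced : (∀ x y → sum (λ i → J x i · y i) ≡ sum (λ i → x i · J y i)) → Reduced J
    symmetric⇒reduced J-sym c y p = SumOfSquares.∑-squares-zero ℤ-ring ℤ-positivity (prod J (c ∷ []) y)
      (≡.trans (shift-symmetric J-sym c y (prod J (c ∷ []) y))
        (∑-0 λ i → ≡.trans (≡.cong (y i ·_) (p i)) (zeroʳ (y i))))

    image : ∀ {k} rs → k ∈ rs → ∀ x → ∃[ z ] prod J rs x ≋ prod J (k ∷ []) z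
    image {k} (_ ∷ cs) (here ≡.refl) x = prod J cs x , prod-shift lin k cs x
    image (c ∷ cs) (there k∈cs)  x = image cs k∈cs _

    -- Let y = (J - c) z for the first root c. The vector (J - c) y satisfies the same hypotheses
    -- for the remaining roots and vanishes by induction; being (J - c)² z, its vanishing forces y =
    -- 0 by reducedness.
    kill : Reduced J → ∀ ks y → (∀ {k} → k ∈ ks → ∃[ z ] y ≋ prod J (k ∷ []) z) →
           (∀ i → prod J ks y i ≡ 0ℤ) → ∀ i → y i ≡ 0ℤ
    kill red []       y im p = p
    kill red (c ∷ cs) y im p i with im (here ≡.refl)
    ... | z , y≋ = trans (y≋ i) (red c z (λ i → trans (sym (Linear.cong (prod-linear lin (c ∷ [])) y≋ i))
      (kill red cs (prod J (c ∷ []) y) im′ p i)) i)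
      where
      im′ : ∀ {k} → k ∈ cs → ∃[ z ] prod J (c ∷ []) y ≋ prod J (k ∷ []) z
      im′ {k} k∈cs with im (there k∈cs)
      ... | z , y≋ = prod J (c ∷ []) z , λ i → trans (Linear.cong (prod-linear lin (c ∷ [])) y≋ i) (prod-swap lin k c [] z i)

    -- A reduced operator has no repeated roots, so multiplicities are irrelevant.
    kill-by : Reduced J → ∀ rs ks → (∀ {k} → k ∈ ks → k ∈ rs) → ∀ x →
              (∀ i → prod J ks x i ≡ 0ℤ) → ∀ i → prod J rs x i ≡ 0ℤ
    kill-by red rs ks ks⊆rs x p = kill red ks (prod J rs x) (λ k∈ks → image rs (ks⊆rs k∈ks) x)
      (λ i → trans (prod-prod lin ks rs x i) (Linear.at-0 (prod-linear lin rs) p i))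

  module _ {N} {J₀ J₁ : Vect N → Vect N} (lin₀ : Linear J₀) (lin₁ : Linear J₁)
           (p : Fin N → Fin N) (p-p : ∀ i → p (p i) ≡ i)
           (J₁-J₀ : ∀ x → J₁ (J₀ x) ≋ J₀ (J₁ x))
           (J₀-p : ∀ x i → J₀ (x ∘ p) i ≡ J₁ x (p i) - x i)
           (J₁-p : ∀ x i → J₁ (x ∘ p) i ≡ x i + J₀ x (p i))
           (red : Reduced J₁) where

    -- The intertwiner s (J₀ - J₁) + 1 of the degenerate affine Hecke algebra, where s is
    -- composition with `p`. It exchanges J₁ for J₀ and so lets the known roots of J₀ act on J₁.
    φ : Vect N → Vect N
    φ z i = (J₀ z (p i) - J₁ z (p i)) + z i

    φ-linear : Linear φ
    φ-linear = record
      { cong  = λ q i → ≡.cong₂ _+_ (≡.cong₂ _-_ (Linear.cong lin₀ q (p i)) (Linear.cong lin₁ q (p i))) (q i)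
      ; add   = λ x y i → ≡.trans
          (≡.cong₂ (λ a b → (a - b) + (x i + y i)) (Linear.add lin₀ x y (p i)) (Linear.add lin₁ x y (p i)))
          (solve 6 (λ a b c d x y → ((a :+ b) :- (c :+ d)) :+ (x :+ y) := ((a :- c) :+ x) :+ ((b :- d) :+ y))
            refl (J₀ x (p i)) (J₀ y (p i)) (J₁ x (p i)) (J₁ y (p i)) (x i) (y i))
      ; scale = λ c x i → ≡.trans
          (≡.cong₂ (λ a b → (a - b) + c · x i) (Linear.scale lin₀ c x (p i)) (Linear.scale lin₁ c x (p i)))
          (solve 4 (λ a b c x → ((c :* a) :- (c :* b)) :+ c :* x := c :* ((a :- b) :+ x))
            refl (J₀ x (p i)) (J₁ x (p i)) c (x i))
      }

    φ-intertwines : ∀ z → φ (J₁ z) ≋ J₀ (φ z)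
    φ-intertwines z i = sym (begin
      J₀ (φ z) i
        ≡⟨ Linear.add lin₀ (λ j → J₀ z (p j) - J₁ z (p j)) z i ⟩
      J₀ (w ∘ p) i + J₀ z i
        ≡⟨ +-congʳ (J₀-p w i) ⟩
      (J₁ w (p i) - w i) + J₀ z i
        ≡⟨ ≡.cong (λ a → (a - w i) + J₀ z i) (≡.trans (Linear.cong lin₁ (λ j → ≡.cong (J₀ z j +_) (≡.cong -_ (≡.sym (*-identityˡ (J₁ z j))))) (p i))
             (Linear.sub lin₁ (J₀ z) 1# (J₁ z) (p i))) ⟩
      ((J₁ (J₀ z) (p i) - 1# · J₁ (J₁ z) (p i)) - (J₀ z i - J₁ z i)) + J₀ z i
        ≡⟨ ≡.cong (λ a → ((a - 1# · J₁ (J₁ z) (p i)) - (J₀ z i - J₁ z i)) + J₀ z i) (J₁-J₀ z (p i)) ⟩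
      ((J₀ (J₁ z) (p i) - 1# · J₁ (J₁ z) (p i)) - (J₀ z i - J₁ z i)) + J₀ z i
        ≡⟨ solve 4 (λ a b c d → ((a :- con 1# :* b) :- (c :- d)) :+ c := (a :- b) :+ d) refl
             (J₀ (J₁ z) (p i)) (J₁ (J₁ z) (p i)) (J₀ z i) (J₁ z i) ⟩
      φ (J₁ z) i ∎)
      where
      w : Vect N
      w j = J₀ z j - J₁ z j

    module _ (rs : List ℤ) (rs-kills : ∀ x i → prod J₀ rs x i ≡ 0ℤ) where

      module _ {a x} (x-eigen : J₀ x ≋ λ i → a · x i) where
        private
          -- The factors from `rs` push x into the kernel of `φ`, since `φ` turns them into the
          -- product of J₀-factors that kills everything.
          y = prod J₁ rs x

          y-eigen : J₀ y ≋ λ i → a · y i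
          y-eigen i = ≡.trans (prod-intertwine lin₁ lin₀ (λ z j → sym (J₁-J₀ z j)) rs x i)
            (≡.trans (Linear.cong (prod-linear lin₁ rs) x-eigen i) (Linear.scale (prod-linear lin₁ rs) a x i))

          φ-y : ∀ i → φ y i ≡ 0ℤ
          φ-y i = ≡.trans (prod-intertwine lin₀ φ-linear φ-intertwines rs x i) (rs-kills (φ x) i)

          y-p : y ∘ p ≋ λ i → J₁ y i - a · y i
          y-p i = begin
            y (p i)
              ≡⟨ solve 3 (λ u v w → w := ((u :- v) :+ w) :+ (v :- u)) refl (a · y i) (J₁ y i) (y (p i)) ⟩
            ((a · y i - J₁ y i) + y (p i)) + (J₁ y i - a · y i)
              ≡⟨ ≡.cong (_+ (J₁ y i - a · y i)) (≡.trans
                   (≡.cong (λ u → (u - J₁ y i) + y (p i)) (≡.sym (y-eigen i)))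
                   (≡.subst (λ k → (J₀ y k - J₁ y k) + y (p i) ≡ 0ℤ) (p-p i) (φ-y (p i)))) ⟩
            0ℤ + (J₁ y i - a · y i)
              ≡⟨ +-identityˡ _ ⟩
            J₁ y i - a · y i ∎

          J₁-y-p : ∀ i → J₁ (y ∘ p) i ≡ y i + a · y (p i)
          J₁-y-p i = ≡.trans (J₁-p y i) (≡.cong (y i +_) (y-eigen (p i)))

        -- Since J₀ acts on y as a and `φ` y = 0, one has s y = (J₁ - a) y. The Hecke relation
        -- `J₁-p` gives (J₁ - a) s y = y. Hence (J₁ - a)² y = y, with roots a + 1 and a - 1.
        neighbours-kill : ∀ i → prod J₁ (a + 1# ∷ a - 1# ∷ []) y i ≡ 0ℤ
        neighbours-kill i = begin
          J₁ (λ j → J₁ y j - (a + 1#) · y j) i - (a - 1#) · (J₁ y i - (a + 1#) · y i)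
            ≡⟨ ≡.cong (_- (a - 1#) · (J₁ y i - (a + 1#) · y i)) (Linear.cong lin₁ shifted i) ⟩
          J₁ (λ j → y (p j) - 1# · y j) i - (a - 1#) · (J₁ y i - (a + 1#) · y i)
            ≡⟨ ≡.cong (_- (a - 1#) · (J₁ y i - (a + 1#) · y i)) (≡.trans (Linear.sub lin₁ (y ∘ p) 1# y i)
                 (≡.cong (_- 1# · J₁ y i) (≡.trans (J₁-y-p i) (≡.cong (λ u → y i + a · u) (y-p i))))) ⟩
          ((y i + a · (J₁ y i - a · y i)) - 1# · J₁ y i) - (a - 1#) · (J₁ y i - (a + 1#) · y i)
            ≡⟨ solve 3 (λ a y z → ((y :+ a :* (z :- a :* y)) :- con 1# :* z) :- (a :- con 1#) :* (z :- (a :+ con 1#) :* y)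
                 := con 0ℤ) refl a (y i) (J₁ y i) ⟩
          0ℤ ∎
          where
          shifted : (λ j → J₁ y j - (a + 1#) · y j) ≋ λ j → y (p j) - 1# · y j
          shifted j = ≡.trans
            (solve 3 (λ a y z → z :- (a :+ con 1#) :* y := (z :- a :* y) :- con 1# :* y) refl a (y j) (J₁ y j))
            (≡.cong (_- 1# · y j) (≡.sym (y-p j)))

      private
        all-roots : List ℤ
        all-roots = rs ++ (map (_+ 1#) rs ++ map (_- 1#) rs)

        new-roots : List ℤ
        new-roots = deduplicate ℤ._≟_ all-roots

        neighbour : ∀ {a k} → a ∈ rs → k ∈ rs ++ (a + 1# ∷ a - 1# ∷ []) → k ∈ new-roots
        neighbour {a} {k} a∈rs k∈ = ∈-deduplicate⁺ ℤ._≟_ (go rs k∈ (λ q → q))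
          where
          go : ∀ ks → k ∈ ks ++ (a + 1# ∷ a - 1# ∷ []) → (∀ {k} → k ∈ ks → k ∈ rs) → k ∈ all-roots
          go []       (here ≡.refl) _ = ∈-++⁺ʳ rs (∈-++⁺ˡ (∈-map⁺ (_+ 1#) a∈rs))
          go []       (there (here ≡.refl)) _ = ∈-++⁺ʳ rs (∈-++⁺ʳ (map (_+ 1#) rs) (∈-map⁺ (_- 1#) a∈rs))
          go (_ ∷ ks) (here q) ks⊆ = ∈-++⁺ˡ (ks⊆ (here q))
          go (_ ∷ ks) (there q) ks⊆ = go ks q (λ r → ks⊆ (there r))

        -- One of a + 1 and a - 1 may already occur in `rs`, so the product killing x can have
        -- repeated factors; `kill-by` absorbs them.
        eigen-killed : ∀ {a} → a ∈ rs → ∀ x → (∀ i → prod J₀ (a ∷ []) x i ≡ 0ℤ) →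
                       ∀ i → prod J₁ new-roots x i ≡ 0ℤ
        eigen-killed {a} a∈rs x q = kill-by lin₁ red new-roots (rs ++ (a + 1# ∷ a - 1# ∷ [])) (neighbour a∈rs) x
          (λ i → ≡.trans (≡.cong (λ z → z i) (prod-++ lin₁ rs (a + 1# ∷ a - 1# ∷ []) x))
            (neighbours-kill {a} {x} (λ j → ℤ.i-j≡0⇒i≡j (J₀ x j) _ (q j)) i))

        -- (c − d) x = (J₀ − d) x − (J₀ − c) x reduces a product of distinct factors to single ones.
        all-killed : ∀ c cs → Unique (c ∷ cs) → (∀ {k} → k ∈ c ∷ cs → k ∈ rs) → ∀ x →
                     (∀ i → prod J₀ (c ∷ cs) x i ≡ 0ℤ) → ∀ i → prod J₁ new-roots x i ≡ 0ℤ
        all-killed c []       _ ⊆rs x q = eigen-killed (⊆rs (here ≡.refl)) x q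
        all-killed c (d ∷ cs) ((c≢d ∷ c∉) ∷ (d∉ ∷ cs!)) ⊆rs x q i =
          torsion-free c≢d (begin
            (c - d) · prod J₁ new-roots x i
              ≡⟨ Linear.scale P (c - d) x i ⟨
            prod J₁ new-roots (λ j → (c - d) · x j) i
              ≡⟨ Linear.cong P (λ j → solve 4 (λ c d x z → (c :- d) :* x := (z :- d :* x) :- con 1# :* (z :- c :* x))
                   refl c d (x j) (J₀ x j)) i ⟩
            prod J₁ new-roots (λ j → (J₀ x j - d · x j) - 1# · (J₀ x j - c · x j)) i
              ≡⟨ Linear.sub P _ 1# _ i ⟩
            prod J₁ new-roots (prod J₀ (d ∷ []) x) i - 1# · prod J₁ new-roots (prod J₀ (c ∷ []) x) i
              ≡⟨ ≡.cong₂ (λ u v → u - 1# · v)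
                   (all-killed c cs (c∉ ∷ cs!) (λ { (here r) → ⊆rs (here r) ; (there r) → ⊆rs (there (there r)) }) _
                     (λ j → ≡.trans (prod-swap lin₀ d c cs x j) (q j)) i)
                   (all-killed d cs (d∉ ∷ cs!) (λ r → ⊆rs (there r)) _ q i) ⟩
            0ℤ ∎)
          where P = prod-linear lin₁ new-roots

      split-step : Unique rs → HasSplit J₁
      split-step rs! = new-roots , deduplicate-! all-roots , λ x → killed rs rs! (λ r → r) x (rs-kills x)
        where
        killed : ∀ ks → Unique ks → (∀ {k} → k ∈ ks → k ∈ rs) → ∀ x → (∀ i → prod J₀ ks x i ≡ 0ℤ) →
                 ∀ i → prod J₁ new-roots x i ≡ 0ℤ
        killed []       _  _   x q = Linear.at-0 (prod-linear lin₁ new-roots) q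
        killed (c ∷ cs) ks! ⊆rs x q = all-killed c cs ks! ⊆rs x q

  module _ {n : ℕ} where
    open JM {n} ℤ-ring

    -- Induction on the number of points: in the Hecke relations `J₀` is the Jucys-Murphy element of
    -- `e zero` with respect to the other points. With no points the operator is 0, and 0 is its
    -- only root.
    JM-split : ∀ m (e : Fin m → Fin n) → Injective _≡_ _≡_ e → ∀ v → (∀ k → v ≢ e k) → HasSplit (J e v)
    JM-split zero    e e-inj v v≢e = 0ℤ ∷ [] , [] ∷ [] , λ x i → ≡.refl
    JM-split (suc m) e e-inj v v≢e with JM-split m (e ∘ suc) (Fin.suc-injective ∘ e-inj) (e zero)
      (λ k p → Fin.0≢1+n (e-inj p))
    ... | rs , rs! , kills = split-step (J-linear (e ∘ suc) (e zero)) (J-linear e v) (t v (e zero)) (t-involutive v (e zero))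
      (Hecke.J₀-J₁ e e-inj v v≢e) (Hecke.J₀-s e e-inj v v≢e) (Hecke.J₁-s e e-inj v v≢e)
      (symmetric⇒reduced (J-linear e v) (J-symmetric e v)) rs kills rs!

-- Sums over pairs and the adjacency operator of the Cayley graph.

module PairSum (R : CommutativeRing 0ℓ 0ℓ) where
  open RingLemmas R

  pairSum : ∀ {n} → (Fin n → Fin n → Carrier) → Carrier
  pairSum F = sum λ a → sum λ b → [ does (a Fin.<? b) ] F a b

  pairSum-cong : ∀ {n} {F G : Fin n → Fin n → Carrier} →
                 (∀ a b → a Fin.< b → F a b ≈ G a b) → pairSum F ≈ pairSum G
  pairSum-cong p = ∑-cong λ a → ∑-cong λ b → []-cong-dec (a Fin.<? b) (p a b)

  pairSum-0 : ∀ {n} (F : Fin n → Fin n → Carrier) →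
              (∀ a b → a Fin.< b → F a b ≈ 0#) → pairSum F ≈ 0#
  pairSum-0 F p = ∑-0 λ a → ∑-0 λ b →
    trans ([]-cong-dec (a Fin.<? b) (p a b)) ([]-0 (does (a Fin.<? b)))

  pairSum-+ : ∀ {n} (F G : Fin n → Fin n → Carrier) →
              pairSum (λ a b → F a b + G a b) ≈ pairSum F + pairSum G
  pairSum-+ F G = trans
    (∑-cong λ a → trans (∑-cong λ b → []-+ (does (a Fin.<? b)) (F a b) (G a b))
      (∑-distrib-+ (λ b → [ does (a Fin.<? b) ] F a b) _))
    (∑-distrib-+ (λ a → sum λ b → [ does (a Fin.<? b) ] F a b) _)

  pairSum-· : ∀ {n} c (F : Fin n → Fin n → Carrier) →
              pairSum (λ a b → c · F a b) ≈ c · pairSum F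
  pairSum-· c F = trans
    (∑-cong λ a → trans (∑-cong λ b → []-· (does (a Fin.<? b)) c (F a b))
      (∑-·ˡ c (λ b → [ does (a Fin.<? b) ] F a b)))
    (∑-·ˡ c (λ a → sum λ b → [ does (a Fin.<? b) ] F a b))

  pairSum-∑ : ∀ {n m} (G : Fin n → Fin n → Fin m → Carrier) →
              sum (λ j → pairSum (λ a b → G a b j)) ≈ pairSum (λ a b → sum (G a b))
  pairSum-∑ G = begin
    sum (λ j → pairSum (λ a b → G a b j))
      ≈⟨ ∑-comm (λ j a → sum λ b → [ does (a Fin.<? b) ] G a b j) ⟩
    sum (λ a → sum λ j → sum λ b → [ does (a Fin.<? b) ] G a b j)
      ≈⟨ ∑-cong (λ a → ∑-comm (λ j b → [ does (a Fin.<? b) ] G a b j)) ⟩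
    sum (λ a → sum λ b → sum λ j → [ does (a Fin.<? b) ] G a b j)
      ≈⟨ ∑-cong (λ a → ∑-cong λ b → ∑-[] (does (a Fin.<? b)) (G a b)) ⟨
    pairSum (λ a b → sum (G a b)) ∎

  pairSum-single : ∀ {n} (F : Fin n → Fin n → Carrier) a b → a Fin.< b →
                   (∀ a′ b′ → a′ Fin.< b′ → ¬ (a′ ≡ a × b′ ≡ b) → F a′ b′ ≈ 0#) → pairSum F ≈ F a b
  pairSum-single F a b a<b off = begin
    pairSum F                            ≈⟨ ∑-single _ a (λ a′ a′≢a → ∑-0 λ b′ → drop a′ b′ (a′≢a ∘ proj₁)) ⟩
    sum (λ b → [ does (a Fin.<? b) ] F a b)  ≈⟨ ∑-single _ b (λ b′ b′≢b → drop a b′ (b′≢b ∘ proj₂)) ⟩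
    [ does (a Fin.<? b) ] F a b              ≈⟨ []-yes (a Fin.<? b) a<b ⟩
    F a b                                ∎
    where
    drop : ∀ a′ b′ → ¬ (a′ ≡ a × b′ ≡ b) → [ does (a′ Fin.<? b′) ] F a′ b′ ≈ 0#
    drop a′ b′ ≢ = trans ([]-cong-dec (a′ Fin.<? b′) (λ a′<b′ → off a′ b′ a′<b′ ≢)) ([]-0 (does (a′ Fin.<? b′)))

  -- A pair a < b contains v either as a or as b; symmetry of F rewrites the second kind, and
  -- trichotomy merges the two sums over the points other than v.
  pairSum-star : ∀ {n} (F : Fin (suc n) → Fin (suc n) → Carrier) → (∀ a b → F a b ≈ F b a) → ∀ v →
    pairSum (λ a b → [ does (a Fin.≟ v) ] F a b + [ does (b Fin.≟ v) ] F a b) ≈ sum (λ k → F v (punchIn v k))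
  pairSum-star F F-sym v = begin
    pairSum (λ a b → [ does (a Fin.≟ v) ] F a b + [ does (b Fin.≟ v) ] F a b)
      ≈⟨ pairSum-+ (λ a b → [ does (a Fin.≟ v) ] F a b) (λ a b → [ does (b Fin.≟ v) ] F a b) ⟩
    pairSum (λ a b → [ does (a Fin.≟ v) ] F a b) + pairSum (λ a b → [ does (b Fin.≟ v) ] F a b)
      ≈⟨ +-cong first second ⟩
    sum (λ b → [ does (v Fin.<? b) ] F v b) + sum (λ b → [ does (b Fin.<? v) ] F v b)
      ≈⟨ ∑-distrib-+ (λ b → [ does (v Fin.<? b) ] F v b) (λ b → [ does (b Fin.<? v) ] F v b) ⟨
    sum (λ b → [ does (v Fin.<? b) ] F v b + [ does (b Fin.<? v) ] F v b)
      ≈⟨ sum-remove {i = v} (λ b → [ does (v Fin.<? b) ] F v b + [ does (b Fin.<? v) ] F v b) ⟩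
    ([ does (v Fin.<? v) ] F v v + [ does (v Fin.<? v) ] F v v)
      + sum (λ k → [ does (v Fin.<? punchIn v k) ] F v (punchIn v k) + [ does (punchIn v k Fin.<? v) ] F v (punchIn v k))
      ≈⟨ +-cong diagonal (∑-cong λ k → off-diagonal (punchIn v k) (Fin.punchInᵢ≢i v k)) ⟩
    0# + sum (λ k → F v (punchIn v k))
      ≈⟨ +-identityˡ _ ⟩
    sum (λ k → F v (punchIn v k)) ∎
    where
    []-comm : ∀ b c x → [ b ] [ c ] x ≈ [ c ] [ b ] x
    []-comm true  c     _ = refl
    []-comm false true  _ = refl
    []-comm false false _ = refl

    first : pairSum (λ a b → [ does (a Fin.≟ v) ] F a b) ≈ sum (λ b → [ does (v Fin.<? b) ] F v b)
    first = begin
      sum (λ a → sum λ b → [ does (a Fin.<? b) ] [ does (a Fin.≟ v) ] F a b)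
        ≈⟨ ∑-cong (λ a → trans (∑-cong λ b → []-comm (does (a Fin.<? b)) (does (a Fin.≟ v)) (F a b))
             (sym (∑-[] (does (a Fin.≟ v)) (λ b → [ does (a Fin.<? b) ] F a b)))) ⟩
      sum (λ a → [ does (a Fin.≟ v) ] sum λ b → [ does (a Fin.<? b) ] F a b)
        ≈⟨ ∑-δ (λ a → sum λ b → [ does (a Fin.<? b) ] F a b) v ⟩
      sum (λ b → [ does (v Fin.<? b) ] F v b) ∎

    second : pairSum (λ a b → [ does (b Fin.≟ v) ] F a b) ≈ sum (λ b → [ does (b Fin.<? v) ] F v b)
    second = ∑-cong λ a → begin
      sum (λ b → [ does (a Fin.<? b) ] [ does (b Fin.≟ v) ] F a b)
        ≈⟨ ∑-cong (λ b → []-comm (does (a Fin.<? b)) (does (b Fin.≟ v)) (F a b)) ⟩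
      sum (λ b → [ does (b Fin.≟ v) ] [ does (a Fin.<? b) ] F a b)
        ≈⟨ ∑-δ (λ b → [ does (a Fin.<? b) ] F a b) v ⟩
      [ does (a Fin.<? v) ] F a v
        ≈⟨ []-cong (does (a Fin.<? v)) (F-sym a v) ⟩
      [ does (a Fin.<? v) ] F v a ∎

    diagonal : [ does (v Fin.<? v) ] F v v + [ does (v Fin.<? v) ] F v v ≈ 0#
    diagonal = trans (+-cong ([]-no (v Fin.<? v) (Fin.<-irrefl ≡.refl)) ([]-no (v Fin.<? v) (Fin.<-irrefl ≡.refl)))
      (+-identityˡ 0#)

    off-diagonal : ∀ b → b ≢ v → [ does (v Fin.<? b) ] F v b + [ does (b Fin.<? v) ] F v b ≈ F v b
    off-diagonal b b≢v with Fin.<-cmp v b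
    ... | tri< v<b _ b≮v = trans (+-cong ([]-yes (v Fin.<? b) v<b) ([]-no (b Fin.<? v) b≮v)) (+-identityʳ _)
    ... | tri≈ _ v≡b _   = contradiction (≡.sym v≡b) b≢v
    ... | tri> v≮b _ b<v = trans (+-cong ([]-no (v Fin.<? b) v≮b) ([]-yes (b Fin.<? v) b<v)) (+-identityˡ _)

transpose-unique : ∀ {n} {a b c d : Fin n} → a Fin.< b → c Fin.< d →
                   transpose a b Perm.≈ transpose c d → a ≡ c × b ≡ d
transpose-unique {a = a} {b} {c} {d} a<b c<d p = go (a Fin.≟ c) (a Fin.≟ d)
  where
  b≡ : b ≡ transpose c d ⟨$⟩ʳ a
  b≡ = ≡.trans (≡.sym (transpose-matchˡ a b)) (p a)
  go : Dec (a ≡ c) → Dec (a ≡ d) → a ≡ c × b ≡ d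
  go (yes ≡.refl) _            = ≡.refl , ≡.trans b≡ (transpose-matchˡ a d)
  go (no _)       (yes ≡.refl) = contradiction c<d
    (Fin.<-asym (≡.subst (a Fin.<_) (≡.trans b≡ (transpose-matchʳ c a)) a<b))
  go (no a≢c)     (no a≢d)     = contradiction (≡.sym (≡.trans b≡ (transpose-other c d a≢c a≢d)))
    (Fin.<⇒≢ a<b)

module _ {n : ℕ} where

  quotient : Fin (n !) → Fin (n !) → Permutation′ n
  quotient i j = flip (decode n j) ∘ₚ decode n i

  t⇒quotient : ∀ {a b i j} → j ≡ t a b i → quotient i j Perm.≈ transpose a b
  t⇒quotient {a} {b} {i} {j} j≡ k = ≡.trans (≡.sym (transpose-involutive a b _))
    (≡.cong (transpose a b ⟨$⟩ʳ_) (begin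
      transpose a b ⟨$⟩ʳ (decode n i ⟨$⟩ʳ l) ≡⟨ decode-act (transpose a b) i l ⟨
      decode n (t a b i) ⟨$⟩ʳ l              ≡⟨ ≡.cong (λ j → decode n j ⟨$⟩ʳ l) j≡ ⟨
      decode n j ⟨$⟩ʳ l                      ≡⟨ Perm.inverseʳ (decode n j) ⟩
      k                                      ∎))
    where
    open ≡.≡-Reasoning
    l = decode n j ⟨$⟩ˡ k

  quotient⇒t : ∀ {a b i j} → quotient i j Perm.≈ transpose a b → j ≡ t a b i
  quotient⇒t {a} {b} {i} {j} p = ≡.trans (≡.sym (encode-decode n j))
    (encode-cong n (decode n j) (decode n i ∘ₚ transpose a b) λ k → begin
      decode n j ⟨$⟩ʳ k
        ≡⟨ transpose-involutive a b (decode n j ⟨$⟩ʳ k) ⟨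
      transpose a b ⟨$⟩ʳ (transpose a b ⟨$⟩ʳ (decode n j ⟨$⟩ʳ k))
        ≡⟨ ≡.cong (transpose a b ⟨$⟩ʳ_) (p (decode n j ⟨$⟩ʳ k)) ⟨
      transpose a b ⟨$⟩ʳ (decode n i ⟨$⟩ʳ (decode n j ⟨$⟩ˡ (decode n j ⟨$⟩ʳ k)))
        ≡⟨ ≡.cong (λ l → transpose a b ⟨$⟩ʳ (decode n i ⟨$⟩ʳ l)) (Perm.inverseˡ (decode n j)) ⟩
      transpose a b ⟨$⟩ʳ (decode n i ⟨$⟩ʳ k) ∎)
    where open ≡.≡-Reasoning

ordered-transposition : ∀ {n} {π : Permutation′ n} → IsTransposition π →
                        ∃₂ λ a b → a Fin.< b × π Perm.≈ transpose a b
ordered-transposition (a , b , a≢b , π≈) with Fin.<-cmp a b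
... | tri< a<b _ _ = a , b , a<b , π≈
... | tri≈ _ a≡b _ = contradiction a≡b a≢b
... | tri> _ _ b<a = b , a , b<a , λ k → ≡.trans (π≈ k) (transpose-sym a b k)

commRing : HeytingField 0ℓ 0ℓ 0ℓ → CommutativeRing 0ℓ 0ℓ
commRing F = HeytingCommutativeRing.commutativeRing (HeytingField.heytingCommutativeRing F)

module Operator (F : HeytingField 0ℓ 0ℓ 0ℓ) where
  open RingLemmas (commRing F)
  open PairSum (commRing F)
  open Spectrum F using (IsEigenvalue; adjacencyMatrix)
  open HeytingField F using (_#_)

  module _ {n : ℕ} (T : TranspositionSet n) where
    open TranspositionSet T
    open SimpleGraph G[ T ]

    A : Vect (n !) → Vect (n !)
    A x i = pairSum λ a b → [ does (a ~? b) ] x (t a b i)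

    A-linear : Linear A
    A-linear = record
      { cong  = λ p i → pairSum-cong λ a b _ → []-cong (does (a ~? b)) (p (t a b i))
      ; add   = λ x y i → trans
          (pairSum-cong λ a b _ → []-+ (does (a ~? b)) (x (t a b i)) (y (t a b i)))
          (pairSum-+ (λ a b → [ does (a ~? b) ] x (t a b i)) _)
      ; scale = λ c x i → trans
          (pairSum-cong λ a b _ → []-· (does (a ~? b)) c (x (t a b i)))
          (pairSum-· c (λ a b → [ does (a ~? b) ] x (t a b i)))
      }

    private
      M = adjacencyMatrix (Sym-finite n) (CaySym T)

    -- The group element `quotient i j` is the transposition of at most one pair a < b, so the
    -- double sum has at most one nonzero term.
    entry : ∀ i j → M i j ≈ pairSum λ a b → [ does (a ~? b) ] [ does (j Fin.≟ t a b i) ] 1#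
    entry i j with quotient i j ∈T?
    ... | yes q∈T with ordered-transposition {π = quotient i j} (transpositions q∈T)
    ...   | a , b , a<b , q≈ = sym (trans (pairSum-single _ a b a<b off) on)
      where
      off : ∀ a′ b′ → a′ Fin.< b′ → ¬ (a′ ≡ a × b′ ≡ b) →
            [ does (a′ ~? b′) ] [ does (j Fin.≟ t a′ b′ i) ] 1# ≈ 0#
      off a′ b′ a′<b′ ≢ with a′ ~? b′ | j Fin.≟ t a′ b′ i
      ... | no  _ | _      = refl
      ... | yes _ | no  _  = refl
      ... | yes _ | yes j≡ = contradiction
        (transpose-unique a′<b′ a<b λ k → ≡.trans (≡.sym (t⇒quotient j≡ k)) (q≈ k)) ≢
      on : [ does (a ~? b) ] [ does (j Fin.≟ t a b i) ] 1# ≈ 1#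
      on with a ~? b | j Fin.≟ t a b i
      ... | yes _   | yes _ = refl
      ... | no ¬a~b | _     = contradiction (∈T-resp {quotient i j} {transpose a b} q≈ q∈T) ¬a~b
      ... | yes _   | no j≢ = contradiction (quotient⇒t {i = i} q≈) j≢
    entry i j | no q∉T = sym (pairSum-0 _ off)
      where
      off : ∀ a b → a Fin.< b → [ does (a ~? b) ] [ does (j Fin.≟ t a b i) ] 1# ≈ 0#
      off a b _ with a ~? b | j Fin.≟ t a b i
      ... | no  _   | _      = refl
      ... | yes _   | no  _  = refl
      ... | yes a~b | yes j≡ = contradiction
        (∈T-resp {transpose a b} {quotient i j} (λ k → ≡.sym (t⇒quotient j≡ k)) a~b) q∉T

    matrix-A : ∀ x i → sum (λ j → M i j · x j) ≈ A x i
    matrix-A x i = begin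
      sum (λ j → M i j · x j)
        ≈⟨ ∑-cong (λ j → trans (*-congʳ (entry i j)) (trans (*-comm _ (x j))
             (sym (pairSum-· (x j) (λ a b → [ does (a ~? b) ] [ does (j Fin.≟ t a b i) ] 1#))))) ⟩
      sum (λ j → pairSum λ a b → x j · [ does (a ~? b) ] [ does (j Fin.≟ t a b i) ] 1#)
        ≈⟨ pairSum-∑ (λ a b j → x j · [ does (a ~? b) ] [ does (j Fin.≟ t a b i) ] 1#) ⟩
      pairSum (λ a b → sum λ j → x j · [ does (a ~? b) ] [ does (j Fin.≟ t a b i) ] 1#)
        ≈⟨ pairSum-cong (λ a b _ → trans
             (∑-cong (λ j → trans (sym ([]-· (does (a ~? b)) (x j) _))
               ([]-cong (does (a ~? b)) (trans (sym ([]-· (does (j Fin.≟ t a b i)) (x j) 1#))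
                 ([]-cong (does (j Fin.≟ t a b i)) (*-identityʳ (x j)))))))
             (trans (sym (∑-[] (does (a ~? b)) (λ j → [ does (j Fin.≟ t a b i) ] x j))) ([]-cong (does (a ~? b)) (∑-δ x (t a b i))))) ⟩
      A x i ∎

    IsEigenvector : Carrier → Vect (n !) → Set
    IsEigenvector μ x = (∃[ i ] x i # 0#) × (∀ i → A x i ≈ μ · x i)

    eigenvalue⇒ : ∀ {μ} → IsEigenvalue M μ → ∃ (IsEigenvector μ)
    eigenvalue⇒ (x , x#0 , eq) = x , x#0 , λ i → trans (sym (matrix-A x i)) (eq i)

    ⇒eigenvalue : ∀ {μ} → ∃ (IsEigenvector μ) → IsEigenvalue M μ
    ⇒eigenvalue (x , x#0 , eq) = x , x#0 , λ i → trans (matrix-A x i) (eq i)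

-- Passage from ℤ to fields of characteristic zero, and splitting off eigenvectors.

module Transfer (R : CommutativeRing 0ℓ 0ℓ) where
  open RingLemmas R
  private module Z = RingLemmas ℤ-ring

  ι-∑ : ∀ {n} (f : Fin n → ℤ) → ι (Z.sum f) ≈ sum (λ i → ι (f i))
  ι-∑ {zero}  f = refl
  ι-∑ {suc n} f = trans (ι-+ (f zero) (Z.sum (f ∘ suc))) (+-congˡ (ι-∑ (f ∘ suc)))

  module _ {n m : ℕ} (e : Fin m → Fin n) (v : Fin n) where
    private
      J  = JM.J R e v
      Jℤ = JM.J ℤ-ring e v

    -- J has integer matrix entries, so it acts on the integer functions `φ k` and leaves the
    -- coefficients `c k` alone. For the standard basis this carries an annihilating product from ℤ
    -- to R.
    transfer : ∀ {N} rs (f : Vect (n !)) (c : Vect N) (φ : Fin N → Z.Vect (n !)) →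
               (f ≋ λ i → sum λ k → c k · ι (φ k i)) →
               prod J (map ι rs) f ≋ λ i → sum λ k → c k · ι (Z.prod Jℤ rs (φ k) i)
    transfer []       f c φ p = p
    transfer {N} (r ∷ rs) f c φ p = transfer rs (λ i → J f i - ι r · f i) c
      (λ k i → Jℤ (φ k) i ℤ.- r ℤ.* φ k i) λ i → begin
        J f i - ι r · f i
          ≈⟨ +-cong (∑-cong λ b → p (t v (e b) i)) (-‿cong (*-congˡ (p i))) ⟩
        sum (λ b → sum λ k → c k · ι (φ k (t v (e b) i))) - ι r · sum (λ k → c k · ι (φ k i))
          ≈⟨ +-cong (∑-comm (λ b k → c k · ι (φ k (t v (e b) i)))) (-‿distribˡ-* (ι r) _) ⟩
        sum (λ k → sum λ b → c k · ι (φ k (t v (e b) i))) + - ι r · sum (λ k → c k · ι (φ k i))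
          ≈⟨ +-cong (∑-cong λ k → trans (∑-·ˡ (c k) (λ b → ι (φ k (t v (e b) i))))
               (*-congˡ (sym (ι-∑ (λ b → φ k (t v (e b) i)))))) (sym (∑-·ˡ (- ι r) (λ k → c k · ι (φ k i)))) ⟩
        sum (λ k → c k · ι (Jℤ (φ k) i)) + sum (λ k → - ι r · (c k · ι (φ k i)))
          ≈⟨ ∑-distrib-+ (λ k → c k · ι (Jℤ (φ k) i)) (λ k → - ι r · (c k · ι (φ k i))) ⟨
        sum (λ k → c k · ι (Jℤ (φ k) i) + - ι r · (c k · ι (φ k i)))
          ≈⟨ ∑-cong (λ k → trans
               (solve 4 (λ c j r x → c :* j :+ (:- r) :* (c :* x) := c :* (j :- r :* x)) refl
                 (c k) (ι (Jℤ (φ k) i)) (ι r) (ι (φ k i)))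
               (*-congˡ (sym (trans (ι-+ (Jℤ (φ k) i) (ℤ.- (r ℤ.* φ k i)))
                 (+-congˡ (trans (ι-neg (r ℤ.* φ k i)) (-‿cong (ι-* r (φ k i))))))))) ⟩
        sum (λ k → c k · ι (Jℤ (φ k) i ℤ.- r ℤ.* φ k i)) ∎
      where open Solver

    prod-vanishes : ∀ rs → (∀ x i → Z.prod Jℤ rs x i ≡ 0ℤ) → ∀ f i → prod J (map ι rs) f i ≈ 0#
    prod-vanishes rs kills f i = trans (transfer rs f f δ expand i)
      (∑-0 λ k → trans (*-congˡ (reflexive (≡.cong ι (kills (δ k) i)))) (zeroʳ (f k)))
      where
      δ : Fin (n !) → Z.Vect (n !)
      δ k i = Z.[ does (k Fin.≟ i) ] ℤ.1ℤ
      ι-δ : ∀ b x → [ b ] x ≈ x · ι (Z.[ b ] ℤ.1ℤ)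
      ι-δ true  x = sym (trans (*-congˡ (+-identityʳ 1#)) (*-identityʳ x))
      ι-δ false x = sym (zeroʳ x)
      expand : f ≋ λ i → sum λ k → f k · ι (δ k i)
      expand i = sym (trans (∑-cong λ k → sym (ι-δ (does (k Fin.≟ i)) (f k))) (∑-δ f i))

module FieldLemmas (F : HeytingField 0ℓ 0ℓ 0ℓ) where
  open HeytingField F using (_#_; #-cotrans; #⇒invertible; invertible⇒#)
  open Algebra.Apartness.Properties.HeytingCommutativeRing (HeytingField.heytingCommutativeRing F) public
    using (invertibleˡ⇒#; #-congʳ; x#0y#0→xy#0)
  open Spectrum F using (CharacteristicZero; fromℤ)
  open RingLemmas (commRing F)

  fromℤ≈ι : ∀ k → fromℤ k ≈ ι k
  fromℤ≈ι (ℤ.+ n)  = refl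
  fromℤ≈ι -[1+ n ] = refl

  unit⇒#0 : ∀ {x y} → y · x ≈ 1# → x # 0#
  unit⇒#0 {x} {y} p = invertibleˡ⇒# (y , trans (*-congˡ (trans (+-congˡ -0#≈0#) (+-identityʳ x))) p)

  #⇒unit : ∀ {x y} → x # y → ∃[ z ] z · (x - y) ≈ 1#
  #⇒unit x#y = let z , p , _ = #⇒invertible x#y in z , p

  #0⇒unit : ∀ {x} → x # 0# → ∃[ y ] y · x ≈ 1#
  #0⇒unit {x} x#0 = let y , p = #⇒unit x#0 in
    y , trans (*-congˡ (sym (trans (+-congˡ -0#≈0#) (+-identityʳ x)))) p

  neg-#0 : ∀ {x} → x # 0# → (- x) # 0#
  neg-#0 {x} x#0 = let y , p = #0⇒unit x#0 in unit⇒#0 {y = - y}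
    (trans (solve 2 (λ x y → (:- y) :* (:- x) := y :* x) refl x y) p)
    where open Solver

  -- Apartness is not decidable, but cotransitivity of x - y # 0 through x still offers a choice; if
  -- x - y # x, then -y is a unit.
  difference-#0 : ∀ {x y} → (x - y) # 0# → x # 0# ⊎ y # 0#
  difference-#0 {x} {y} d with #-cotrans d x
  ... | inj₂ x#0 = inj₁ x#0
  ... | inj₁ q   = let z , p = #⇒unit q in inj₂ (unit⇒#0 {y = - z}
    (trans (solve 3 (λ x y z → (:- z) :* y := z :* ((x :- y) :- x)) refl x y z) p))
    where open Solver

  module _ (char0 : CharacteristicZero) where

    ι-#0 : ∀ k → k ≢ 0ℤ → ι k # 0#
    ι-#0 (ℤ.+ zero)  k≢0 = contradiction ≡.refl k≢0
    ι-#0 (ℤ.+ suc n) k≢0 = char0 n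
    ι-#0 -[1+ n ]    k≢0 = neg-#0 (char0 n)

    -- Distinct integer roots let us split off an eigenvector without deciding equality in F.
    extract : ∀ {N} {J : Vect N → Vect N} → Linear J → (P : Vect N → Set) →
              (∀ c x → P x → P (λ i → J x i - c · x i)) →
              ∀ rs → Unique rs → ∀ x → P x → ∃[ i ] x i # 0# →
              (∀ i → prod J (map ι rs) x i ≈ 0#) →
              ∃₂ λ k y → P y × (∃[ i ] y i # 0#) × (∀ i → J y i ≈ ι k · y i)
    extract {N} {J} lin P P-shift []       _   x Px (i , xi#0) p =
      contradiction (p i) λ xi≈0 → HeytingField.#-irrefl F xi≈0 xi#0
    extract {N} {J} lin P P-shift (r ∷ rs) rs! x = go r rs rs! x
      where
      open Solver
      go : ∀ r rs → Unique (r ∷ rs) → ∀ x → P x → ∃[ i ] x i # 0# →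
           (∀ i → prod J (map ι (r ∷ rs)) x i ≈ 0#) →
           ∃₂ λ k y → P y × (∃[ i ] y i # 0#) × (∀ i → J y i ≈ ι k · y i)
      go r [] _ x Px x#0 p = r , x , Px , x#0 , λ i → x-y≈0⇒x≈y (p i)
        where
        x-y≈0⇒x≈y : ∀ {a b} → a - b ≈ 0# → a ≈ b
        x-y≈0⇒x≈y {a} {b} q = trans (solve 2 (λ a b → a := (a :- b) :+ b) refl a b) (trans (+-congʳ q) (+-identityˡ b))
      go r (s ∷ rs) ((r≢s ∷ r∉) ∷ (s∉ ∷ rs!)) x Px (i , xi#0) p
        = [ (λ q → go r rs (r∉ ∷ rs!) _ (P-shift (ι s) x Px) (i , q)
                 (λ j → trans (prod-swap lin (ι s) (ι r) (map ι rs) x j) (p j)))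
          , (λ q → go s rs (s∉ ∷ rs!) _ (P-shift (ι r) x Px) (i , q) p)
          ]′ (difference-#0 (#-congʳ eq (x#0y#0→xy#0 (ι-#0 (r ℤ.- s) (r≢s ∘ ℤ.i-j≡0⇒i≡j r s)) xi#0)))
        where
        eq : ι (r ℤ.- s) · x i ≈ (J x i - ι s · x i) - (J x i - ι r · x i)
        eq = trans (*-congʳ (trans (ι-+ r (ℤ.- s)) (+-congˡ (ι-neg s))))
          (solve 4 (λ r s x z → (r :- s) :* x := (z :- s :* x) :- (z :- r :* x)) refl (ι r) (ι s) (x i) (J x i))

-- Removing or adding a complete vertex preserves integrality.

module _ {n} (T T′ : TranspositionSet (suc n)) (v : Fin (suc n))
         (v-complete : IsComplete G[ T ] v) (T′≐ : G[ T′ ] ≐ isolate G[ T ] v) where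
  private
    module T  = SimpleGraph G[ T ]
    module T′ = SimpleGraph G[ T′ ]

  module _ (F : HeytingField 0ℓ 0ℓ 0ℓ) where
    open RingLemmas (commRing F)
    open PairSum (commRing F)
    open Operator F
    open JM {suc n} (commRing F)
    private
      Jv = J (punchIn v) v
      lin = J-linear (punchIn v) v

    A-decompose : ∀ x i → A T x i ≈ A T′ x i + Jv x i
    A-decompose x i = begin
      pairSum (λ a b → [ does (a T.~? b) ] x (t a b i))
        ≈⟨ pairSum-cong (λ a b a<b → term a b (x (t a b i)) a<b (a Fin.≟ v) (b Fin.≟ v)) ⟩
      pairSum (λ a b → [ does (a T′.~? b) ] x (t a b i) +
                       ([ does (a Fin.≟ v) ] x (t a b i) + [ does (b Fin.≟ v) ] x (t a b i)))
        ≈⟨ pairSum-+ (λ a b → [ does (a T′.~? b) ] x (t a b i))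
             (λ a b → [ does (a Fin.≟ v) ] x (t a b i) + [ does (b Fin.≟ v) ] x (t a b i)) ⟩
      A T′ x i + pairSum (λ a b → [ does (a Fin.≟ v) ] x (t a b i) + [ does (b Fin.≟ v) ] x (t a b i))
        ≈⟨ +-congˡ (pairSum-star (λ a b → x (t a b i)) (λ a b → reflexive (≡.cong x (t-sym a b i))) v) ⟩
      A T′ x i + Jv x i ∎
      where
      off : ∀ {a b} → ¬ a T.~ b → ¬ a T′.~ b
      off {a} {b} ¬p p = ¬p (proj₂ (proj₂ (Equivalence.to (T′≐ a b) p)))
      offˡ : ∀ {a b} → a ≡ v → ¬ a T′.~ b
      offˡ {a} {b} a≡v p = proj₁ (Equivalence.to (T′≐ a b) p) a≡v
      offʳ : ∀ {a b} → b ≡ v → ¬ a T′.~ b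
      offʳ {a} {b} b≡v p = proj₁ (proj₂ (Equivalence.to (T′≐ a b) p)) b≡v
      term : ∀ a b X → a Fin.< b → (a=v : Dec (a ≡ v)) (b=v : Dec (b ≡ v)) →
             [ does (a T.~? b) ] X ≈ [ does (a T′.~? b) ] X + ([ does a=v ] X + [ does b=v ] X)
      term a b X a<b (yes a≡v) (yes b≡v) = contradiction (≡.trans a≡v (≡.sym b≡v)) (Fin.<⇒≢ a<b)
      term a b X a<b (yes ≡.refl) (no b≢v) = trans ([]-yes (a T.~? b) (v-complete b b≢v))
        (sym (trans (+-cong ([]-no (a T′.~? b) (offˡ ≡.refl)) (+-identityʳ _)) (+-identityˡ _)))
      term a b X a<b (no a≢v) (yes ≡.refl) = trans ([]-yes (a T.~? b) (T.~-sym (v-complete a a≢v)))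
        (sym (trans (+-cong ([]-no (a T′.~? b) (offʳ ≡.refl)) (+-identityˡ _)) (+-identityˡ _)))
      term a b X a<b (no a≢v) (no b≢v) = trans same (sym (trans (+-congˡ (+-identityˡ 0#)) (+-identityʳ _)))
        where
        same : [ does (a T.~? b) ] X ≈ [ does (a T′.~? b) ] X
        same with a T.~? b
        ... | yes p = sym ([]-yes (a T′.~? b) (Equivalence.from (T′≐ a b) (a≢v , b≢v , p)))
        ... | no ¬p = sym ([]-no (a T′.~? b) (off ¬p))

    -- Every transposition of T′ fixes v and permutes the other points by `Perm.remove v τ`, so
    -- `J-act` applies to it.
    A′-J : ∀ x i → A T′ (Jv x) i ≈ Jv (A T′ x) i
    A′-J x i = begin
      pairSum (λ a b → [ does (a T′.~? b) ] Jv x (t a b i))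
        ≈⟨ pairSum-cong (λ a b _ → trans ([]-cong-dec (a T′.~? b) (commute a b))
             (∑-[] (does (a T′.~? b)) (λ k → x (t a b (t v (punchIn v k) i))))) ⟩
      pairSum (λ a b → sum λ k → [ does (a T′.~? b) ] x (t a b (t v (punchIn v k) i)))
        ≈⟨ pairSum-∑ (λ a b k → [ does (a T′.~? b) ] x (t a b (t v (punchIn v k) i))) ⟨
      Jv (A T′ x) i ∎
      where
      commute : ∀ a b → a T′.~ b → Jv x (t a b i) ≈ Jv (x ∘ t a b) i
      commute a b p = sym (J-act (punchIn v) v τ (Perm.remove v τ) τv
        (λ k → ≡.trans (Perm.punchIn-permute τ v k) (≡.cong (λ u → punchIn u (Perm.remove v τ ⟨$⟩ʳ k)) τv)) x i)
        where
        τ = transpose a b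
        a≢v×b≢v = Equivalence.to (T′≐ a b) p
        τv : τ ⟨$⟩ʳ v ≡ v
        τv = transpose-other a b (proj₁ a≢v×b≢v ∘ ≡.sym) (proj₁ (proj₂ a≢v×b≢v) ∘ ≡.sym)

    A-J : ∀ x i → A T (Jv x) i ≈ Jv (A T x) i
    A-J x i = begin
      A T (Jv x) i                        ≈⟨ A-decompose (Jv x) i ⟩
      A T′ (Jv x) i + Jv (Jv x) i         ≈⟨ +-congʳ (A′-J x i) ⟩
      Jv (A T′ x) i + Jv (Jv x) i         ≈⟨ Linear.add lin (A T′ x) (Jv x) i ⟨
      Jv (λ j → A T′ x j + Jv x j) i      ≈⟨ Linear.cong lin (λ j → sym (A-decompose x j)) i ⟩
      Jv (A T x) i                        ∎

    open FieldLemmas F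
    open HeytingField F using (_#_)
    open Spectrum F using (CharacteristicZero; IsInteger; fromℤ)

    module _ (char0 : CharacteristicZero) where

      -- The predicate handed to `extract` is membership of the μ-eigenspace of B, which J - c
      -- preserves because B commutes with J.
      joint-eigenvector : ∀ {B μ} → Linear B → (∀ x i → B (Jv x) i ≈ Jv (B x) i) → ∀ x →
        ∃[ i ] x i # 0# → (∀ i → B x i ≈ μ · x i) →
        ∃₂ λ k y → (∀ i → B y i ≈ μ · y i) × (∃[ i ] y i # 0#) × (∀ i → Jv y i ≈ ι k · y i)
      joint-eigenvector {B} {μ} B-lin B-J x x#0 Bx =
        let rs , rs! , kills = Split.JM-split n (punchIn v)
              (λ {i} {j} → Fin.punchIn-injective v i j) v (λ k p → Fin.punchInᵢ≢i v k (≡.sym p))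
        in extract char0 lin (λ y → ∀ i → B y i ≈ μ · y i) shift rs rs! x Bx x#0
             (Transfer.prod-vanishes (commRing F) (punchIn v) v rs kills x)
        where
        open Solver
        shift : ∀ c y → (∀ i → B y i ≈ μ · y i) →
                ∀ i → B (λ j → Jv y j - c · y j) i ≈ μ · (Jv y i - c · y i)
        shift c y By i = begin
          B (λ j → Jv y j - c · y j) i   ≈⟨ Linear.sub B-lin (Jv y) c y i ⟩
          B (Jv y) i - c · B y i         ≈⟨ +-cong (trans (B-J y i) (trans (Linear.cong lin By i) (Linear.scale lin μ y i)))
                                                   (-‿cong (*-congˡ (By i))) ⟩
          μ · Jv y i - c · (μ · y i)     ≈⟨ solve 4 (λ m j c y → m :* j :- c :* (m :* y) := m :* (j :- c :* y)) refl μ (Jv y i) c (y i) ⟩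
          μ · (Jv y i - c · y i)         ∎

      private
        ι-shift : ∀ {μ} j k → μ + ι k ≈ fromℤ j → μ ≈ fromℤ (j ℤ.- k)
        ι-shift {μ} j k p = begin
          μ                ≈⟨ solve 2 (λ m k → m := (m :+ k) :- k) refl μ (ι k) ⟩
          (μ + ι k) - ι k  ≈⟨ +-congʳ (trans p (fromℤ≈ι j)) ⟩
          ι j - ι k        ≈⟨ trans (ι-+ j (ℤ.- k)) (+-congˡ (ι-neg k)) ⟨
          ι (j ℤ.- k)      ≈⟨ fromℤ≈ι (j ℤ.- k) ⟨
          fromℤ (j ℤ.- k)  ∎
          where open Solver

      to-T′ : (∀ μ → ∃ (IsEigenvector T μ) → IsInteger μ) → ∀ μ → ∃ (IsEigenvector T′ μ) → IsInteger μ
      to-T′ integral μ (x , x#0 , eq) =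
        let k , y , Ay , y#0 , Jy = joint-eigenvector (A-linear T′) A′-J x x#0 eq
            j , p = integral (μ + ι k) (y , y#0 , λ i → begin
              A T y i                  ≈⟨ A-decompose y i ⟩
              A T′ y i + Jv y i        ≈⟨ +-cong (Ay i) (Jy i) ⟩
              μ · y i + ι k · y i      ≈⟨ distribʳ (y i) μ (ι k) ⟨
              (μ + ι k) · y i          ∎)
        in j ℤ.- k , ι-shift j k p

      from-T′ : (∀ μ → ∃ (IsEigenvector T′ μ) → IsInteger μ) → ∀ μ → ∃ (IsEigenvector T μ) → IsInteger μ
      from-T′ integral μ (x , x#0 , eq) =
        let k , y , Ay , y#0 , Jy = joint-eigenvector (A-linear T) A-J x x#0 eq
            j , p = integral (μ - ι k) (y , y#0 , λ i → begin
              A T′ y i                          ≈⟨ solve 2 (λ a j → a := (a :+ j) :- j) refl (A T′ y i) (Jv y i) ⟩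
              (A T′ y i + Jv y i) - Jv y i      ≈⟨ +-cong (trans (sym (A-decompose y i)) (Ay i)) (-‿cong (Jy i)) ⟩
              μ · y i - ι k · y i               ≈⟨ solve 3 (λ m k y → m :* y :- k :* y := (m :- k) :* y) refl μ (ι k) (y i) ⟩
              (μ - ι k) · y i                   ∎)
        in j ℤ.- (ℤ.- k) , ι-shift j (ℤ.- k) (trans (+-congˡ (ι-neg k)) p)
        where open Solver

  complete-vertex-integral : IntegralCay T ⇔ IntegralCay T′
  complete-vertex-integral = mk⇔
    (λ integral F char0 μ eig → to-T′ F char0
      (λ ν e → integral F char0 ν (Operator.⇒eigenvalue F T e)) μ (Operator.eigenvalue⇒ F T′ eig))
    (λ integral F char0 μ eig → from-T′ F char0
      (λ ν e → integral F char0 ν (Operator.⇒eigenvalue F T′ e)) μ (Operator.eigenvalue⇒ F T eig))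

-- The Laplacian of an integral graph has integer eigenvalues.

module Laplacian (R : CommutativeRing 0ℓ 0ℓ) {n} (Γ : Graph n) where
  open RingLemmas R
  open SimpleGraph Γ

  laplacian : Vect n → Vect n
  laplacian x j = sum λ b → [ does (j ~? b) ] (x j - x b)

  laplacian-linear : Linear laplacian
  laplacian-linear = record
    { cong  = λ p j → ∑-cong λ b → []-cong (does (j ~? b)) (+-cong (p j) (-‿cong (p b)))
    ; add   = λ x y j → trans
        (∑-cong λ b → trans ([]-cong (does (j ~? b))
            (solve 4 (λ a b c d → (a :+ b) :- (c :+ d) := (a :- c) :+ (b :- d)) refl (x j) (y j) (x b) (y b)))
          ([]-+ (does (j ~? b)) (x j - x b) (y j - y b)))
        (∑-distrib-+ (λ b → [ does (j ~? b) ] (x j - x b)) (λ b → [ does (j ~? b) ] (y j - y b)))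
    ; scale = λ c x j → trans
        (∑-cong λ b → trans ([]-cong (does (j ~? b))
            (solve 3 (λ c x y → c :* x :- c :* y := c :* (x :- y)) refl c (x j) (x b)))
          ([]-· (does (j ~? b)) c (x j - x b)))
        (∑-·ˡ c (λ b → [ does (j ~? b) ] (x j - x b)))
    } where open Solver

module LaplacianEigenvalue {n} (T : TranspositionSet (suc n)) (F : HeytingField 0ℓ 0ℓ 0ℓ) where
  open RingLemmas (commRing F)
  open PairSum (commRing F)
  open Operator F
  open FieldLemmas F
  open HeytingField F using (_#_)
  open Spectrum F using (CharacteristicZero; IsInteger; fromℤ)
  open SimpleGraph G[ T ]
  open Laplacian (commRing F) G[ T ] using (laplacian)
  private
    module ZP = PairSum ℤ-ring
    module Z = RingLemmas ℤ-ring

  ∣T∣ : Carrier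
  ∣T∣ = pairSum λ a b → [ does (a ~? b) ] 1#

  ∣T∣ℤ : ℤ
  ∣T∣ℤ = ZP.pairSum λ a b → Z.[ does (a ~? b) ] ℤ.1ℤ

  ι-∣T∣ : ι ∣T∣ℤ ≈ ∣T∣
  ι-∣T∣ = trans (Transfer.ι-∑ (commRing F) (λ a → Z.sum (row a))) (∑-cong λ a →
    trans (Transfer.ι-∑ (commRing F) (row a)) (∑-cong λ b →
    trans (ι-[] (does (a Fin.<? b)) (Z.[ does (a ~? b) ] ℤ.1ℤ)) ([]-cong (does (a Fin.<? b))
      (trans (ι-[] (does (a ~? b)) ℤ.1ℤ) ([]-cong (does (a ~? b)) (+-identityʳ 1#))))))
    where
    row : Fin (suc n) → Fin (suc n) → ℤ
    row a b = Z.[ does (a Fin.<? b) ] Z.[ does (a ~? b) ] ℤ.1ℤ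
    ι-[] : ∀ b x → ι (Z.[ b ] x) ≈ [ b ] ι x
    ι-[] true  x = refl
    ι-[] false x = refl

  module _ (x : Fin (suc n) → Carrier) where

    move : Fin (suc n) → Fin (suc n) → Fin (suc n) → Carrier
    move j a b = x (transpose a b ⟨$⟩ʳ j)

    -- The change of x at j along the edge ab. It vanishes unless the transposition moves j, which
    -- leaves only a star of pairs at j.
    G : Fin (suc n) → Fin (suc n) → Fin (suc n) → Carrier
    G j a b = [ does (a ~? b) ] (move j a b - x j)

    G-sym : ∀ j a b → G j a b ≈ G j b a
    G-sym j a b = trans ([]-cong (does (a ~? b)) (+-congʳ (reflexive (≡.cong x (transpose-sym a b j)))))
      (swap (a ~? b) (b ~? a))
      where
      swap : ∀ {X} (d : Dec (a ~ b)) (e : Dec (b ~ a)) → [ does d ] X ≈ [ does e ] X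
      swap (yes p) e = sym ([]-yes e (~-sym p))
      swap (no ¬p) e = sym ([]-no e (¬p ∘ ~-sym))

    term : ∀ j a b → a Fin.< b → (a=j : Dec (a ≡ j)) (b=j : Dec (b ≡ j)) →
           [ does (a ~? b) ] move j a b ≈
           x j · [ does (a ~? b) ] 1# + ([ does a=j ] G j a b + [ does b=j ] G j a b)
    term j a b a<b a=j b=j = begin
      [ d ] move j a b
        ≈⟨ []-cong d (solve 2 (λ m x → m := x :+ (m :- x)) refl (move j a b) (x j)) ⟩
      [ d ] (x j + (move j a b - x j))
        ≈⟨ []-+ d (x j) _ ⟩
      [ d ] x j + G j a b
        ≈⟨ +-cong (trans ([]-cong d (sym (*-identityʳ (x j)))) ([]-· d (x j) 1#)) (cases a=j b=j) ⟩
      x j · [ d ] 1# + ([ does a=j ] G j a b + [ does b=j ] G j a b) ∎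
      where
      open Solver
      d = does (a ~? b)
      cases : (a=j : Dec (a ≡ j)) (b=j : Dec (b ≡ j)) → G j a b ≈ [ does a=j ] G j a b + [ does b=j ] G j a b
      cases (yes a≡j) (yes b≡j) = contradiction (≡.trans a≡j (≡.sym b≡j)) (Fin.<⇒≢ a<b)
      cases (yes _)   (no _)    = sym (+-identityʳ _)
      cases (no _)    (yes _)   = sym (+-identityˡ _)
      cases (no a≢j)  (no b≢j)  = trans
        (trans ([]-cong d (trans (+-congʳ (reflexive (≡.cong x (transpose-other a b (a≢j ∘ ≡.sym) (b≢j ∘ ≡.sym)))))
                 (-‿inverseʳ (x j)))) ([]-0 d))
        (sym (+-identityˡ 0#))

    -- On functions of the image of a point, A acts as |T| − Laplacian.
    pairSum-move : ∀ j → pairSum (λ a b → [ does (a ~? b) ] move j a b) ≈ x j · ∣T∣ - laplacian x j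
    pairSum-move j = begin
      pairSum (λ a b → [ does (a ~? b) ] move j a b)
        ≈⟨ pairSum-cong (λ a b a<b → term j a b a<b (a Fin.≟ j) (b Fin.≟ j)) ⟩
      pairSum (λ a b → x j · [ does (a ~? b) ] 1# + ([ does (a Fin.≟ j) ] G j a b + [ does (b Fin.≟ j) ] G j a b))
        ≈⟨ pairSum-+ (λ a b → x j · [ does (a ~? b) ] 1#) (λ a b → [ does (a Fin.≟ j) ] G j a b + [ does (b Fin.≟ j) ] G j a b) ⟩
      pairSum (λ a b → x j · [ does (a ~? b) ] 1#) + pairSum (λ a b → [ does (a Fin.≟ j) ] G j a b + [ does (b Fin.≟ j) ] G j a b)
        ≈⟨ +-cong (pairSum-· (x j) (λ a b → [ does (a ~? b) ] 1#)) (pairSum-star (G j) (G-sym j) j) ⟩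
      x j · ∣T∣ + sum (λ k → G j j (punchIn j k))
        ≈⟨ +-congˡ (trans (∑-cong λ k → edge (punchIn j k)) (trans (∑-·ˡ (- 1#) (g ∘ punchIn j)) (-1*x≈-x _))) ⟩
      x j · ∣T∣ - sum (g ∘ punchIn j)
        ≈⟨ +-congˡ (-‿cong (trans (sym (+-identityˡ _)) (+-congʳ (sym g-diagonal)))) ⟩
      x j · ∣T∣ - (g j + sum (g ∘ punchIn j))
        ≈⟨ +-congˡ (-‿cong (sum-remove {i = j} g)) ⟨
      x j · ∣T∣ - laplacian x j ∎
      where
      open Solver
      g : Fin (suc n) → Carrier
      g b = [ does (j ~? b) ] (x j - x b)
      g-diagonal : g j ≈ 0#
      g-diagonal = []-no (j ~? j) (~-irrefl ≡.refl)
      edge : ∀ b → G j j b ≈ - 1# · g b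
      edge b = trans ([]-cong (does (j ~? b)) (trans (+-congʳ (reflexive (≡.cong x (transpose-matchˡ j b))))
        (trans (solve 2 (λ x y → y :- x := :- (x :- y)) refl (x j) (x b)) (sym (-1*x≈-x _)))))
        ([]-· (does (j ~? b)) (- 1#) (x j - x b))

  -- `∣T∣ - μ` is an eigenvalue of the Cayley graph, and `∣T∣` is the image of an integer.
  laplacian-integral : IntegralCay T → CharacteristicZero → ∀ x μ → ∃[ j ] x j # 0# →
                       (∀ j → laplacian x j ≈ μ · x j) → IsInteger μ
  laplacian-integral integral char0 x μ (j , xj#0) eq =
    let k , p = integral F char0 (∣T∣ - μ) (⇒eigenvalue T (f , (index , f#0) , eigen))
    in ∣T∣ℤ ℤ.- k , (begin
      μ                        ≈⟨ solve 2 (λ c m → m := c :- (c :- m)) refl ∣T∣ μ ⟩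
      ∣T∣ - (∣T∣ - μ)          ≈⟨ +-cong (sym ι-∣T∣) (-‿cong (trans p (fromℤ≈ι k))) ⟩
      ι ∣T∣ℤ - ι k             ≈⟨ trans (ι-+ ∣T∣ℤ (ℤ.- k)) (+-congˡ (ι-neg k)) ⟨
      ι (∣T∣ℤ ℤ.- k)           ≈⟨ fromℤ≈ι (∣T∣ℤ ℤ.- k) ⟨
      fromℤ (∣T∣ℤ ℤ.- k)       ∎)
    where
    open Solver
    point : Fin (suc n !) → Fin (suc n)
    point i = decode (suc n) i ⟨$⟩ʳ zero
    f : Vect (suc n !)
    f i = x (point i)
    -- A permutation taking `zero` to j, at which f has the value x j # 0.
    index = encode (suc n) (transpose zero j)
    f#0 : f index # 0#
    f#0 = ≡.subst (λ k → x k # 0#) (≡.sym (≡.trans (decode-encode (suc n) (transpose zero j) zero) (transpose-matchˡ zero j))) xj#0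
    eigen : ∀ i → A T f i ≈ (∣T∣ - μ) · f i
    eigen i = begin
      pairSum (λ a b → [ does (a ~? b) ] f (t a b i))
        ≈⟨ pairSum-cong (λ a b _ → []-cong (does (a ~? b)) (reflexive (≡.cong x (decode-act (transpose a b) i zero)))) ⟩
      pairSum (λ a b → [ does (a ~? b) ] move x (point i) a b)
        ≈⟨ pairSum-move x (point i) ⟩
      f i · ∣T∣ - laplacian x (point i)
        ≈⟨ +-congˡ (-‿cong (eq (point i))) ⟩
      f i · ∣T∣ - μ · f i
        ≈⟨ solve 3 (λ f c m → f :* c :- m :* f := (c :- m) :* f) refl (f i) ∣T∣ μ ⟩
      (∣T∣ - μ) · f i ∎

-- Linear dependence over fields with decidable zero.

record DiscreteField : Set₁ where
  field
    scalars : CommutativeRing 0ℓ 0ℓ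
  open CommutativeRing scalars using (Carrier; _≈_; _*_; 0#; 1#)
  field
    _≟0     : ∀ x → Dec (x ≈ 0#)
    inverse : ∀ x → ¬ x ≈ 0# → ∃[ y ] y * x ≈ 1#
    1≉0     : ¬ 1# ≈ 0#

module LinearDependence (K : DiscreteField) where
  open DiscreteField K
  open RingLemmas scalars

  unit-cancel : ∀ {e x} → ¬ e ≈ 0# → e · x ≈ 0# → x ≈ 0#
  unit-cancel {e} {x} e≉0 p = let f , fe≈1 = inverse e e≉0 in begin
    x            ≈⟨ *-identityˡ x ⟨
    1# · x       ≈⟨ *-congʳ fe≈1 ⟨
    f · e · x    ≈⟨ *-assoc f e x ⟩
    f · (e · x)  ≈⟨ *-congˡ p ⟩
    f · 0#       ≈⟨ zeroʳ f ⟩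
    0#           ∎

  Dependent : ∀ {m n} → (Fin m → Vect n) → Set
  Dependent {m} v = Σ (Vect m) λ c → (∃[ i ] ¬ c i ≈ 0#) × (∀ j → sum (λ i → c i · v i j) ≈ 0#)

  dependent : ∀ n (v : Fin (suc n) → Vect n) → Dependent v
  dependent zero    v = (λ _ → 1#) , (zero , 1≉0) , λ ()
  dependent (suc n) v = go (Fin.any? λ i → ¬? (v i zero ≟0))
    where
    open Solver
    go : Dec (∃[ i ] ¬ v i zero ≈ 0#) → Dependent v
    go (no ¬p) = extend (dependent n (λ i j → v (suc i) (suc j)))
      where
      column-zero : ∀ i → v i zero ≈ 0#
      column-zero i = decidable-stable (v i zero ≟0) λ p → ¬p (i , p)

      extend : Dependent (λ i j → v (suc i) (suc j)) → Dependent v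
      extend (c , (i , ci≉0) , eq) = c′ , (suc i , ci≉0) , vanish
        where
        c′ : Vect (suc (suc n))
        c′ = insertAt c zero 0#
        vanish : ∀ j → sum (λ i → c′ i · v i j) ≈ 0#
        vanish zero    = ∑-0 λ i → trans (*-congˡ (column-zero i)) (zeroʳ (c′ i))
        vanish (suc j) = trans (+-cong (zeroˡ (v zero (suc j))) (eq j)) (+-identityˡ 0#)
    go (yes (p , vp≉0)) =
      eliminate (dependent n (λ i j → bracket i (suc j)))
      where
      -- Division-free elimination: these combinations with the pivot vector vanish in coordinate
      -- `zero`. A relation c among them becomes one among the original vectors, with coefficients v
      -- p zero · c i, and `pivot c` at p.
      bracket : Fin (suc n) → Fin (suc n) → Carrier
      bracket i j = v p zero · v (punchIn p i) j - v (punchIn p i) zero · v p j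

      pivot : Vect (suc n) → Carrier
      pivot c = - sum (λ i → c i · v (punchIn p i) zero)

      vanish : ∀ c → (∀ j → sum (λ i → c i · bracket i (suc j)) ≈ 0#) → ∀ j → sum (λ i → c i · bracket i j) ≈ 0#
      vanish c eq zero    = ∑-0 λ i → trans (*-congˡ (trans (+-congʳ (*-comm (v p zero) (v (punchIn p i) zero))) (-‿inverseʳ _))) (zeroʳ (c i))
      vanish c eq (suc j) = eq j

      expand : ∀ c j → sum (λ k → insertAt (λ i → v p zero · c i) p (pivot c) k · v k j) ≈ sum (λ i → c i · bracket i j)
      expand c j = begin
        sum (λ k → d k · v k j)
          ≈⟨ sum-remove {i = p} (λ k → d k · v k j) ⟩
        d p · v p j + sum (λ i → d (punchIn p i) · v (punchIn p i) j)
          ≈⟨ +-cong (*-congʳ (reflexive (insertAt-lookup (λ i → v p zero · c i) p (pivot c))))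
               (∑-cong λ i → *-congʳ {v (punchIn p i) j} (reflexive (insertAt-punchIn (λ i → v p zero · c i) p (pivot c) i))) ⟩
        pivot c · v p j + sum (λ i → v p zero · c i · v (punchIn p i) j)
          ≈⟨ +-congʳ (trans (solve 2 (λ s x → (:- s) :* x := (:- x) :* s) refl _ (v p j))
               (sym (∑-·ˡ (- v p j) (λ i → c i · v (punchIn p i) zero)))) ⟩
        sum (λ i → - v p j · (c i · v (punchIn p i) zero)) + sum (λ i → v p zero · c i · v (punchIn p i) j)
          ≈⟨ ∑-distrib-+ (λ i → - v p j · (c i · v (punchIn p i) zero)) (λ i → v p zero · c i · v (punchIn p i) j) ⟨
        sum (λ i → - v p j · (c i · v (punchIn p i) zero) + v p zero · c i · v (punchIn p i) j)
          ≈⟨ ∑-cong (λ i → solve 5 (λ c x y z w → (:- x) :* (c :* y) :+ z :* c :* w := c :* (z :* w :- y :* x)) refl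
               (c i) (v p j) (v (punchIn p i) zero) (v p zero) (v (punchIn p i) j)) ⟩
        sum (λ i → c i · bracket i j) ∎
        where d = insertAt (λ i → v p zero · c i) p (pivot c)

      eliminate : Dependent (λ i j → bracket i (suc j)) → Dependent v
      eliminate (c , (i , ci≉0) , eq) = insertAt (λ i → v p zero · c i) p (pivot c)
        , (punchIn p i , λ q → ci≉0 (unit-cancel vp≉0 (trans
            (reflexive (≡.sym (insertAt-punchIn (λ i → v p zero · c i) p (pivot c) i))) q)))
        , λ j → trans (expand c j) (vanish c eq j)

-- Polynomials in an operator, and the field K[X]/Ann(w) for an annihilator of least degree.

module Polynomials (K : DiscreteField) {n : ℕ}
  {L : RingLemmas.Vect (DiscreteField.scalars K) n → RingLemmas.Vect (DiscreteField.scalars K) n}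
  (L-linear : RingLemmas.Linear (DiscreteField.scalars K) L) where
  open DiscreteField K
  open RingLemmas scalars
  open Solver
  open LinearDependence K

  private
    V = Vect n
    module L = Linear L-linear

  -- The action on V of the polynomial with coefficients p, and of the monic
  -- polynomial with lower coefficients cs, where X acts as L.
  eval : List Carrier → V → V
  eval []      y i = 0#
  eval (c ∷ p) y i = c · y i + L (eval p y) i

  monic : ∀ {m} → Vec Carrier m → V → V
  monic []       y i = y i
  monic (c ∷ cs) y i = c · y i + L (monic cs y) i

  evalᵥ : ∀ {m} → Vec Carrier m → V → V
  evalᵥ r = eval (toList r)

  private
    step-linear : ∀ c {K : V → V} → Linear K → Linear (λ y i → c · y i + L (K y) i)
    step-linear c K-lin = record
      { cong  = λ p i → +-cong (*-congˡ (p i)) (L.cong (K.cong p) i)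
      ; add   = λ x y i → trans (+-congˡ (trans (L.cong (K.add x y) i) (L.add _ _ i)))
          (solve 5 (λ c x y u v → c :* (x :+ y) :+ (u :+ v) := (c :* x :+ u) :+ (c :* y :+ v)) refl c (x i) (y i) _ _)
      ; scale = λ d x i → trans (+-congˡ (trans (L.cong (K.scale d x) i) (L.scale d _ i)))
          (solve 4 (λ c d x u → c :* (d :* x) :+ d :* u := d :* (c :* x :+ u)) refl c d (x i) _)
      }
      where module K = Linear K-lin

  eval-linear : ∀ p → Linear (eval p)
  eval-linear []      = record
    { cong = λ _ _ → refl ; add = λ _ _ _ → sym (+-identityˡ 0#) ; scale = λ d _ _ → sym (zeroʳ d) }
  eval-linear (c ∷ p) = step-linear c (eval-linear p)

  monic-linear : ∀ {m} (cs : Vec Carrier m) → Linear (monic cs)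
  monic-linear []       = record { cong = λ p → p ; add = λ _ _ _ → refl ; scale = λ _ _ _ → refl }
  monic-linear (c ∷ cs) = step-linear c (monic-linear cs)

  module _ {K : V → V} (K-lin : Linear K) (K-L : ∀ y → K (L y) ≋ L (K y)) where
    private
      module K = Linear K-lin
      step-comm : ∀ c {M : V → V} → (∀ y → K (M y) ≋ M (K y)) → ∀ y →
                  K (λ i → c · y i + L (M y) i) ≋ λ i → c · K y i + L (M (K y)) i
      step-comm c K-M y i = trans (K.add _ _ i)
        (+-cong (K.scale c y i) (trans (K-L _ i) (L.cong (K-M y) i)))

    eval-comm : ∀ p y → K (eval p y) ≋ eval p (K y)
    eval-comm []      y = K.at-0 (λ _ → refl)
    eval-comm (c ∷ p) y = step-comm c (eval-comm p) y

    monic-comm : ∀ {m} (cs : Vec Carrier m) y → K (monic cs y) ≋ monic cs (K y)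
    monic-comm []       y i = refl
    monic-comm (c ∷ cs) y = step-comm c (monic-comm cs) y

  eval-L : ∀ p y → eval p (L y) ≋ L (eval p y)
  eval-L p y i = sym (eval-comm L-linear (λ _ _ → refl) p y i)

  monic-L : ∀ {m} (cs : Vec Carrier m) y → monic cs (L y) ≋ L (monic cs y)
  monic-L cs y i = sym (monic-comm L-linear (λ _ _ → refl) cs y i)

  infixl 6 _⊕_
  infixl 7 _⊛_ _⊗_

  _⊕_ : List Carrier → List Carrier → List Carrier
  []      ⊕ q       = q
  (c ∷ p) ⊕ []      = c ∷ p
  (c ∷ p) ⊕ (d ∷ q) = c + d ∷ p ⊕ q

  _⊛_ : Carrier → List Carrier → List Carrier
  c ⊛ p = map (c ·_) p

  _⊗_ : List Carrier → List Carrier → List Carrier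
  []      ⊗ q = []
  (c ∷ p) ⊗ q = c ⊛ q ⊕ (0# ∷ p ⊗ q)

  eval-⊕ : ∀ p q y → eval (p ⊕ q) y ≋ λ i → eval p y i + eval q y i
  eval-⊕ []      q       y i = sym (+-identityˡ _)
  eval-⊕ (c ∷ p) []      y i = sym (+-identityʳ _)
  eval-⊕ (c ∷ p) (d ∷ q) y i = trans (+-congˡ (trans (L.cong (eval-⊕ p q y) i) (L.add _ _ i)))
    (solve 5 (λ c d y u v → (c :+ d) :* y :+ (u :+ v) := (c :* y :+ u) :+ (d :* y :+ v)) refl c d (y i) _ _)

  eval-⊛ : ∀ c p y → eval (c ⊛ p) y ≋ λ i → c · eval p y i
  eval-⊛ c []      y i = sym (zeroʳ c)
  eval-⊛ c (d ∷ p) y i = trans (+-congˡ (trans (L.cong (eval-⊛ c p y) i) (L.scale c _ i)))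
    (solve 4 (λ c d y u → (c :* d) :* y :+ c :* u := c :* (d :* y :+ u)) refl c d (y i) _)

  eval-⊗ : ∀ p q y → eval (p ⊗ q) y ≋ eval p (eval q y)
  eval-⊗ []      q y i = refl
  eval-⊗ (c ∷ p) q y i = trans (eval-⊕ (c ⊛ q) (0# ∷ p ⊗ q) y i)
    (+-cong (eval-⊛ c q y i) (trans (+-cong (zeroˡ (y i)) (L.cong (eval-⊗ p q y) i)) (+-identityˡ _)))

  monicList : ∀ {m} → Vec Carrier m → List Carrier
  monicList []       = 1# ∷ []
  monicList (c ∷ cs) = c ∷ monicList cs

  eval-monicList : ∀ {m} (cs : Vec Carrier m) y → eval (monicList cs) y ≋ monic cs y
  eval-monicList []       y i = trans (+-cong (*-identityˡ (y i)) (L.at-0 (λ _ → refl) i)) (+-identityʳ _)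
  eval-monicList (c ∷ cs) y i = +-congˡ (L.cong (eval-monicList cs y) i)

  -- Division of X·r + c by a monic polynomial of degree m, for r of degree < m.
  reduce-step : ∀ {m} (cs r : Vec Carrier m) c → ∃₂ λ e (r′ : Vec Carrier m) →
                ∀ y i → c · y i + L (evalᵥ r y) i ≈ e · monic cs y i + evalᵥ r′ y i
  reduce-step []       []      c = c , [] , λ y i → +-congˡ (L.at-0 (λ _ → refl) i)
  reduce-step (a ∷ cs) (b ∷ r) c = let e , r′ , eq = reduce-step cs r b in
    e , (c - e · a) ∷ r′ , λ y i → begin
      c · y i + L (evalᵥ (b ∷ r) y) i
        ≈⟨ +-congˡ (trans (L.cong (eq y) i) (trans (L.add _ _ i) (+-congʳ (L.scale e _ i)))) ⟩
      c · y i + (e · L (monic cs y) i + L (evalᵥ r′ y) i)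
        ≈⟨ solve 6 (λ a c e y u v → c :* y :+ (e :* u :+ v) := e :* (a :* y :+ u) :+ ((c :- e :* a) :* y :+ v))
             refl a c e (y i) _ _ ⟩
      e · monic (a ∷ cs) y i + evalᵥ ((c - e · a) ∷ r′) y i ∎

  reduce : ∀ {m} (cs : Vec Carrier m) p → ∃₂ λ s (r : Vec Carrier m) →
           ∀ y i → eval p y i ≈ monic cs (eval s y) i + evalᵥ r y i
  reduce {m} cs []      = [] , Vec.replicate m 0# , λ y i →
    sym (trans (+-cong (Linear.at-0 (monic-linear cs) (λ _ → refl) i) (zeros m y i)) (+-identityˡ 0#))
    where
    zeros : ∀ m y i → evalᵥ {m} (Vec.replicate m 0#) y i ≈ 0#
    zeros zero    y i = refl
    zeros (suc m) y i = trans (+-cong (zeroˡ (y i)) (L.at-0 (zeros m y) i)) (+-identityˡ 0#)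
  reduce cs (c ∷ p) = let s , r , eq = reduce cs p ; e , r′ , eq′ = reduce-step cs r c in
    e ∷ s , r′ , λ y i → begin
      c · y i + L (eval p y) i
        ≈⟨ +-congˡ (trans (L.cong (eq y) i) (L.add _ _ i)) ⟩
      c · y i + (L (monic cs (eval s y)) i + L (evalᵥ r y) i)
        ≈⟨ solve 3 (λ a b c → a :+ (b :+ c) := b :+ (a :+ c)) refl _ _ _ ⟩
      L (monic cs (eval s y)) i + (c · y i + L (evalᵥ r y) i)
        ≈⟨ +-cong (sym (monic-L cs (eval s y) i)) (eq′ y i) ⟩
      monic cs (L (eval s y)) i + (e · monic cs y i + evalᵥ r′ y i)
        ≈⟨ solve 3 (λ a b c → b :+ (a :+ c) := (a :+ b) :+ c) refl _ _ _ ⟩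
      (e · monic cs y i + monic cs (L (eval s y)) i) + evalᵥ r′ y i
        ≈⟨ +-congʳ (trans (Linear.add (monic-linear cs) _ _ i) (+-congʳ (Linear.scale (monic-linear cs) e y i))) ⟨
      monic cs (eval (e ∷ s) y) i + evalᵥ r′ y i ∎

  -- Unlike in `reduce`, the quotient is monic of known degree, so that minimality can later be
  -- applied to the quotient itself.
  divide-monic : ∀ {m} (cs : Vec Carrier m) k (ps : Vec Carrier (k ℕ.+ m)) →
                 ∃₂ λ (ss : Vec Carrier k) (r : Vec Carrier m) →
                 ∀ y i → monic ps y i ≈ monic cs (monic ss y) i + evalᵥ r y i
  divide-monic cs zero    ps = [] , Vec.zipWith _-_ ps cs , diff cs ps
    where
    diff : ∀ {m} (cs ps : Vec Carrier m) y i → monic ps y i ≈ monic cs y i + evalᵥ (Vec.zipWith _-_ ps cs) y i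
    diff []       []       y i = sym (+-identityʳ _)
    diff (c ∷ cs) (p ∷ ps) y i = trans (+-congˡ (trans (L.cong (diff cs ps y) i) (L.add _ _ i)))
      (solve 5 (λ c p y u v → p :* y :+ (u :+ v) := (c :* y :+ u) :+ ((p :- c) :* y :+ v)) refl c p (y i) _ _)
  divide-monic cs (suc k) (c ∷ ps) =
    let ss , r , eq = divide-monic cs k ps ; e , r′ , eq′ = reduce-step cs r c in
    e ∷ ss , r′ , λ y i → begin
      c · y i + L (monic ps y) i
        ≈⟨ +-congˡ (trans (L.cong (eq y) i) (L.add _ _ i)) ⟩
      c · y i + (L (monic cs (monic ss y)) i + L (evalᵥ r y) i)
        ≈⟨ solve 3 (λ a b c → a :+ (b :+ c) := b :+ (a :+ c)) refl _ _ _ ⟩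
      L (monic cs (monic ss y)) i + (c · y i + L (evalᵥ r y) i)
        ≈⟨ +-cong (sym (monic-L cs (monic ss y) i)) (eq′ y i) ⟩
      monic cs (L (monic ss y)) i + (e · monic cs y i + evalᵥ r′ y i)
        ≈⟨ solve 3 (λ a b c → b :+ (a :+ c) := (a :+ b) :+ c) refl _ _ _ ⟩
      (e · monic cs y i + monic cs (L (monic ss y)) i) + evalᵥ r′ y i
        ≈⟨ +-congʳ (trans (Linear.add (monic-linear cs) _ _ i) (+-congʳ (Linear.scale (monic-linear cs) e y i))) ⟨
      monic cs (monic (e ∷ ss) y) i + evalᵥ r′ y i ∎

  evalᵥ-zero : ∀ {m} {r : Vec Carrier m} → All (_≈ 0#) r → ∀ y i → evalᵥ r y i ≈ 0#
  evalᵥ-zero []       y i = refl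
  evalᵥ-zero (p ∷ ps) y i = trans (+-cong (trans (*-congʳ p) (zeroˡ (y i))) (L.at-0 (evalᵥ-zero ps y) i)) (+-identityˡ 0#)

  IsMultipleOfMonic : ∀ {m} → Vec Carrier m → Set
  IsMultipleOfMonic {m} r = ∃[ k ] k ℕ.< m × ∃₂ λ (cs : Vec Carrier k) e → ¬ e ≈ 0# ×
                            (∀ y i → evalᵥ r y i ≈ e · monic cs y i)

  -- Decidable zero locates the last nonzero coefficient, by which the rest is divided. The strict
  -- bound k < m makes degrees fall in the Euclidean steps.
  zero-or-monic : ∀ {m} (r : Vec Carrier m) → All (_≈ 0#) r ⊎ IsMultipleOfMonic r
  zero-or-monic []      = inj₁ []
  zero-or-monic {suc m} (c ∷ r) = [ zeros , monics ]′ (zero-or-monic r)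
    where
    zeros : All (_≈ 0#) r → All (_≈ 0#) (c ∷ r) ⊎ IsMultipleOfMonic (c ∷ r)
    zeros r≈0 = go (c ≟0)
      where
      go : Dec (c ≈ 0#) → All (_≈ 0#) (c ∷ r) ⊎ IsMultipleOfMonic (c ∷ r)
      go (yes c≈0) = inj₁ (c≈0 ∷ r≈0)
      go (no  c≉0) = inj₂ (0 , ℕ.z<s , [] , c , c≉0 ,
        λ y i → trans (+-congˡ (L.at-0 (evalᵥ-zero r≈0 y) i)) (+-identityʳ _))
    monics : IsMultipleOfMonic r → All (_≈ 0#) (c ∷ r) ⊎ IsMultipleOfMonic (c ∷ r)
    monics (k , k<m , cs , e , e≉0 , eq) = let f , fe≈1 = inverse e e≉0 in
      inj₂ (suc k , ℕ.s<s k<m , f · c ∷ cs , e , e≉0 , λ y i → begin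
        c · y i + L (evalᵥ r y) i             ≈⟨ +-congˡ (trans (L.cong (eq y) i) (L.scale e _ i)) ⟩
        c · y i + e · L (monic cs y) i        ≈⟨ +-congʳ (*-congʳ (trans (*-congʳ fe≈1) (*-identityˡ c))) ⟨
        (f · e · c) · y i + e · L (monic cs y) i
          ≈⟨ solve 5 (λ c e f y u → (f :* e :* c) :* y :+ e :* u := e :* ((f :* c) :* y :+ u)) refl c e f (y i) _ ⟩
        e · monic (f · c ∷ cs) y i            ∎)

  record IsInvariant (U : V → Set) : Set where
    field
      resp   : ∀ {x y} → x ≋ y → U x → U y
      add    : ∀ {x y} → U x → U y → U (λ i → x i + y i)
      scale  : ∀ c {x} → U x → U (λ i → c · x i)
      stable : ∀ {x} → U x → U (L x)

    monic-stable : ∀ {m} (cs : Vec Carrier m) {x} → U x → U (monic cs x)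
    monic-stable []       Ux = Ux
    monic-stable (c ∷ cs) Ux = add (scale c Ux) (stable (monic-stable cs Ux))

  NonZero : V → Set
  NonZero y = ∃[ i ] ¬ y i ≈ 0#

  -- The bound concerns all vectors of U and not just one: a proper factor of the polynomial of w
  -- would kill another vector of U, the cofactor applied to w.
  IsMinimal : (V → Set) → ℕ → Set
  IsMinimal U d = ∀ m → m ℕ.< d → (cs : Vec Carrier m) → ∀ y → U y → (∀ i → monic cs y i ≈ 0#) → ∀ i → y i ≈ 0#

  power : ℕ → V → V
  power zero    y = y
  power (suc k) y = L (power k y)

  evalᵥ-tabulate : ∀ m (c : Vect m) y i → evalᵥ (Vec.tabulate c) y i ≈ sum (λ k → c k · power (toℕ k) y i)
  evalᵥ-tabulate zero    c y i = refl
  evalᵥ-tabulate (suc m) c y i = +-congˡ (begin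
    L (evalᵥ (Vec.tabulate (c ∘ suc)) y) i
      ≈⟨ eval-L (toList (Vec.tabulate (c ∘ suc))) y i ⟨
    evalᵥ (Vec.tabulate (c ∘ suc)) (L y) i
      ≈⟨ evalᵥ-tabulate m (c ∘ suc) (L y) i ⟩
    sum (λ k → c (suc k) · power (toℕ k) (L y) i)
      ≈⟨ ∑-cong (λ k → *-congˡ {c (suc k)} (reflexive (≡.cong (λ z → z i) (power-L (toℕ k) y)))) ⟩
    sum (λ k → c (suc k) · power (suc (toℕ k)) y i) ∎)
    where
    power-L : ∀ k y → power k (L y) ≡ power (suc k) y
    power-L zero    y = ≡.refl
    power-L (suc k) y = ≡.cong L (power-L k y)

  -- The n + 1 vectors y, L y, up to the n-th power are dependent in dimension n; normalising the
  -- relation makes it monic.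
  annihilator : ∀ y → ∃₂ λ m (cs : Vec Carrier m) → ∀ i → monic cs y i ≈ 0#
  annihilator y = let c , (k , ck≉0) , eq = dependent n (λ k → power (toℕ k) y) in
    [ (λ c≈0 → contradiction (tabulate⁻ {f = c} c≈0 k) ck≉0)
    , (λ (m , _ , cs , e , e≉0 , eq′) → m , cs , λ i →
        unit-cancel e≉0 (trans (sym (eq′ y i)) (trans (evalᵥ-tabulate (suc n) c y i) (eq i))))
    ]′ (zero-or-monic (Vec.tabulate c))

  Minimal : (V → Set) → Set
  Minimal U = ∃[ d ] IsMinimal U d × ∃₂ λ (qs : Vec Carrier d) w → U w × NonZero w × (∀ i → monic qs w i ≈ 0#)

  -- Descent on the degree: if it is not minimal, some nonzero vector of U is killed in smaller
  -- degree. As U is an arbitrary predicate, this search cannot be decided, whence the double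
  -- negation.
  ¬¬minimal : ∀ (U : V → Set) → ∃ (λ y → U y × NonZero y) → ¬ ¬ Minimal U
  ¬¬minimal U (y , Uy , y≉0) ¬minimal = let m , cs , eq = annihilator y in
    descend (suc m) m ℕ.≤-refl cs y Uy y≉0 eq
    where
    descend : ∀ b m → m ℕ.< b → (cs : Vec Carrier m) → ∀ y → U y → NonZero y → ¬ (∀ i → monic cs y i ≈ 0#)
    descend (suc b) m (ℕ.s≤s m≤b) cs y Uy y≉0 eq = ¬minimal (m , minimal , cs , y , Uy , y≉0 , eq)
      where
      minimal : IsMinimal U m
      minimal k k<m cs′ y′ Uy′ eq′ i = decidable-stable (y′ i ≟0) λ y′i≉0 →
        descend b k (ℕ.<-≤-trans k<m m≤b) cs′ y′ Uy′ (i , y′i≉0) eq′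

  -- R[X]/Ann(w) is a field because a nontrivial factor of the polynomial qs
  -- killing w would kill a nonzero vector of U.
  module QuotientField {U : V → Set} (inv : IsInvariant U) {d} (minimal : IsMinimal U d)
    (qs : Vec Carrier d) {w : V} (Uw : U w) (w≉0 : NonZero w) (qs-w : ∀ i → monic qs w i ≈ 0#) where
    open IsInvariant inv

    infix 4 _≈ᴱ_
    _≈ᴱ_ : List Carrier → List Carrier → Set
    p ≈ᴱ q = eval p w ≋ eval q w

    w-zero : ¬ (∀ i → w i ≈ 0#)
    w-zero w≈0 = proj₂ w≉0 (w≈0 (proj₁ w≉0))

    independent : ∀ {m} → m ℕ.≤ d → (r : Vec Carrier m) → (∀ i → evalᵥ r w i ≈ 0#) → All (_≈ 0#) r
    independent m≤d r p = [ (λ z → z) , (λ (k , k<m , cs , e , e≉0 , eq) → contradiction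
      (minimal k (ℕ.<-≤-trans k<m m≤d) cs w Uw (λ i → unit-cancel e≉0 (trans (sym (eq w i)) (p i)))) w-zero) ]′ (zero-or-monic r)

    -- Invertibility of p modulo Ann(w), read on the vector y = p(L) w.
    Invertible : V → Set
    Invertible y = ∃[ s ] eval s y ≋ w

    invertible-scale : ∀ {x y e} → ¬ e ≈ 0# → (∀ i → x i ≈ e · y i) → Invertible y → Invertible x
    invertible-scale {x} {y} {e} e≉0 eq (s , sy) = let f , fe≈1 = inverse e e≉0 in f ⊛ s , λ i → begin
      eval (f ⊛ s) x i          ≈⟨ eval-⊛ f s x i ⟩
      f · eval s x i            ≈⟨ *-congˡ (trans (Linear.cong (eval-linear s) eq i) (Linear.scale (eval-linear s) e y i)) ⟩
      f · (e · eval s y i)      ≈⟨ *-assoc f e _ ⟨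
      f · e · eval s y i        ≈⟨ trans (*-congʳ fe≈1) (*-identityˡ _) ⟩
      eval s y i                ≈⟨ sy i ⟩
      w i                       ∎

    divide : ∀ {m k} → k ℕ.+ m ≡ d → (cs : Vec Carrier m) → ∃₂ λ (ss : Vec Carrier k) (r : Vec Carrier m) →
             ∀ y i → monic qs y i ≈ monic cs (monic ss y) i + evalᵥ r y i
    divide {k = k} ≡.refl cs = divide-monic cs k qs

    neg-≉0 : ∀ {e} → ¬ e ≈ 0# → ¬ - e ≈ 0#
    neg-≉0 {e} e≉0 p = e≉0 (trans (sym (-‿involutive e)) (trans (-‿cong p) -0#≈0#))

    -- A single remainder suffices at each step: from qs = cs ss + r follows ss(L) cs(L) w = -r(L)
    -- w. As r is nonzero of smaller degree, r(L) w is invertible by induction, and hence so is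
    -- cs(L) w.
    monic-invertible : ∀ b m → m ℕ.< b → m ℕ.< d → (cs : Vec Carrier m) → Invertible (monic cs w)
    monic-invertible _       zero    _ _ [] = 1# ∷ [] , eval-monicList [] w
    monic-invertible (suc b) (suc m) (ℕ.s≤s m<b) m<d cs = [ zeros , monics ]′ (zero-or-monic r)
      where
      k = d ℕ.∸ suc m
      division = divide (ℕ.m∸n+n≡m (ℕ.<⇒≤ m<d)) cs
      ss = proj₁ division
      r  = proj₁ (proj₂ division)
      eq = proj₂ (proj₂ division)
      zeros : All (_≈ 0#) r → Invertible (monic cs w)
      -- If r = 0, then cs kills ss(L) w, which lies in U. Both degrees are below d, so minimality
      -- gives first ss(L) w = 0 and then w = 0.
      zeros r≈0 = contradiction
        (minimal k (ℕ.∸-monoʳ-< {d} {suc m} {0} ℕ.z<s (ℕ.<⇒≤ m<d)) ss w Uw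
          (minimal (suc m) m<d cs (monic ss w) (monic-stable ss Uw)
            (λ i → trans (sym (trans (eq w i) (trans (+-congˡ (evalᵥ-zero r≈0 w i)) (+-identityʳ _)))) (qs-w i))))
        w-zero
      monics : IsMultipleOfMonic r → Invertible (monic cs w)
      monics (l , l<m , cs′ , e , e≉0 , eq′) =
        let s , sy = invertible-scale {monic ss (monic cs w)} (neg-≉0 e≉0) ssw
                       (monic-invertible b l (ℕ.<-≤-trans l<m m<b) (ℕ.<-trans l<m m<d) cs′)
        in s ⊗ monicList ss , λ i → trans (eval-⊗ s (monicList ss) (monic cs w) i)
             (trans (Linear.cong (eval-linear s) (eval-monicList ss (monic cs w)) i) (sy i))
        where
        ssw : ∀ i → monic ss (monic cs w) i ≈ - e · monic cs′ w i
        ssw i = begin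
          monic ss (monic cs w) i
            ≈⟨ monic-comm (monic-linear ss) (monic-L ss) cs w i ⟩
          monic cs (monic ss w) i
            ≈⟨ solve 2 (λ a b → a := (a :+ b) :- b) refl _ (evalᵥ r w i) ⟩
          (monic cs (monic ss w) i + evalᵥ r w i) - evalᵥ r w i
            ≈⟨ +-cong (trans (sym (eq w i)) (qs-w i)) (-‿cong (eq′ w i)) ⟩
          0# - e · monic cs′ w i
            ≈⟨ trans (+-identityˡ _) (-‿distribˡ-* e _) ⟩
          - e · monic cs′ w i ∎

    eval-mod : ∀ p → ∃[ r ] eval p w ≋ evalᵥ {d} r w
    eval-mod p = let s , r , eq = reduce qs p in r , λ i → trans (eq w i) (trans (+-congʳ (begin
      monic qs (eval s w) i  ≈⟨ monic-comm (eval-linear s) (eval-L s) qs w i ⟨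
      eval s (monic qs w) i  ≈⟨ Linear.at-0 (eval-linear s) qs-w i ⟩
      0#                     ∎)) (+-identityˡ _))

    eval-invertible : ∀ p → ¬ (∀ i → eval p w i ≈ 0#) → Invertible (eval p w)
    eval-invertible p p≉0 = let r , eq = eval-mod p in
      [ (λ r≈0 → contradiction (λ i → trans (eq i) (evalᵥ-zero r≈0 w i)) p≉0)
      , (λ (k , k<d , cs , e , e≉0 , eq′) → invertible-scale e≉0 (λ i → trans (eq i) (eq′ w i))
          (monic-invertible (suc k) k ℕ.≤-refl k<d cs)) ]′ (zero-or-monic r)

    ⊗-comm : ∀ p q y → eval (p ⊗ q) y ≋ eval (q ⊗ p) y
    ⊗-comm p q y i = trans (eval-⊗ p q y i) (trans (eval-comm (eval-linear p) (eval-L p) q y i) (sym (eval-⊗ q p y i)))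

    ⊗-congˡ : ∀ p {q q′} → q ≈ᴱ q′ → p ⊗ q ≈ᴱ p ⊗ q′
    ⊗-congˡ p {q} {q′} eq i = trans (eval-⊗ p q w i) (trans (Linear.cong (eval-linear p) eq i) (sym (eval-⊗ p q′ w i)))

    ⊗-cong : ∀ {p p′ q q′} → p ≈ᴱ p′ → q ≈ᴱ q′ → p ⊗ q ≈ᴱ p′ ⊗ q′
    ⊗-cong {p} {p′} {q} {q′} eq eq′ i = trans (⊗-congˡ p {q} {q′} eq′ i)
      (trans (⊗-comm p q′ w i) (trans (⊗-congˡ q′ {p} {p′} eq i) (⊗-comm q′ p′ w i)))

    one : List Carrier
    one = 1# ∷ []

    eval-one : ∀ y → eval one y ≋ y
    eval-one = eval-monicList []

    _≈ᴱ?_ : ∀ p q → Dec (p ≈ᴱ q)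
    p ≈ᴱ? q = Fin.all? λ i → dec (eval p w i) (eval q w i)
      where
      dec : ∀ x y → Dec (x ≈ y)
      dec x y with (x - y) ≟0
      ... | yes q = yes (trans (solve 2 (λ x y → x := (x :- y) :+ y) refl x y) (trans (+-congʳ q) (+-identityˡ y)))
      ... | no ¬q = no λ x≈y → ¬q (trans (+-congʳ x≈y) (-‿inverseʳ y))

    ⊖_ : List Carrier → List Carrier
    ⊖ p = - 1# ⊛ p

    eval-⊖ : ∀ p y → eval (⊖ p) y ≋ λ i → - eval p y i
    eval-⊖ p y i = trans (eval-⊛ (- 1#) p y i) (-1*x≈-x _)

    eval-difference : ∀ p q i → eval (p ⊕ ⊖ q) w i ≈ eval p w i - eval q w i
    eval-difference p q i = trans (eval-⊕ p (⊖ q) w i) (+-congˡ (eval-⊖ q w i))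

    quotientField : HeytingField 0ℓ 0ℓ 0ℓ
    quotientField = record
      { Carrier = List Carrier
      ; _≈_ = _≈ᴱ_
      ; _#_ = λ p q → ¬ p ≈ᴱ q
      ; _+_ = _⊕_
      ; _*_ = _⊗_
      ; -_  = ⊖_
      ; 0#  = []
      ; 1#  = one
      ; isHeytingField = record
        { isHeytingCommutativeRing = record
          { isCommutativeRing = record
            { isRing = record
              { +-isAbelianGroup = record
                { isGroup = record
                  { isMonoid = record
                    { isSemigroup = record
                      { isMagma = record
                        { isEquivalence = record
                          { refl = λ _ → refl
                          ; sym = λ p i → sym (p i)
                          ; trans = λ p q i → trans (p i) (q i) }
                        ; ∙-cong = λ {p} {p′} {q} {q′} eq eq′ i → trans (eval-⊕ p q w i)
                            (trans (+-cong (eq i) (eq′ i)) (sym (eval-⊕ p′ q′ w i))) }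
                      ; assoc = λ p q r i → trans (eval-⊕ (p ⊕ q) r w i) (trans (+-congʳ (eval-⊕ p q w i))
                          (trans (+-assoc _ _ _) (sym (trans (eval-⊕ p (q ⊕ r) w i) (+-congˡ (eval-⊕ q r w i)))))) }
                    ; identity = (λ _ _ → refl)
                               , (λ p i → trans (eval-⊕ p [] w i) (+-identityʳ _)) }
                  ; inverse = (λ p i → trans (eval-⊕ (⊖ p) p w i) (trans (+-congʳ (eval-⊖ p w i)) (-‿inverseˡ _)))
                            , (λ p i → trans (eval-⊕ p (⊖ p) w i) (trans (+-congˡ (eval-⊖ p w i)) (-‿inverseʳ _)))
                  ; ⁻¹-cong = λ {p} {q} eq i → trans (eval-⊖ p w i) (trans (-‿cong (eq i)) (sym (eval-⊖ q w i))) }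
                ; comm = λ p q i → trans (eval-⊕ p q w i) (trans (+-comm _ _) (sym (eval-⊕ q p w i))) }
              ; *-cong = λ {p} {p′} {q} {q′} → ⊗-cong {p} {p′} {q} {q′}
              ; *-assoc = λ p q r i → trans (eval-⊗ (p ⊗ q) r w i) (trans (eval-⊗ p q (eval r w) i)
                  (sym (trans (eval-⊗ p (q ⊗ r) w i) (Linear.cong (eval-linear p) (eval-⊗ q r w) i))))
              ; *-identity = (λ p i → trans (eval-⊗ one p w i) (eval-one (eval p w) i))
                           , (λ p i → trans (eval-⊗ p one w i) (Linear.cong (eval-linear p) (eval-one w) i))
              ; distrib = (λ p q r i → trans (eval-⊗ p (q ⊕ r) w i)
                              (trans (Linear.cong (eval-linear p) (eval-⊕ q r w) i)
                              (trans (Linear.add (eval-linear p) _ _ i)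
                              (sym (trans (eval-⊕ (p ⊗ q) (p ⊗ r) w i) (+-cong (eval-⊗ p q w i) (eval-⊗ p r w i)))))))
                          , (λ p q r i → trans (eval-⊗ (q ⊕ r) p w i)
                              (trans (eval-⊕ q r (eval p w) i)
                              (sym (trans (eval-⊕ (q ⊗ p) (r ⊗ p) w i) (+-cong (eval-⊗ q p w i) (eval-⊗ r p w i)))))) }
            ; *-comm = λ p q i → ⊗-comm p q w i }
          ; isApartnessRelation = record
            { irrefl = λ p≈q p#q → p#q p≈q
            ; sym = λ p#q q≈p → p#q (λ i → sym (q≈p i))
            ; cotrans = λ {p} {q} p#q r → cotrans {p} {q} {r} p#q (p ≈ᴱ? r) }
          ; #⇒invertible = λ {p} {q} → invertible p q
          ; invertible⇒# = λ {p} {q} → apart p q }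
        ; tight = λ p q → decidable-stable (p ≈ᴱ? q) , λ p≈q p#q → p#q p≈q } }
      where
      cotrans : ∀ {p q r} → ¬ p ≈ᴱ q → Dec (p ≈ᴱ r) → (¬ p ≈ᴱ r) ⊎ (¬ r ≈ᴱ q)
      cotrans p#q (yes p≈r) = inj₂ λ r≈q → p#q λ i → trans (p≈r i) (r≈q i)
      cotrans p#q (no  p#r) = inj₁ p#r

      invertible : ∀ p q → ¬ p ≈ᴱ q → ∃[ s ] (s ⊗ (p ⊕ ⊖ q) ≈ᴱ one) × ((p ⊕ ⊖ q) ⊗ s ≈ᴱ one)
      invertible p q p#q =
        let s , sy = eval-invertible (p ⊕ ⊖ q) λ z → p#q λ i → begin
              eval p w i                              ≈⟨ solve 2 (λ a b → a := (a :- b) :+ b) refl _ _ ⟩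
              (eval p w i - eval q w i) + eval q w i  ≈⟨ +-congʳ (trans (sym (eval-difference p q i)) (z i)) ⟩
              0# + eval q w i                         ≈⟨ +-identityˡ _ ⟩
              eval q w i                              ∎
            left : s ⊗ (p ⊕ ⊖ q) ≈ᴱ one
            left i = trans (eval-⊗ s (p ⊕ ⊖ q) w i) (trans (sy i) (sym (eval-one w i)))
        in s , left , λ i → trans (⊗-comm (p ⊕ ⊖ q) s w i) (left i)

      apart : ∀ p q → ∃[ s ] (s ⊗ (p ⊕ ⊖ q) ≈ᴱ one) × ((p ⊕ ⊖ q) ⊗ s ≈ᴱ one) → ¬ p ≈ᴱ q
      apart p q (s , left , _) p≈q = w-zero λ i → begin
        w i                        ≈⟨ eval-one w i ⟨
        eval one w i               ≈⟨ left i ⟨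
        eval (s ⊗ (p ⊕ ⊖ q)) w i   ≈⟨ eval-⊗ s (p ⊕ ⊖ q) w i ⟩
        eval s (eval (p ⊕ ⊖ q) w) i ≈⟨ Linear.at-0 (eval-linear s) (λ j →
          trans (eval-difference p q j) (trans (+-congʳ (p≈q j)) (-‿inverseʳ _))) i ⟩
        0#                         ∎

CharZero : DiscreteField → Set
CharZero K = ∀ k → ¬ suc k ⨯ 1# ≈ 0#
  where open RingLemmas (DiscreteField.scalars K)

-- An eigenvector of the Laplacian with integer eigenvalue in every invariant subspace.

module LaplacianEigenvector (K : DiscreteField) (char0 : CharZero K)
  {n} (T : TranspositionSet (suc n)) (integral : IntegralCay T) where
  open DiscreteField K
  open RingLemmas scalars
  open LinearDependence K
  open Laplacian scalars G[ T ]
  open Polynomials K laplacian-linear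
  open SimpleGraph G[ T ]

  private
    L = laplacian
    module L = Linear laplacian-linear

  L-∑ : ∀ {m} (f : Fin m → Vect (suc n)) k → L (λ i → sum λ b → f b i) k ≈ sum λ b → L (f b) k
  L-∑ {zero}  f k = L.at-0 (λ _ → refl) k
  L-∑ {suc m} f k = trans (L.add (f zero) (λ i → sum λ b → f (suc b) i) k) (+-congˡ (L-∑ (f ∘ suc) k))

  -- (q(s) − q(t)) / (s − t) applied to w, with s acting as L and t the class of X:
  -- by synthetic division, an eigenvector of L with eigenvalue t when q(L) w = 0.
  eigenvector : ∀ {m} → Vec Carrier m → Vect (suc n) → Fin (suc n) → Vec Carrier m
  eigenvector []       w j = []
  eigenvector (c ∷ cs) w j = monic cs w j ∷ eigenvector cs w j

  -- The top coefficient left by synthetic division is `w j` itself, because q is monic.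
  eigenvector-zero : ∀ {m} (cs : Vec Carrier (suc m)) w j → All (_≈ 0#) (eigenvector cs w j) → w j ≈ 0#
  eigenvector-zero (c ∷ [])     w j (p ∷ []) = p
  eigenvector-zero (c ∷ d ∷ cs) w j (_ ∷ ps) = eigenvector-zero (d ∷ cs) w j ps

  -- A class in the quotient is represented by a vector of K[L] w, so `X b i` has two indices: L
  -- acts as s on the first and as t on the second. The equation is (s - t) X = q(s) - q(t) on the
  -- tensor square of w; the right side vanishes once q(L) w = 0.
  eigenvector-equation : ∀ {m} (cs : Vec Carrier m) w j i → let X = λ j → evalᵥ (eigenvector cs w j) w in
    laplacian (λ b → X b i) j ≈ L (X j) i + (monic cs w j · w i - w j · monic cs w i)
  eigenvector-equation []       w j i = trans (∑-0 λ b → trans ([]-cong (does (j ~? b)) (-‿inverseʳ 0#)) ([]-0 (does (j ~? b))))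
    (sym (trans (+-cong (L.at-0 (λ _ → refl) i) (-‿inverseʳ _)) (+-identityˡ 0#)))
  eigenvector-equation (c ∷ cs) w j i = begin
    L (λ b → u b · w i + L (X b) i) j
      ≈⟨ L.add (λ b → u b · w i) (λ b → L (X b) i) j ⟩
    L (λ b → u b · w i) j + L (λ b → L (X b) i) j
      ≈⟨ +-cong (trans (L.cong (λ b → *-comm (u b) (w i)) j) (L.scale (w i) u j)) (swap i) ⟩
    w i · L u j + L (λ i → L (λ b → X b i) j) i
      ≈⟨ +-congˡ (L.cong (eigenvector-equation cs w j) i) ⟩
    w i · L u j + L (λ i → L (X j) i + (u j · w i - w j · u i)) i
      ≈⟨ +-congˡ (trans (L.add (L (X j)) (λ i → u j · w i - w j · u i) i) (+-congˡ (trans (L.sub (λ i → u j · w i) (w j) u i) (+-congʳ (L.scale (u j) w i))))) ⟩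
    w i · L u j + (L (L (X j)) i + (u j · L w i - w j · L u i))
      ≈⟨ solve 8 (λ wi wj Luj Lui LLX uj Lwi c → wi :* Luj :+ (LLX :+ (uj :* Lwi :- wj :* Lui)) :=
           (uj :* Lwi :+ LLX) :+ ((c :* wj :+ Luj) :* wi :- wj :* (c :* wi :+ Lui))) refl
           (w i) (w j) (L u j) (L u i) (L (L (X j)) i) (u j) (L w i) c ⟩
    (u j · L w i + L (L (X j)) i) + (monic (c ∷ cs) w j · w i - w j · monic (c ∷ cs) w i)
      ≈⟨ +-congʳ (trans (L.add (λ i → u j · w i) (L (X j)) i) (+-congʳ (L.scale (u j) w i))) ⟨
    L (λ i → u j · w i + L (X j) i) i + (monic (c ∷ cs) w j · w i - w j · monic (c ∷ cs) w i) ∎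
    where
    open Solver
    u = monic cs w
    X : Fin (suc n) → Vect (suc n)
    X b = evalᵥ (eigenvector cs w b) w
    -- The two actions of L commute, since they concern different indices.
    swap : ∀ i → L (λ b → L (X b) i) j ≈ L (λ i → L (λ b → X b i) j) i
    swap i = trans (∑-cong λ b → trans ([]-cong (does (j ~? b)) (L-difference (X j) (X b) i)) (L-[] (does (j ~? b)) (λ i → X j i - X b i) i))
      (sym (L-∑ (λ b i → [ does (j ~? b) ] (X j i - X b i)) i))
      where
      L-difference : ∀ x y i → L x i - L y i ≈ L (λ i → x i - y i) i
      L-difference x y i = sym (trans (L.cong (λ k → +-congˡ {x k} (-‿cong (sym (*-identityˡ (y k))))) i)
        (trans (L.sub x 1# y i) (+-congˡ (-‿cong (*-identityˡ (L y i))))))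
      L-[] : ∀ b x i → [ b ] L x i ≈ L (λ i → [ b ] x i) i
      L-[] true  x i = refl
      L-[] false x i = sym (L.at-0 (λ _ → refl) i)

  integral-eigenvector : ∀ {U} → IsInvariant U → Minimal U →
    ∃[ w ] U w × NonZero w × ∃[ k ] (∀ i → L w i ≈ ι k · w i)
  integral-eigenvector inv (zero  , minimal , [] , w , Uw , (i , wi≉0) , eq) = contradiction (eq i) wi≉0
  integral-eigenvector inv (suc d , minimal , qs , w , Uw , w≉0@(j₀ , wj≉0) , eq) =
    let k , p = LaplacianEigenvalue.laplacian-integral T F integral F-char0 x X
          -- This coordinate is nonzero in the quotient: it has degree below that of `qs`, so
          -- vanishing would kill all its coefficients, among them `w j₀`.
          (j₀ , λ z → wj≉0 (eigenvector-zero qs w j₀ (independent ℕ.≤-refl (eigenvector qs w j₀) z))) x-eigen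
    in w , Uw , w≉0 , k , λ i → trans (sym (eval-X w i)) (trans (p i) (eval-ι k i))
    where
    open QuotientField inv minimal qs Uw w≉0 eq
    F = quotientField
    module RF = RingLemmas (commRing F)
    open Spectrum F using (CharacteristicZero; fromℤ)

    X : List Carrier
    X = 0# ∷ one

    eval-X : ∀ y → eval X y ≋ L y
    eval-X y i = trans (+-cong (zeroˡ (y i)) (L.cong (eval-one y) i)) (+-identityˡ _)

    eval-⨯ : ∀ k i → eval (k RF.⨯ one) w i ≈ k ⨯ 1# · w i
    eval-⨯ zero    i = sym (zeroˡ (w i))
    eval-⨯ (suc k) i = trans (eval-⊕ one (k RF.⨯ one) w i) (trans
      (+-cong (trans (eval-one w i) (sym (*-identityˡ (w i)))) (eval-⨯ k i)) (sym (distribʳ (w i) 1# (k ⨯ 1#))))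

    eval-ι : ∀ k i → eval (fromℤ k) w i ≈ ι k · w i
    eval-ι (ℤ.+ k)  i = eval-⨯ k i
    eval-ι -[1+ k ] i = trans (eval-⊖ (suc k RF.⨯ one) w i) (trans (-‿cong (eval-⨯ (suc k) i)) (-‿distribˡ-* _ _))

    F-char0 : CharacteristicZero
    F-char0 k z = wj≉0 (unit-cancel (char0 k) (trans (sym (eval-⨯ (suc k) j₀)) (z j₀)))

    eval-∑ : ∀ {m} (f : Fin m → List Carrier) i → eval (RF.sum f) w i ≈ sum (λ b → eval (f b) w i)
    eval-∑ {zero}  f i = refl
    eval-∑ {suc m} f i = trans (eval-⊕ (f zero) (RF.sum (f ∘ suc)) w i) (+-congˡ (eval-∑ (f ∘ suc) i))

    eval-[] : ∀ b p i → eval (RF.[ b ] p) w i ≈ [ b ] eval p w i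
    eval-[] true  p i = refl
    eval-[] false p i = refl

    x : Fin (suc n) → List Carrier
    x j = toList (eigenvector qs w j)

    x-eigen : ∀ j → Laplacian.laplacian (commRing F) G[ T ] x j RF.≈ X RF.· x j
    x-eigen j i = begin
      eval (RF.sum λ b → RF.[ does (j ~? b) ] (x j ⊕ ⊖ x b)) w i
        ≈⟨ eval-∑ (λ b → RF.[ does (j ~? b) ] (x j ⊕ ⊖ x b)) i ⟩
      sum (λ b → eval (RF.[ does (j ~? b) ] (x j ⊕ ⊖ x b)) w i)
        ≈⟨ ∑-cong (λ b → trans (eval-[] (does (j ~? b)) (x j ⊕ ⊖ x b) i)
             ([]-cong (does (j ~? b)) (eval-difference (x j) (x b) i))) ⟩
      L (λ b → eval (x b) w i) j
        ≈⟨ eigenvector-equation qs w j i ⟩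
      L (eval (x j) w) i + (monic qs w j · w i - w j · monic qs w i)
        ≈⟨ +-congˡ (trans (+-cong (trans (*-congʳ (eq j)) (zeroˡ (w i)))
             (-‿cong (trans (*-congˡ (eq i)) (zeroʳ (w j))))) (-‿inverseʳ 0#)) ⟩
      L (eval (x j) w) i + 0#
        ≈⟨ trans (+-identityʳ _) (sym (eval-X (eval (x j) w) i)) ⟩
      eval X (eval (x j) w) i
        ≈⟨ eval-⊗ X (x j) w i ⟨
      eval (X ⊗ x j) w i ∎

-- Ordered fields and the spectral gap of the Laplacian.

record OrderedField : Set₁ where
  field
    discreteField : DiscreteField
  open DiscreteField discreteField public
  open CommutativeRing scalars using (Carrier; _≈_; _+_; _*_; 0#; 1#)
  field
    NonNeg        : Carrier → Set
    nonNeg-resp   : ∀ {x y} → x ≈ y → NonNeg x → NonNeg y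
    nonNeg-0      : NonNeg 0#
    nonNeg-+      : ∀ {x y} → NonNeg x → NonNeg y → NonNeg (x + y)
    nonNeg-*      : ∀ {x y} → NonNeg x → NonNeg y → NonNeg (x * y)
    nonNeg-square : ∀ x → NonNeg (x * x)
    +-zero        : ∀ {x y} → NonNeg x → NonNeg y → x + y ≈ 0# → x ≈ 0#

module InnerProduct (K : OrderedField) where
  open OrderedField K
  open RingLemmas scalars
  open LinearDependence discreteField

  square-zero : ∀ {x} → x · x ≈ 0# → x ≈ 0#
  square-zero {x} p = decidable-stable (x ≟0) λ x≉0 → x≉0 (unit-cancel x≉0 p)

  positivity : Positivity scalars
  positivity = record
    { NonNeg        = NonNeg
    ; nonNeg-resp   = nonNeg-resp
    ; nonNeg-0      = nonNeg-0
    ; nonNeg-+      = nonNeg-+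
    ; nonNeg-square = nonNeg-square
    ; +-zero        = +-zero
    ; square-zero   = square-zero
    }

  open SumOfSquares scalars positivity public

  nonNeg-[] : ∀ b {x} → NonNeg x → NonNeg ([ b ] x)
  nonNeg-[] true  p = p
  nonNeg-[] false p = nonNeg-0

  1-nonNeg : NonNeg 1#
  1-nonNeg = nonNeg-resp (*-identityˡ 1#) (nonNeg-square 1#)

  nonNeg-⨯ : ∀ k → NonNeg (k ⨯ 1#)
  nonNeg-⨯ zero    = nonNeg-0
  nonNeg-⨯ (suc k) = nonNeg-+ 1-nonNeg (nonNeg-⨯ k)

  char0 : CharZero discreteField
  char0 k p = 1≉0 (+-zero 1-nonNeg (nonNeg-⨯ k) p)

  dot : ∀ {n} → Vect n → Vect n → Carrier
  dot x y = sum λ i → x i · y i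

  dot-congˡ : ∀ {n} {x x′ : Vect n} y → x ≋ x′ → dot x y ≈ dot x′ y
  dot-congˡ y p = ∑-cong λ i → *-congʳ {y i} (p i)

  dot-congʳ : ∀ {n} (x : Vect n) {y y′} → y ≋ y′ → dot x y ≈ dot x y′
  dot-congʳ x p = ∑-cong λ i → *-congˡ {x i} (p i)

  dot-comm : ∀ {n} (x y : Vect n) → dot x y ≈ dot y x
  dot-comm x y = ∑-cong λ i → *-comm (x i) (y i)

  dot-add : ∀ {n} (x y z : Vect n) → dot (λ i → x i + y i) z ≈ dot x z + dot y z
  dot-add x y z = trans (∑-cong λ i → distribʳ (z i) (x i) (y i))
    (∑-distrib-+ (λ i → x i · z i) (λ i → y i · z i))

  dot-scale : ∀ {n} c (x z : Vect n) → dot (λ i → c · x i) z ≈ c · dot x z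
  dot-scale c x z = trans (∑-cong λ i → *-assoc c (x i) (z i)) (∑-·ˡ c (λ i → x i · z i))

  dot-addʳ : ∀ {n} (z x y : Vect n) → dot z (λ i → x i + y i) ≈ dot z x + dot z y
  dot-addʳ z x y = trans (dot-comm z (λ i → x i + y i)) (trans (dot-add x y z) (+-cong (dot-comm x z) (dot-comm y z)))

  dot-scaleʳ : ∀ {n} c (z x : Vect n) → dot z (λ i → c · x i) ≈ c · dot z x
  dot-scaleʳ c z x = trans (dot-comm z (λ i → c · x i)) (trans (dot-scale c x z) (*-congˡ (dot-comm x z)))

  -- Pairing a linear relation with `W k` leaves only c k times the square of the length of `W k`.
  orthogonal-small : ∀ {n} (W : Fin (suc n) → Vect n) → (∀ i → ¬ (∀ k → W i k ≈ 0#)) →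
                     ¬ (∀ i j → i ≢ j → dot (W i) (W j) ≈ 0#)
  orthogonal-small {n} W W≉0 orth = let c , (k , ck≉0) , eq = dependent n W in
    W≉0 k (∑-squares-zero (W k) (unit-cancel ck≉0 (begin
      c k · dot (W k) (W k)
        ≈⟨ ∑-single (λ i → c i · dot (W i) (W k)) k (λ i i≢k → trans (*-congˡ (orth i k i≢k)) (zeroʳ (c i))) ⟨
      sum (λ i → c i · dot (W i) (W k))
        ≈⟨ ∑-cong (λ i → dot-scale (c i) (W i) (W k)) ⟨
      sum (λ i → sum λ j → (c i · W i j) · W k j)
        ≈⟨ ∑-comm (λ i j → (c i · W i j) · W k j) ⟩
      sum (λ j → sum λ i → (c i · W i j) · W k j)
        ≈⟨ ∑-0 (λ j → trans (∑-·ʳ (W k j) (λ i → c i · W i j)) (trans (*-congʳ (eq j)) (zeroˡ (W k j)))) ⟩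
      0# ∎)))

module RayleighQuotient (K : OrderedField) {n} (T : TranspositionSet (suc n)) where
  open OrderedField K
  open RingLemmas scalars
  open InnerProduct K
  open Laplacian scalars G[ T ]
  open SimpleGraph G[ T ]
  open LinearDependence discreteField
  open Polynomials discreteField laplacian-linear
  private
    V = Vect (suc n)
    L = laplacian
    module L = Linear laplacian-linear

  []-edge-sym : ∀ j b X → [ does (j ~? b) ] X ≈ [ does (b ~? j) ] X
  []-edge-sym j b X = go (j ~? b) (b ~? j)
    where
    go : (d : Dec (j ~ b)) (e : Dec (b ~ j)) → [ does d ] X ≈ [ does e ] X
    go (yes p) e = sym ([]-yes e (~-sym p))
    go (no ¬p) e = sym ([]-no e (¬p ∘ ~-sym))

  edge-sum : (Fin (suc n) → Fin (suc n) → Carrier) → Carrier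
  edge-sum F = sum λ j → sum λ b → [ does (j ~? b) ] F j b

  edge-sum-+ : ∀ F G → edge-sum (λ j b → F j b + G j b) ≈ edge-sum F + edge-sum G
  edge-sum-+ F G = trans
    (∑-cong λ j → trans (∑-cong λ b → []-+ (does (j ~? b)) (F j b) (G j b))
      (∑-distrib-+ (λ b → [ does (j ~? b) ] F j b) (λ b → [ does (j ~? b) ] G j b)))
    (∑-distrib-+ (λ j → sum λ b → [ does (j ~? b) ] F j b) (λ j → sum λ b → [ does (j ~? b) ] G j b))

  edge-sum-cong : ∀ {F G : Fin (suc n) → Fin (suc n) → Carrier} →
                  (∀ j b → F j b ≈ G j b) → edge-sum F ≈ edge-sum G
  edge-sum-cong p = ∑-cong λ j → ∑-cong λ b → []-cong (does (j ~? b)) (p j b)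

  edge-sum-swap : ∀ F → edge-sum F ≈ edge-sum (λ j b → F b j)
  edge-sum-swap F = trans (∑-comm (λ j b → [ does (j ~? b) ] F j b))
    (∑-cong λ b → ∑-cong λ j → []-edge-sym j b (F j b))

  dot-L : ∀ x y → dot x (L y) ≈ edge-sum (λ j b → x j · (y j - y b))
  dot-L x y = ∑-cong λ j → trans (sym (∑-·ˡ (x j) (λ b → [ does (j ~? b) ] (y j - y b))))
    (∑-cong λ b → sym ([]-· (does (j ~? b)) (x j) (y j - y b)))

  L-symmetric : ∀ x y → dot x (L y) ≈ dot (L x) y
  L-symmetric x y = begin
    dot x (L y)
      ≈⟨ dot-L x y ⟩
    edge-sum (λ j b → x j · (y j - y b))
      ≈⟨ edge-sum-cong (λ j b → solve 3 (λ x y z → x :* (y :- z) := x :* y :+ (:- (x :* z))) refl (x j) (y j) (y b)) ⟩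
    edge-sum (λ j b → x j · y j + - (x j · y b))
      ≈⟨ edge-sum-+ (λ j b → x j · y j) (λ j b → - (x j · y b)) ⟩
    edge-sum (λ j b → x j · y j) + edge-sum (λ j b → - (x j · y b))
      ≈⟨ +-congˡ (edge-sum-swap (λ j b → - (x j · y b))) ⟩
    edge-sum (λ j b → x j · y j) + edge-sum (λ j b → - (x b · y j))
      ≈⟨ edge-sum-+ (λ j b → x j · y j) (λ j b → - (x b · y j)) ⟨
    edge-sum (λ j b → x j · y j + - (x b · y j))
      ≈⟨ edge-sum-cong (λ j b → solve 3 (λ x y z → x :* y :+ (:- (z :* y)) := y :* (x :- z)) refl (x j) (y j) (x b)) ⟩
    edge-sum (λ j b → y j · (x j - x b))
      ≈⟨ dot-L y x ⟨
    dot y (L x)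
      ≈⟨ dot-comm y (L x) ⟩
    dot (L x) y ∎
    where open Solver

  -- The form is doubled because `edge-sum` visits every edge in both directions; this avoids
  -- halving.
  energy : ∀ (x : V) → dot x (L x) + dot x (L x) ≈ edge-sum (λ j b → (x j - x b) · (x j - x b))
  energy x = begin
    dot x (L x) + dot x (L x)
      ≈⟨ +-cong (dot-L x x) (trans (dot-L x x) (edge-sum-swap (λ j b → x j · (x j - x b)))) ⟩
    edge-sum (λ j b → x j · (x j - x b)) + edge-sum (λ j b → x b · (x b - x j))
      ≈⟨ edge-sum-+ (λ j b → x j · (x j - x b)) (λ j b → x b · (x b - x j)) ⟨
    edge-sum (λ j b → x j · (x j - x b) + x b · (x b - x j))
      ≈⟨ edge-sum-cong (λ j b → solve 2 (λ x y → x :* (x :- y) :+ y :* (y :- x) := (x :- y) :* (x :- y)) refl (x j) (x b)) ⟩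
    edge-sum (λ j b → (x j - x b) · (x j - x b)) ∎
    where open Solver

  module _ (connected : ∀ i j → Reachable G[ T ] i j) where

    energy-zero⇒constant : ∀ (x : V) → edge-sum (λ j b → (x j - x b) · (x j - x b)) ≈ 0# → ∀ i j → x i ≈ x j
    energy-zero⇒constant x p i j = along (connected i j)
      where
      term-nonNeg : ∀ j b → NonNeg ([ does (j ~? b) ] ((x j - x b) · (x j - x b)))
      term-nonNeg j b = nonNeg-[] (does (j ~? b)) (nonNeg-square (x j - x b))
      edge : ∀ {j b} → j ~ b → x j ≈ x b
      edge {j} {b} j~b = begin
        x j               ≈⟨ solve 2 (λ x y → x := (x :- y) :+ y) refl (x j) (x b) ⟩
        (x j - x b) + x b ≈⟨ +-congʳ (square-zero (trans (sym ([]-yes (j ~? b) j~b))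
                               (∑-zero (term-nonNeg j) (∑-zero (λ j → nonNeg-∑ (term-nonNeg j)) p j) b))) ⟩
        0# + x b          ≈⟨ +-identityˡ (x b) ⟩
        x b               ∎
        where open Solver
      along : ∀ {i j} → Reachable G[ T ] i j → x i ≈ x j
      along ε        = refl
      along (e ◅ es) = trans (edge e) (along es)

    ones : V
    ones _ = 1#

    -- The energy of w is 2κ(w·w). If -κ ≥ 0, the energy and its negative are both nonnegative, so
    -- it vanishes; connectedness makes w constant, and orthogonality to 1 makes it zero.
    eigenvalue-not-negative : ∀ {κ} w → NonZero w → dot w ones ≈ 0# → (∀ i → L w i ≈ κ · w i) → ¬ NonNeg (- κ)
    eigenvalue-not-negative {κ} w (i , wi≉0) w⊥1 eigen -κ≥0 = wi≉0 (∑-squares-zero w (begin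
      dot w w                     ≈⟨ dot-congʳ w (λ j → trans (constant j i) (sym (*-identityʳ (w i)))) ⟩
      dot w (λ j → w i · ones j)  ≈⟨ dot-scaleʳ (w i) w ones ⟩
      w i · dot w ones            ≈⟨ trans (*-congˡ w⊥1) (zeroʳ (w i)) ⟩
      0#                          ∎) i)
      where
      open Solver
      E = edge-sum (λ j b → (w j - w b) · (w j - w b))
      N = - κ · (dot w w + dot w w)
      E-nonNeg : NonNeg E
      E-nonNeg = nonNeg-∑ λ j → nonNeg-∑ λ b → nonNeg-[] (does (j ~? b)) (nonNeg-square (w j - w b))
      N-nonNeg : NonNeg N
      N-nonNeg = nonNeg-* -κ≥0 (nonNeg-+ (nonNeg-∑ λ i → nonNeg-square (w i)) (nonNeg-∑ λ i → nonNeg-square (w i)))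
      E+N : E + N ≈ 0#
      E+N = begin
        E + N                                    ≈⟨ +-congʳ (energy w) ⟨
        (dot w (L w) + dot w (L w)) + N          ≈⟨ +-congʳ (+-cong Lw Lw) ⟩
        (κ · dot w w + κ · dot w w) + N          ≈⟨ solve 2 (λ k d → (k :* d :+ k :* d) :+ (:- k) :* (d :+ d) := con 0ℤ) refl κ (dot w w) ⟩
        0#                                       ∎
        where
        Lw : dot w (L w) ≈ κ · dot w w
        Lw = trans (dot-congʳ w eigen) (dot-scaleʳ κ w w)
      constant : ∀ i j → w i ≈ w j
      constant = energy-zero⇒constant w (+-zero E-nonNeg N-nonNeg E+N)

    -- Here integrality produces the constant of the gap: an integer that is not ≤ 0 is at least 1.
    eigenvalue-positive : ∀ k w → NonZero w → dot w ones ≈ 0# → (∀ i → L w i ≈ ι k · w i) → NonNeg (ι k - 1#)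
    eigenvalue-positive (ℤ.+ suc m) w _ _ _ = nonNeg-resp
      (solve 2 (λ a b → b := (a :+ b) :- a) refl 1# (m ⨯ 1#)) (nonNeg-⨯ m)
      where open Solver
    eigenvalue-positive (ℤ.+ zero) w w≉0 w⊥1 eigen = contradiction
      (nonNeg-resp (sym -0#≈0#) nonNeg-0) (eigenvalue-not-negative w w≉0 w⊥1 eigen)
    eigenvalue-positive -[1+ m ] w w≉0 w⊥1 eigen = contradiction
      (nonNeg-resp (sym (-‿involutive _)) (nonNeg-⨯ (suc m))) (eigenvalue-not-negative w w≉0 w⊥1 eigen)

    Q : V → Carrier
    Q x = dot x (L x) - dot x x

    -- The field `constant` keeps the all-ones vector in the family, so whatever is orthogonal to W
    -- is orthogonal to it and has its eigenvalues bounded by `eigenvalue-positive`.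
    record OrthogonalEigenvectors {m} (W : Fin m → V) : Set where
      field
        nonZero    : ∀ i → NonZero (W i)
        orthogonal : ∀ i j → i ≢ j → dot (W i) (W j) ≈ 0#
        eigenvalue : ∀ i → ∃[ κ ] (∀ j → L (W i) j ≈ κ · W i j)
        constant   : ∃[ i ] W i ≋ ones

    _⟂_ : ∀ {m} → V → (Fin m → V) → Set
    x ⟂ W = ∀ i → dot x (W i) ≈ 0#

    -- L is symmetric, so the orthogonal complement of a family of eigenvectors is stable under it.
    ⟂-invariant : ∀ {m} {W : Fin m → V} → OrthogonalEigenvectors W → IsInvariant (_⟂ W)
    ⟂-invariant {W = W} ortho = record
      { resp   = λ p x⊥W i → trans (dot-congˡ (W i) (λ j → sym (p j))) (x⊥W i)
      ; add    = λ {x} {y} x⊥W y⊥W i → trans (dot-add x y (W i)) (trans (+-cong (x⊥W i) (y⊥W i)) (+-identityˡ 0#))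
      ; scale  = λ c {x} x⊥W i → trans (dot-scale c x (W i)) (trans (*-congˡ (x⊥W i)) (zeroʳ c))
      ; stable = λ {x} x⊥W i → let κ , eq = eigenvalue i in begin
          dot (L x) (W i)               ≈⟨ L-symmetric x (W i) ⟨
          dot x (L (W i))               ≈⟨ dot-congʳ x eq ⟩
          dot x (λ j → κ · W i j)       ≈⟨ dot-scaleʳ κ x (W i) ⟩
          κ · dot x (W i)               ≈⟨ trans (*-congˡ (x⊥W i)) (zeroʳ κ) ⟩
          0#                            ∎
      }
      where open OrthogonalEigenvectors ortho

    module _ (integral : IntegralCay T) where

      -- In x = x′ + c w the cross terms vanish in both forms, as w is an eigenvector orthogonal to
      -- x′. Hence Q x = Q x′ + c²(κ - 1)(w·w), whose last term is nonnegative.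
      project : ∀ x {κ} w → NonZero w → (∀ i → L w i ≈ κ · w i) → NonNeg (κ - 1#) →
                ∃[ x′ ] dot x′ w ≈ 0# × (∀ y → dot x y ≈ 0# → dot w y ≈ 0# → dot x′ y ≈ 0#) × (NonNeg (Q x′) → NonNeg (Q x))
      project x {κ} w w≉0 eigen κ≥1 = x′ , x′⊥w , x′⊥ , λ Qx′≥0 →
        nonNeg-resp (sym Qx) (nonNeg-+ Qx′≥0 (nonNeg-* (nonNeg-square c) (nonNeg-* κ≥1 (nonNeg-∑ λ i → nonNeg-square (w i)))))
        where
        open Solver
        ww≉0 : ¬ dot w w ≈ 0#
        ww≉0 p = proj₂ w≉0 (∑-squares-zero w p (proj₁ w≉0))
        f = proj₁ (inverse (dot w w) ww≉0)
        f·ww = proj₂ (inverse (dot w w) ww≉0)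
        c = dot x w · f
        x′ : V
        x′ i = x i + - c · w i
        dot-x′ : ∀ y → dot x′ y ≈ dot x y + - c · dot w y
        dot-x′ y = trans (dot-add x (λ i → - c · w i) y) (+-congˡ {dot x y} (dot-scale (- c) w y))
        x′⊥w : dot x′ w ≈ 0#
        x′⊥w = begin
          dot x′ w                                    ≈⟨ dot-x′ w ⟩
          dot x w + - (dot x w · f) · dot w w         ≈⟨ solve 3 (λ a f d → a :+ (:- (a :* f)) :* d := a :+ (:- a) :* (f :* d)) refl (dot x w) f (dot w w) ⟩
          dot x w + - dot x w · (f · dot w w)         ≈⟨ +-congˡ (trans (*-congˡ f·ww) (*-identityʳ _)) ⟩
          dot x w - dot x w                           ≈⟨ -‿inverseʳ _ ⟩
          0#                                          ∎
        x′⊥ : ∀ y → dot x y ≈ 0# → dot w y ≈ 0# → dot x′ y ≈ 0#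
        x′⊥ y p q = trans (dot-x′ y) (trans (+-cong p (trans (*-congˡ q) (zeroʳ (- c)))) (+-identityˡ 0#))
        x≋ : x ≋ λ i → x′ i + c · w i
        x≋ i = solve 3 (λ x c w → x := (x :+ (:- c) :* w) :+ c :* w) refl (x i) c (w i)
        Lx≋ : L x ≋ λ i → L x′ i + (c · κ) · w i
        Lx≋ i = trans (L.cong x≋ i) (trans (L.add x′ (λ j → c · w j) i) (+-congˡ (trans (L.scale c w i)
          (trans (*-congˡ (eigen i)) (sym (*-assoc c κ (w i)))))))
        w⊥Lx′ : dot w (L x′) ≈ 0#
        w⊥Lx′ = begin
          dot w (L x′)              ≈⟨ L-symmetric w x′ ⟩
          dot (L w) x′              ≈⟨ trans (dot-congˡ x′ eigen) (dot-scale κ w x′) ⟩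
          κ · dot w x′              ≈⟨ *-congˡ (trans (dot-comm w x′) x′⊥w) ⟩
          κ · 0#                    ≈⟨ zeroʳ κ ⟩
          0#                        ∎
        expand : ∀ y z d → z ≋ (λ i → y i + d · w i) → dot w y ≈ 0# → dot x z ≈ dot x′ y + (c · d) · dot w w
        expand y z d z≋ w⊥y = begin
          dot x z
            ≈⟨ trans (dot-congˡ z x≋) (dot-congʳ (λ i → x′ i + c · w i) z≋) ⟩
          dot (λ i → x′ i + c · w i) (λ i → y i + d · w i)
            ≈⟨ trans (dot-add x′ (λ i → c · w i) (λ i → y i + d · w i)) (+-congˡ (dot-scale c w (λ i → y i + d · w i))) ⟩
          dot x′ (λ i → y i + d · w i) + c · dot w (λ i → y i + d · w i)
            ≈⟨ +-cong (trans (dot-addʳ x′ y (λ i → d · w i)) (+-congˡ (dot-scaleʳ d x′ w)))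
                 (*-congˡ (trans (dot-addʳ w y (λ i → d · w i)) (+-congˡ (dot-scaleʳ d w w)))) ⟩
          (dot x′ y + d · dot x′ w) + c · (dot w y + d · dot w w)
            ≈⟨ +-cong (trans (+-congˡ (trans (*-congˡ x′⊥w) (zeroʳ d))) (+-identityʳ _))
                 (*-congˡ (trans (+-congʳ w⊥y) (+-identityˡ _))) ⟩
          dot x′ y + c · (d · dot w w)
            ≈⟨ +-congˡ (*-assoc c d _) ⟨
          dot x′ y + (c · d) · dot w w ∎
        Qx : Q x ≈ Q x′ + (c · c) · ((κ - 1#) · dot w w)
        Qx = begin
          dot x (L x) - dot x x
            ≈⟨ +-cong (expand (L x′) (L x) (c · κ) Lx≋ w⊥Lx′) (-‿cong (expand x′ x c x≋ (trans (dot-comm w x′) x′⊥w))) ⟩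
          (dot x′ (L x′) + (c · (c · κ)) · dot w w) - (dot x′ x′ + (c · c) · dot w w)
            ≈⟨ +-congˡ (-‿cong (+-congˡ (*-congˡ (sym (*-identityˡ _))))) ⟩
          (dot x′ (L x′) + (c · (c · κ)) · dot w w) - (dot x′ x′ + (c · c) · (1# · dot w w))
            ≈⟨ solve 6 (λ a b c k d u → (a :+ (c :* (c :* k)) :* d) :- (b :+ (c :* c) :* (u :* d)) :=
                 (a :- b) :+ (c :* c) :* ((k :- u) :* d)) refl (dot x′ (L x′)) (dot x′ x′) c κ (dot w w) 1# ⟩
          Q x′ + (c · c) · ((κ - 1#) · dot w w) ∎

      -- A vector with x·Lx < x·x orthogonal to W yields, after projecting off an
      -- eigenvector orthogonal to W, another one orthogonal to a larger family.
      descend : ∀ fuel {m} → fuel ℕ.+ m ≡ suc (suc n) → (W : Fin m → V) → OrthogonalEigenvectors W →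
                ∀ x → x ⟂ W → ¬ ¬ NonNeg (Q x)
      -- With no fuel left, W would consist of n + 2 orthogonal nonzero vectors in dimension n + 1.
      descend zero ≡.refl W ortho _ _ _ = orthogonal-small W (λ i z → proj₂ (nonZero i) (z (proj₁ (nonZero i)))) orthogonal
        where open OrthogonalEigenvectors ortho
      descend (suc fuel) {m} eq W ortho x x⊥W Qx<0 = ¬¬minimal (_⟂ W) (x , x⊥W , x≉0) λ minimal →
        let w , w⊥W , w≉0 , k , eigen = integral-eigenvector (⟂-invariant ortho) minimal
            i , Wi≋ones = constant
            x′ , x′⊥w , x′⊥ , Q′ = project x w w≉0 eigen (eigenvalue-positive k w w≉0
              (trans (dot-congʳ w (λ j → sym (Wi≋ones j))) (w⊥W i)) eigen)
        in descend fuel (≡.trans (ℕ.+-suc fuel m) eq) (extend w) (extended w w⊥W w≉0 (ι k , eigen)) x′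
             (λ { zero → x′⊥w ; (suc i) → x′⊥ (W i) (x⊥W i) (w⊥W i) }) (Qx<0 ∘ Q′)
        where
        open OrthogonalEigenvectors ortho
        open LaplacianEigenvector discreteField char0 T integral
        -- A zero vector would have Q x = 0, which is nonnegative.
        x≉0 : NonZero x
        x≉0 = decidable-stable (Fin.any? λ i → ¬? (x i ≟0)) λ x≈0 →
          let zero-at = λ i → decidable-stable (x i ≟0) λ xi≉0 → x≈0 (i , xi≉0)
              x·y≈0 = λ y → ∑-0 λ i → trans (*-congʳ (zero-at i)) (zeroˡ (y i))
          in Qx<0 (nonNeg-resp (sym (trans (+-cong (x·y≈0 (L x)) (-‿cong (x·y≈0 x))) (-‿inverseʳ 0#))) nonNeg-0)
        extend : V → Fin (suc m) → V
        extend w zero    = w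
        extend w (suc i) = W i
        extended : ∀ w → w ⟂ W → NonZero w → ∃[ κ ] (∀ j → L w j ≈ κ · w j) → OrthogonalEigenvectors (extend w)
        extended w w⊥W w≉0 eigen = record
          { nonZero    = λ { zero → w≉0 ; (suc i) → nonZero i }
          ; orthogonal = λ { zero zero 0≢0 → contradiction ≡.refl 0≢0
                           ; zero (suc j) _ → w⊥W j
                           ; (suc i) zero _ → trans (dot-comm (W i) w) (w⊥W i)
                           ; (suc i) (suc j) i≢j → orthogonal i j (i≢j ∘ ≡.cong suc) }
          ; eigenvalue = λ { zero → eigen ; (suc i) → eigenvalue i }
          ; constant   = suc (proj₁ constant) , proj₂ constant
          }

      spectral-gap : ∀ x → dot x ones ≈ 0# → ¬ ¬ NonNeg (Q x)
      spectral-gap x x⊥1 = descend (suc n) (ℕ.+-comm (suc n) 1) (λ _ → ones) record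
        { nonZero    = λ _ → zero , 1≉0
        ; orthogonal = λ { zero zero 0≢0 → contradiction ≡.refl 0≢0 }
        ; eigenvalue = λ _ → 0# , λ j → trans (∑-0 λ b → trans ([]-cong (does (j ~? b)) (-‿inverseʳ 1#)) ([]-0 (does (j ~? b))))
            (sym (zeroˡ 1#))
        ; constant   = zero , λ _ → refl
        } x (λ { zero → x⊥1 })

ℚ-field : OrderedField
ℚ-field = record
  { discreteField = record
    { scalars = ℚ.+-*-commutativeRing
    ; _≟0     = λ x → x ℚ.≟ ℚ.0ℚ
    ; inverse = λ x x≢0 → let instance _ = ℚ.≢-nonZero x≢0 in ℚ.1/ x , ℚ.*-inverseˡ x
    ; 1≉0     = λ ()
    }
  ; NonNeg        = ℚ.0ℚ ℚ.≤_
  ; nonNeg-resp   = λ { ≡.refl p → p }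
  ; nonNeg-0      = ℚ.≤-refl
  ; nonNeg-+      = ℚ.+-mono-≤
  ; nonNeg-*      = product
  ; nonNeg-square = square
  ; +-zero        = λ {x} {y} 0≤x 0≤y p → ℚ.≤-antisym
      (≡.subst₂ ℚ._≤_ (ℚ.+-identityʳ x) p (ℚ.+-monoʳ-≤ x 0≤y)) 0≤x
  }
  where
  product : ∀ {x y} → ℚ.0ℚ ℚ.≤ x → ℚ.0ℚ ℚ.≤ y → ℚ.0ℚ ℚ.≤ x ℚ.* y
  product {x} {y} 0≤x 0≤y = ≡.subst (ℚ._≤ x ℚ.* y) (ℚ.*-zeroˡ y)
    (ℚ.*-monoʳ-≤-nonNeg y {{ℚ.nonNegative 0≤y}} 0≤x)
  square : ∀ x → ℚ.0ℚ ℚ.≤ x ℚ.* x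
  square x with ℚ.≤-total ℚ.0ℚ x
  ... | inj₁ 0≤x = product 0≤x 0≤x
  ... | inj₂ x≤0 = ≡.subst (ℚ.0ℚ ℚ.≤_)
    (≡.trans (≡.sym (ℚ.neg-distribˡ-* x (ℚ.- x))) (≡.trans (≡.cong ℚ.-_ (≡.sym (ℚ.neg-distribʳ-* x x)))
      (ℚ-neg-involutive (x ℚ.* x))))
    (product (ℚ.neg-antimono-≤ x≤0) (ℚ.neg-antimono-≤ x≤0))
    where
    ℚ-neg-involutive : ∀ y → ℚ.- (ℚ.- y) ≡ y
    ℚ-neg-involutive = RingLemmas.-‿involutive ℚ.+-*-commutativeRing

-- A separating vertex of a connected integral graph is complete.

data View {n} (v : Fin (suc n)) : Fin (suc n) → Set where
  same  : View v v
  other : ∀ j → View v (punchIn v j)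

view : ∀ {n} (v u : Fin (suc n)) → View v u
view v u with v Fin.≟ u
... | yes ≡.refl = same
... | no v≢u     = ≡.subst (View v) (Fin.punchIn-punchOut v≢u) (other (punchOut v≢u))

-- `side` may lump several components of the graph without v together; constancy along edges and
-- both values being taken express that v separates.
module Separation (K : OrderedField) {n} (T : TranspositionSet (suc n))
  (connected : ∀ i j → Reachable G[ T ] i j) (integral : IntegralCay T) (v : Fin (suc n))
  (side : Fin n → Bool)
  (side-cong : ∀ {j l} → SimpleGraph._~_ (delete G[ T ] v) j l → side j ≡ side l)
  {j₁ j₂} (side₁ : side j₁ ≡ true) (side₂ : side j₂ ≡ false) where
  open SimpleGraph G[ T ]
  open OrderedField K
  open RingLemmas scalars
  open InnerProduct K
  open RayleighQuotient K T
  open Laplacian scalars G[ T ]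
  open Solver

  ∣A∣ ∣B∣ : Carrier
  ∣A∣ = sum λ j → [ side j ] 1#
  ∣B∣ = sum λ j → [ not (side j) ] 1#

  count-nonzero : ∀ (f : Fin n → Bool) j → f j ≡ true → ¬ sum (λ j → [ f j ] 1#) ≈ 0#
  count-nonzero f j fj p = 1≉0 (≡.subst (λ b → [ b ] 1# ≈ 0#) fj (∑-zero (λ l → nonNeg-[] (f l) 1-nonNeg) p j))

  y : Vect n
  y j = ∣B∣ · [ side j ] 1# + - ∣A∣ · [ not (side j) ] 1#

  x : Vect (suc n)
  x = insertAt y v 0#

  x-v : x v ≈ 0#
  x-v = reflexive (insertAt-lookup y v 0#)

  x-y : ∀ j → x (punchIn v j) ≈ y j
  x-y j = reflexive (insertAt-punchIn y v 0# j)

  y-nonzero : ∀ j → ¬ y j ≈ 0#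
  y-nonzero j = go (side j)
    where
    go : ∀ b → ¬ ∣B∣ · [ b ] 1# + - ∣A∣ · [ not b ] 1# ≈ 0#
    go true  p = count-nonzero (not ∘ side) j₂ (≡.cong not side₂) (trans
      (sym (trans (+-cong (*-identityʳ ∣B∣) (zeroʳ (- ∣A∣))) (+-identityʳ ∣B∣))) p)
    go false p = count-nonzero side j₁ side₁ (trans (sym (-‿involutive ∣A∣)) (trans (-‿cong (trans
      (sym (trans (+-cong (zeroʳ ∣B∣) (*-identityʳ (- ∣A∣))) (+-identityˡ (- ∣A∣)))) p)) -0#≈0#))

  y-cong : ∀ {j l} → punchIn v j ~ punchIn v l → y j ≈ y l
  y-cong j~l = reflexive (≡.cong (λ b → ∣B∣ · [ b ] 1# + - ∣A∣ · [ not b ] 1#) (side-cong j~l))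

  dot-x : ∀ z → dot x z ≈ sum (λ j → y j · z (punchIn v j))
  dot-x z = trans (sum-remove {i = v} (λ i → x i · z i)) (trans
    (+-cong (trans (*-congʳ x-v) (zeroˡ (z v))) (∑-cong λ j → *-congʳ {z (punchIn v j)} (x-y j))) (+-identityˡ _))

  x⊥1 : dot x (λ _ → 1#) ≈ 0#
  x⊥1 = begin
    dot x (λ _ → 1#)
      ≈⟨ trans (dot-x (λ _ → 1#)) (∑-cong λ j → *-identityʳ (y j)) ⟩
    sum y
      ≈⟨ ∑-distrib-+ (λ j → ∣B∣ · [ side j ] 1#) (λ j → - ∣A∣ · [ not (side j) ] 1#) ⟩
    sum (λ j → ∣B∣ · [ side j ] 1#) + sum (λ j → - ∣A∣ · [ not (side j) ] 1#)
      ≈⟨ +-cong (∑-·ˡ ∣B∣ (λ j → [ side j ] 1#)) (∑-·ˡ (- ∣A∣) (λ j → [ not (side j) ] 1#)) ⟩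
    ∣B∣ · ∣A∣ + - ∣A∣ · ∣B∣
      ≈⟨ solve 2 (λ a b → b :* a :+ (:- a) :* b := con 0ℤ) refl ∣A∣ ∣B∣ ⟩
    0# ∎

  -- Neighbours other than v carry the same value of x, so only a possible edge to v, where x is 0,
  -- contributes.
  L-x : ∀ j → laplacian x (punchIn v j) ≈ [ does (punchIn v j ~? v) ] y j
  L-x j = begin
    laplacian x u
      ≈⟨ sum-remove {i = v} (λ b → [ does (u ~? b) ] (x u - x b)) ⟩
    [ does (u ~? v) ] (x u - x v) + sum (λ l → [ does (u ~? punchIn v l) ] (x u - x (punchIn v l)))
      ≈⟨ +-cong ([]-cong (does (u ~? v)) (trans (+-cong (x-y j) (trans (-‿cong x-v) -0#≈0#)) (+-identityʳ (y j))))
           (∑-0 λ l → trans ([]-cong-dec (u ~? punchIn v l) (λ p →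
             trans (+-cong (trans (x-y j) (y-cong p)) (-‿cong (x-y l))) (-‿inverseʳ (y l)))) ([]-0 (does (u ~? punchIn v l)))) ⟩
    [ does (u ~? v) ] y j + 0#
      ≈⟨ +-identityʳ _ ⟩
    [ does (u ~? v) ] y j ∎
    where u = punchIn v j

  missing : Fin n → Carrier
  missing j = [ not (does (punchIn v j ~? v)) ] (y j · y j)

  missing-nonNeg : ∀ j → NonNeg (missing j)
  missing-nonNeg j = nonNeg-[] (not (does (punchIn v j ~? v))) (nonNeg-square (y j))

  -- Lx agrees with x at the neighbours of v and is 0 at the other vertices apart from v, where x v
  -- = 0 hides its value. So x·Lx falls short of x·x by the squares at the non-neighbours.
  deficit : (dot x (laplacian x) - dot x x) + sum missing ≈ 0#
  deficit = begin
    (dot x (laplacian x) - dot x x) + sum missing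
      ≈⟨ +-congʳ (+-cong (trans (dot-x (laplacian x)) (∑-cong λ j → *-congˡ {y j} (L-x j)))
           (-‿cong (trans (dot-x x) (∑-cong λ j → *-congˡ {y j} (x-y j))))) ⟩
    (sum adjacent - sum (λ j → y j · y j)) + sum missing
      ≈⟨ solve 3 (λ a b c → (a :- b) :+ c := (a :+ c) :- b) refl (sum adjacent) _ (sum missing) ⟩
    (sum adjacent + sum missing) - sum (λ j → y j · y j)
      ≈⟨ +-congʳ (trans (sym (∑-distrib-+ adjacent missing)) (∑-cong λ j → either (does (punchIn v j ~? v)) (y j))) ⟩
    sum (λ j → y j · y j) - sum (λ j → y j · y j)
      ≈⟨ -‿inverseʳ _ ⟩
    0# ∎
    where
    adjacent : Fin n → Carrier
    adjacent j = y j · [ does (punchIn v j ~? v) ] y j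
    either : ∀ b z → z · [ b ] z + [ not b ] (z · z) ≈ z · z
    either true  z = +-identityʳ _
    either false z = trans (+-congʳ (zeroʳ z)) (+-identityˡ _)

  -- Q x and the sum of `missing` are nonnegative with sum 0, so every missing square vanishes; but
  -- y is nowhere zero, so v has no non-neighbour.
  separating⇒complete : IsComplete G[ T ] v
  separating⇒complete u u≢v = go (view v u) u≢v
    where
    go : ∀ {u} → View v u → u ≢ v → v ~ u
    go same      u≢v = contradiction ≡.refl u≢v
    go (other j) _   = decidable-stable (v ~? punchIn v j) λ v≁u →
      spectral-gap connected integral x x⊥1 λ Q≥0 → y-nonzero j (square-zero (trans
        (sym (keep (punchIn v j ~? v) (v≁u ∘ ~-sym)))
        (∑-zero missing-nonNeg (+-zero (nonNeg-∑ missing-nonNeg) Q≥0 (trans (+-comm _ _) deficit)) j)))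
      where
      keep : ∀ (d : Dec (punchIn v j ~ v)) → ¬ punchIn v j ~ v → [ not (does d) ] (y j · y j) ≈ y j · y j
      keep (yes p) ¬p = contradiction p ¬p
      keep (no _)  _  = refl

cut-vertex⇒complete : ∀ {n} (T : TranspositionSet (suc n)) → IntegralCay T →
  (∀ i j → Reachable G[ T ] i j) → ∀ v → IsCutVertex G[ T ] v → IsComplete G[ T ] v
cut-vertex⇒complete {n} T integral connected v (k , k′ , (c , _) , (c′ , c′-onto , c′-reach) , k<k′) =
  -- The component `c v` inhabits `Fin k`, so k ≥ 1 and therefore k′ ≥ 2.
  two k′ c′ c′-onto (λ i j → Equivalence.from (c′-reach i j)) (ℕ.≤-trans (ℕ.s≤s (ℕ.>-nonZero⁻¹ k {{fin-nonZero (c v)}})) k<k′)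
  where
  open SimpleGraph G[ T ]
  fin-nonZero : ∀ {k} → Fin k → ℕ.NonZero k
  fin-nonZero zero    = _
  fin-nonZero (suc _) = _
  two : ∀ k (c : Fin n → Fin k) → (∀ i → ∃[ j ] (∀ {l} → l ≡ j → c l ≡ i)) →
        (∀ i j → Reachable (delete G[ T ] v) i j → c i ≡ c j) → 2 ℕ.≤ k → IsComplete G[ T ] v
  two (suc (suc k)) c onto reach _ = Separation.separating⇒complete ℚ-field T connected integral v
    -- A is the component numbered `zero`, B the union of all the others.
    (λ j → does (c j Fin.≟ zero)) (λ p → ≡.cong (λ i → does (i Fin.≟ zero)) (reach _ _ (p ◅ ε)))
    (≡.cong (λ i → does (i Fin.≟ zero)) (proj₂ (onto zero) ≡.refl))
    (≡.cong (λ i → does (i Fin.≟ zero)) (proj₂ (onto (suc zero)) ≡.refl))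
  two (suc zero) c onto reach (ℕ.s≤s ())

-- Simple paths, cycles, stars and trees.

module _ {n} (Γ : Graph n) where
  open SimpleGraph Γ

  record SimplePath (i j : Fin n) : Set where
    constructor simplePath
    field
      len       : ℕ
      p         : Fin (suc len) → Fin n
      start     : p zero ≡ i
      end       : p (fromℕ len) ≡ j
      injective : Injective _≡_ _≡_ p
      steps     : ∀ k → p (inject₁ k) ~ p (suc k)

  suffix : ∀ {j} len (p : Fin (suc len) → Fin n) → p (fromℕ len) ≡ j → Injective _≡_ _≡_ p →
           (∀ k → p (inject₁ k) ~ p (suc k)) → ∀ k → SimplePath (p k) j
  suffix len       p end inj steps zero    = simplePath len p ≡.refl end inj steps
  suffix (suc len) p end inj steps (suc k) =
    suffix len (p ∘ suc) end (Fin.suc-injective ∘ inj) (steps ∘ suc) k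

  cons : ∀ {i k j} → i ~ k → (sp : SimplePath k j) → (∀ l → SimplePath.p sp l ≢ i) → SimplePath i j
  cons {i} i~k (simplePath len p start end inj steps) i∉p = simplePath (suc len) p′ ≡.refl end inj′ steps′
    where
    p′ : Fin (suc (suc len)) → Fin n
    p′ zero    = i
    p′ (suc l) = p l
    inj′ : Injective _≡_ _≡_ p′
    inj′ {zero}  {zero}  _ = ≡.refl
    inj′ {zero}  {suc l} q = contradiction (≡.sym q) (i∉p l)
    inj′ {suc l} {zero}  q = contradiction q (i∉p l)
    inj′ {suc l} {suc m} q = ≡.cong suc (inj q)
    steps′ : ∀ l → p′ (inject₁ l) ~ p′ (suc l)
    steps′ zero    = ≡.subst (i ~_) (≡.sym start) i~k
    steps′ (suc l) = steps l

  -- If the new first vertex already lies on the simple path from the second one, the suffix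
  -- starting there is taken instead.
  reachable⇒simplePath : ∀ {i j} → Reachable Γ i j → SimplePath i j
  reachable⇒simplePath {i} ε = simplePath 0 (λ _ → i) ≡.refl ≡.refl (λ { {zero} {zero} _ → ≡.refl }) (λ ())
  reachable⇒simplePath {i} {j} (i~k ◅ k⇝j) = go (reachable⇒simplePath k⇝j)
    where
    go : SimplePath _ j → SimplePath i j
    go sp@(simplePath len p start end inj steps) with Fin.any? (λ l → p l Fin.≟ i)
    ... | yes (l , pl≡i) = ≡.subst (λ m → SimplePath m j) pl≡i (suffix len p end inj steps l)
    ... | no  i∉p        = cons i~k sp (λ l q → i∉p (l , q))

¬¬-all : ∀ {n} {P : Fin n → Set} → (∀ i → ¬ ¬ P i) → ¬ ¬ (∀ i → P i)
¬¬-all {zero}  p k = k λ ()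
¬¬-all {suc n} p k = p zero λ p₀ → ¬¬-all (p ∘ suc) λ ps → k λ { zero → p₀ ; (suc i) → ps i }

module _ {n} (Γ : Graph (suc n)) where
  open SimpleGraph Γ

  -- A simple path from i to j in the graph without v is closed up through v; i ≢ j gives it an
  -- edge, hence at least three vertices on the cycle.
  cycle-through : ∀ v {i j} → i ≢ j → v ~ punchIn v i → v ~ punchIn v j →
                  Reachable (delete Γ v) i j → Cycle Γ
  cycle-through v {i} {j} i≢j v~i v~j i⇝j = go (reachable⇒simplePath (delete Γ v) i⇝j)
    where
    go : SimplePath (delete Γ v) i j → Cycle Γ
    go (simplePath zero p start end inj steps) = contradiction (≡.trans (≡.sym start) end) i≢j
    go (simplePath (suc m) p start end inj steps) = record
      { m         = m
      ; c         = c
      ; injective = c-injective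
      ; steps     = c-steps
      ; closing   = ~-sym (≡.subst (λ k → v ~ punchIn v k) (≡.sym end) v~j)
      }
      where
      c : Fin (suc (suc (suc m))) → Fin (suc n)
      c zero    = v
      c (suc k) = punchIn v (p k)
      c-injective : Injective _≡_ _≡_ c
      c-injective {zero}  {zero}  _ = ≡.refl
      c-injective {zero}  {suc l} q = contradiction (≡.sym q) (Fin.punchInᵢ≢i v (p l))
      c-injective {suc k} {zero}  q = contradiction q (Fin.punchInᵢ≢i v (p k))
      c-injective {suc k} {suc l} q = ≡.cong suc (inj (Fin.punchIn-injective v _ _ q))
      c-steps : ∀ k → c (inject₁ k) ~ c (suc k)
      c-steps zero    = ≡.subst (λ k → v ~ punchIn v k) (≡.sym start) v~i
      c-steps (suc k) = steps k

  triangle : ∀ v {i j} → v ~ punchIn v i → v ~ punchIn v j → punchIn v i ~ punchIn v j → Cycle Γ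
  triangle v {i} {j} v~i v~j i~j = cycle-through v (λ { ≡.refl → ~-irrefl ≡.refl i~j }) v~i v~j (i~j ◅ ε)

  TwoNeighbours : Set
  TwoNeighbours = ∃[ v ] ∃₂ λ i j → i ≢ j × v ~ punchIn v i × v ~ punchIn v j

  two-neighbours : ∀ {v a b} → v ~ a → v ~ b → a ≢ b → TwoNeighbours
  two-neighbours {v} {a} {b} v~a v~b a≢b = go (view v a) (view v b) v~a v~b a≢b
    where
    go : ∀ {a b} → View v a → View v b → v ~ a → v ~ b → a ≢ b → TwoNeighbours
    go same      _         v~a _   _   = contradiction v~a (~-irrefl ≡.refl)
    go (other i) same      _   v~b _   = contradiction v~b (~-irrefl ≡.refl)
    go (other i) (other j) v~a v~b a≢b = v , i , j , a≢b ∘ ≡.cong (punchIn v) , v~a , v~b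

  -- A walk from a to z must leave the edge ab. A first step to c ≢ b gives a two neighbours; a step
  -- to b swaps the roles of the endpoints on a shorter walk.
  leaving-edge : ∀ {a b z} → a ~ b → z ≢ a → z ≢ b → Reachable Γ a z → TwoNeighbours
  leaving-edge a~b z≢a z≢b ε = contradiction ≡.refl z≢a
  leaving-edge {b = b} a~b z≢a z≢b (_◅_ {j = c} a~c c⇝z) with c Fin.≟ b
  ... | yes ≡.refl = leaving-edge (~-sym a~b) z≢b z≢a c⇝z
  ... | no c≢b     = two-neighbours a~c a~b c≢b

  -- An edge between two vertices other than v would close a triangle with v.
  complete⇒star : ∀ v → IsComplete Γ v → ¬ Cycle Γ → Γ ≅ K 1 n
  complete⇒star v complete acyclic = record
    { bijection = mk↔ₛ′ to from to-from (λ u → from-to (view v u))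
    ; adjacency = λ u w → adjacency (view v u) (view v w)
    }
    where
    to′ : ∀ {u} → View v u → Fin 1 ⊎ Fin n
    to′ same      = inj₁ zero
    to′ (other j) = inj₂ j

    to : Fin (suc n) → Fin 1 ⊎ Fin n
    to u = to′ (view v u)

    from : Fin 1 ⊎ Fin n → Fin (suc n)
    from (inj₁ _) = v
    from (inj₂ j) = punchIn v j

    from-to′ : ∀ {u} (w : View v u) → from (to′ w) ≡ u
    from-to′ same      = ≡.refl
    from-to′ (other j) = ≡.refl

    from-to : ∀ {u} → View v u → from (to u) ≡ u
    from-to {u} _ = from-to′ (view v u)

    from-injective : ∀ {a b} → from a ≡ from b → a ≡ b
    from-injective {inj₁ zero} {inj₁ zero} _ = ≡.refl
    from-injective {inj₁ zero} {inj₂ j}    q = contradiction (≡.sym q) (Fin.punchInᵢ≢i v j)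
    from-injective {inj₂ i}    {inj₁ zero} q = contradiction q (Fin.punchInᵢ≢i v i)
    from-injective {inj₂ i}    {inj₂ j}    q = ≡.cong inj₂ (Fin.punchIn-injective v i j q)

    to-from : ∀ a → to (from a) ≡ a
    to-from a = from-injective (from-to′ (view v (from a)))

    open SimpleGraph (K 1 n) using () renaming (_~_ to _~ᴷ_)

    spoke : ∀ j → v ~ punchIn v j
    spoke j = complete (punchIn v j) (Fin.punchInᵢ≢i v j)

    adjacency-from : ∀ a b → from a ~ from b ⇔ a ~ᴷ b
    adjacency-from (inj₁ _) (inj₁ _) = mk⇔ (~-irrefl ≡.refl) λ ()
    adjacency-from (inj₁ _) (inj₂ j) = mk⇔ _ λ _ → spoke j
    adjacency-from (inj₂ i) (inj₁ _) = mk⇔ _ λ _ → ~-sym (spoke i)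
    adjacency-from (inj₂ i) (inj₂ j) = mk⇔ (λ i~j → acyclic (triangle v (spoke i) (spoke j) i~j)) λ ()

    adjacency : ∀ {u w} (u′ : View v u) (w′ : View v w) → u ~ w ⇔ to u ~ᴷ to w
    adjacency {u} {w} _ _ = ≡.subst₂ (λ a b → a ~ b ⇔ to u ~ᴷ to w) (from-to′ (view v u)) (from-to′ (view v w))
      (adjacency-from (to u) (to w))

tree⇒complete : ∀ {n} (T : TranspositionSet (suc n)) → IntegralCay T → IsTree G[ T ] →
                ∃ (IsComplete G[ T ])
tree⇒complete {zero}  T integral tree = zero , λ { zero 0≢0 → contradiction ≡.refl 0≢0 }
tree⇒complete {suc n} T integral ((_ , connected) , acyclic) = first (connected zero (suc zero))
  where
  open SimpleGraph G[ T ]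

  inner : TwoNeighbours G[ T ] → ∃ (IsComplete G[ T ])
  inner (v , i , j , i≢j , v~i , v~j) = v , λ u u≢v → decidable-stable (v ~? u) λ v≁u →
    -- The sides are the component of i in the graph without v and its complement; acyclicity puts j
    -- in the latter. Reachability is decided only under double negation, for all finitely many l at
    -- once.
    ¬¬-all (λ l → decided l) λ reach? → v≁u (Separation.separating⇒complete ℚ-field T connected integral v
      (λ l → does (reach? l)) (λ {l} {m} l~m → same-side l~m (reach? l) (reach? m))
      (on (reach? i) ε) (off (reach? j) λ i⇝j → acyclic (cycle-through G[ T ] v i≢j v~i v~j i⇝j)) u u≢v)
    where
    R : Fin (suc n) → Set
    R = Reachable (delete G[ T ] v) i
    decided : ∀ l → ¬ ¬ Dec (R l)
    decided l k = k (no (k ∘ yes))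
    on : ∀ {P : Set} (d : Dec P) → P → does d ≡ true
    on (yes _) _ = ≡.refl
    on (no ¬p) p = contradiction p ¬p
    off : ∀ {P : Set} (d : Dec P) → ¬ P → does d ≡ false
    off (yes p) ¬p = contradiction p ¬p
    off (no _)  _  = ≡.refl
    same-side : ∀ {l m} → punchIn v l ~ punchIn v m → (d : Dec (R l)) (e : Dec (R m)) → does d ≡ does e
    same-side l~m (yes p) e = ≡.sym (on e (p ◅◅ (l~m ◅ ε)))
    same-side l~m (no ¬p) e = ≡.sym (off e λ q → ¬p (q ◅◅ (~-sym l~m ◅ ε)))

  first : Reachable G[ T ] zero (suc zero) → ∃ (IsComplete G[ T ])
  first (_◅_ {j = y} 0~y _) with Fin.any? (λ z → ¬? (z Fin.≟ zero) ×-dec ¬? (z Fin.≟ y))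
  ... | yes (z , z≢0 , z≢y) = inner (leaving-edge G[ T ] 0~y z≢0 z≢y (connected zero z))
  -- There is no third vertex: the tree is a single edge, and either end is complete.
  ... | no none = zero , λ u u≢0 → ≡.subst (zero ~_)
    (≡.sym (decidable-stable (u Fin.≟ y) λ u≢y → none (u , u≢0 , u≢y))) 0~y

-- Stars are integral, and the theorem.

empty : ∀ n → TranspositionSet n
empty n = record
  { _∈T = λ _ → ⊥ ; _∈T? = λ _ → no λ () ; ∈T-resp = λ _ () ; transpositions = λ () }

-- The operator is 0, so μ · x i = 0 at a coordinate where x i is invertible.
empty-integral : ∀ n → IntegralCay (empty (suc n))
empty-integral n F char0 μ eig = 0ℤ , μ≈0
  where
  open RingLemmas (commRing F)
  open PairSum (commRing F)
  open Operator F
  open FieldLemmas F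
  eigenvector = eigenvalue⇒ (empty (suc n)) {μ} eig
  x = proj₁ eigenvector
  i = proj₁ (proj₁ (proj₂ eigenvector))
  μx≈0 : μ · x i ≈ 0#
  μx≈0 = trans (sym (proj₂ (proj₂ eigenvector) i)) (pairSum-0 {suc n} (λ _ _ → 0#) λ _ _ _ → refl)
  μ≈0 : μ ≈ 0#
  μ≈0 = let z , z·x≈1 = #0⇒unit (proj₂ (proj₁ (proj₂ eigenvector))) in begin
    μ              ≈⟨ *-identityʳ μ ⟨
    μ · 1#         ≈⟨ *-congˡ (trans (sym z·x≈1) (*-comm z (x i))) ⟩
    μ · (x i · z)  ≈⟨ *-assoc μ (x i) z ⟨
    μ · x i · z    ≈⟨ trans (*-congʳ μx≈0) (zeroˡ z) ⟩
    0#             ∎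

-- Isolating the centre of a star leaves no edges, so the equivalence for complete vertices applies
-- with T′ empty.
star⇒integral : ∀ {n} (T : TranspositionSet (suc n)) → G[ T ] ≅ K 1 n → IntegralCay T
star⇒integral {n} T iso = Equivalence.from (complete-vertex-integral T (empty (suc n)) v complete isolated)
  (empty-integral n)
  where
  open SimpleGraph G[ T ]
  open _≅_ iso
  open Inverse bijection using (to; from; strictlyInverseʳ)
  open SimpleGraph (K 1 n) using () renaming (_~_ to _~ᴷ_)
  v = from (inj₁ zero)

  unique : ∀ {u} → to u ≡ inj₁ zero → u ≡ v
  unique {u} q = ≡.trans (≡.sym (strictlyInverseʳ u)) (≡.cong from q)

  to-v : to v ≡ inj₁ zero
  to-v = Inverse.strictlyInverseˡ bijection (inj₁ zero)

  adjacentᴷ : ∀ {u} a → to u ≡ a → u ≢ v → inj₁ zero ~ᴷ a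
  adjacentᴷ (inj₁ zero) q u≢v = contradiction (unique q) u≢v
  adjacentᴷ (inj₂ _)    _ _   = _

  independentᴷ : ∀ {u w} a b → to u ≡ a → to w ≡ b → u ≢ v → w ≢ v → ¬ a ~ᴷ b
  independentᴷ (inj₁ zero) _           p _ u≢v _   _ = u≢v (unique p)
  independentᴷ (inj₂ _)    (inj₁ zero) _ q _   w≢v _ = w≢v (unique q)

  complete : IsComplete G[ T ] v
  complete u u≢v = Equivalence.from (adjacency v u)
    (≡.subst (_~ᴷ to u) (≡.sym to-v) (adjacentᴷ (to u) ≡.refl u≢v))

  isolated : G[ empty (suc n) ] ≐ isolate G[ T ] v
  isolated u w = mk⇔ (λ ()) λ (u≢v , w≢v , u~w) →
    independentᴷ (to u) (to w) ≡.refl ≡.refl u≢v w≢v (Equivalence.to (adjacency u w) u~w)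

corollary1 : ∀ {n : ℕ} (T : TranspositionSet n) →
    (Connected G[ T ] → (v : Fin n) → IsCutVertex G[ T ] v →
    (T′ : TranspositionSet n) → G[ T′ ] ≐ isolate G[ T ] v →
    IntegralCay T ⇔ (IsComplete G[ T ] v × IntegralCay T′))
    ×
    (IsTree G[ T ] → IntegralCay T ⇔ (G[ T ] ≅ K 1 (n ∸ 1)))
corollary1 {zero}  T = (λ { (() , _) }) , λ { ((() , _) , _) }
corollary1 {suc n} T =
    (λ (_ , connected) v cut T′ T′≐ → mk⇔
      (λ integral → let complete = cut-vertex⇒complete T integral connected v cut in
        complete , Equivalence.to (complete-vertex-integral T T′ v complete T′≐) integral)
      (λ (complete , integral′) → Equivalence.from (complete-vertex-integral T T′ v complete T′≐) integral′))
  , λ tree → mk⇔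
      (λ integral → let v , complete = tree⇒complete T integral tree in
        complete⇒star G[ T ] v complete (proj₂ tree))
      (star⇒integral T)
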